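{- Let $G$ be a connected 4-regular graph and let $v$ and $w$ be vertices of $G$. Then \[ c_2^{(2)}(G - v) = c_2^{(2)}(G - w). \]
   Context: For a graph $H$, $H-v$ denotes the graph obtained by deleting the vertex $v$ and all edges incident to it. For a connected graph $H$ with at least $3$ vertices, assign a variable $\alpha_e$ to each edge $e$ and define the Kirchhoff polynomial $\Psi_H=\sum_{T}\prod_{e\notin T}\alpha_e$, the sum running over all spanning trees $T$ of $H$. For a prime $p$, let $[\Psi_H]_p$ be the number of zeros of $\Psi_H$ in $\mathbb{F}_p^{|E(H)|}$; this number is divisible by $p^2$, and the $c_2$-invariant is $c_2^{(p)}(H)\equiv [\Psi_H]_p/p^2 \pmod p$, viewed as an element of $\mathbb{Z}/p\mathbb{Z}$. -}

module Defs where

open import Data.Nat using (ℕ; zero; suc; _+_; _*_; NonZero; _/_; _%_)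
open import Data.Nat.Properties using (m*n≢0)
open import Data.Bool using (if_then_else_)
open import Data.Fin as Fin using (Fin; zero; suc; toℕ; punchOut)
open import Data.Fin.Subset using (Subset; inside; outside; _∈_; ⊤)
open import Data.List as List using (List; []; _∷_; length; filter; mapMaybe; allFin; concatMap; map)
open import Data.Nat.ListAction using (sum; product)
open import Data.List.Relation.Unary.Unique.Propositional using (Unique)
import Data.List.Membership.Propositional as LM
open import Data.Vec as Vec using (Vec; []; _∷_; _[_]≔_; zipWith; toList)
open import Data.Maybe using (Maybe; just; nothing)
open import Data.Product using (_×_; _,_; proj₁; proj₂)
open import Data.Sum using (_⊎_)
open import Function.Bundles using (_⇔_)
open import Relation.Binary.PropositionalEquality using (_≡_; _≢_)
open import Relation.Nullary using (¬_; yes; no)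

-- Finite multigraphs: vertices Fin nV, edges a list of endpoint pairs
-- (parallel edges allowed; loops are excluded by a separate hypothesis).

record Graph : Set where
  constructor graph
  field
    nV    : ℕ
    edges : List (Fin nV × Fin nV)

open Graph public

nE : Graph → ℕ
nE G = length (edges G)

ends : (G : Graph) → Fin (nE G) → Fin (nV G) × Fin (nV G)
ends G e = List.lookup (edges G) e

EdgeSet : Graph → Set
EdgeSet G = Subset (nE G)

Joins : (G : Graph) → Fin (nE G) → Fin (nV G) → Fin (nV G) → Set
Joins G e u w = (ends G e ≡ (u , w)) ⊎ (ends G e ≡ (w , u))

data Reach (G : Graph) (T : EdgeSet G) : Fin (nV G) → Fin (nV G) → Set where
  here : ∀ {u} → Reach G T u u
  step : ∀ {u w x} (e : Fin (nE G)) → e ∈ T → Joins G e u w → Reach G T w x → Reach G T u x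

ConnectedVia : (G : Graph) → EdgeSet G → Set
ConnectedVia G T = ∀ u w → Reach G T u w

-- the spanning subgraph (V(G), T) has no cycle: every edge of T is a bridge of T
AcyclicVia : (G : Graph) → EdgeSet G → Set
AcyclicVia G T = ∀ e → e ∈ T → ¬ Reach G (T [ e ]≔ outside) (proj₁ (ends G e)) (proj₂ (ends G e))

SpanningTree : (G : Graph) → EdgeSet G → Set
SpanningTree G T = ConnectedVia G T × AcyclicVia G T

Connected : Graph → Set
Connected G = ConnectedVia G ⊤

Loopless : Graph → Set
Loopless G = ∀ e → proj₁ (ends G e) ≢ proj₂ (ends G e)

-- degree (a loop would count twice)
degree : (G : Graph) → Fin (nV G) → ℕ
degree G u = length (filter (λ ab → proj₁ ab Fin.≟ u) (edges G))
           + length (filter (λ ab → proj₂ ab Fin.≟ u) (edges G))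

deleteVertex : (G : Graph) → Fin (nV G) → Graph
deleteVertex (graph (suc k) E) v = graph k (mapMaybe f E)
  where
  f : Fin (suc k) × Fin (suc k) → Maybe (Fin k × Fin k)
  f (a , b) with v Fin.≟ a | v Fin.≟ b
  ... | no v≢a | no v≢b = just (punchOut v≢a , punchOut v≢b)
  ... | _      | _      = nothing

_─_ : (G : Graph) → Fin (nV G) → Graph
G ─ v = deleteVertex G v

EnumeratesSpanningTrees : (H : Graph) → List (EdgeSet H) → Set
EnumeratesSpanningTrees H L = Unique L × (∀ T → (T LM.∈ L) ⇔ SpanningTree H T)

monomial : ∀ {p m} → Subset m → Vec (Fin p) m → ℕ
monomial T x = product (toList (zipWith (λ s xe → if s then 1 else toℕ xe) T x))

-- Ψ_H(x) = Σ_T ∏_{e∉T} x_e  (as a natural number; reduce mod p afterwards)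
ΨAt : ∀ {p} (H : Graph) → List (EdgeSet H) → Vec (Fin p) (nE H) → ℕ
ΨAt H L x = sum (map (λ T → monomial T x) L)

allPoints : (p m : ℕ) → List (Vec (Fin p) m)
allPoints p zero    = [] ∷ []
allPoints p (suc m) = concatMap (λ a → map (a ∷_) (allPoints p m)) (allFin p)

zeroCount : (p : ℕ) .{{_ : NonZero p}} (H : Graph) → List (EdgeSet H) → ℕ
zeroCount p H L = length (filter (λ x → ΨAt H L x % p Data.Nat.≟ 0) (allPoints p (nE H)))

c2 : (p : ℕ) .{{_ : NonZero p}} (H : Graph) → List (EdgeSet H) → ℕ
c2 p H L = (_/_ (zeroCount p H L) (p * p) {{m*n≢0 p p}}) % p

{-# OPTIONS --safe #-}

-- Let σ(G ─ v) be the number of ordered partitions of the edges of G ─ v into two spanning trees.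
-- A vertex u ≠ v of the 4-regular graph G can be eliminated: σ(G ─ v) is the sum of σ(G′ ─ v) over
-- the three graphs G′ in which u is replaced by two edges pairing its four neighbours, where a new
-- loop contributes 0.  When only v and w are left this count is visibly symmetric, hence
-- σ(G ─ v) = σ(G ─ w).
--
-- If G has at least five vertices, σ(G ─ v) is congruent modulo 8 to the number of points of 𝔽₂^E
-- at which Ψ is odd.  For a neighbour w of v of degree three in G ─ v write f₀ for the polynomial of
-- the spanning trees of G ─ v ─ w and S for that of its spanning 2-forests separating the neighbours
-- of w.  By Dodgson's identity, summing over the variables of the three edges at w leaves
-- 4·(f₀ + S + f₀S) modulo 8, and summing over the other variables extracts the top degree part of
-- f₀S, whose terms are the pairs of a tree and a complementary 2-forest; there are σ(G ─ v)/4 of them.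
--
-- Spanning trees are recognised by determinants over 𝔽₂ (a square matrix has determinant 1 iff its
-- kernel is trivial), so neither signs nor orderings of rows occur.

module Submission where

open import Defs
open import Data.Bool as Bool using (Bool; true; false; not; _∧_; _∨_; _xor_; if_then_else_)
open import Data.Bool.Properties as Boolₚ using (xor-comm; xor-assoc; xor-same; xor-identityʳ; ∧-comm; ∧-zeroʳ; ¬-not)
open import Data.Empty using (⊥; ⊥-elim)
open import Data.Fin as Fin using (Fin; zero; suc)
open import Data.Fin.Patterns using (0F; 1F; 2F; 3F)
import Data.Fin.Properties as Finₚ
open import Data.Fin.Subset using (outside) renaming (_∈_ to _∈ˢ_)
open import Data.List as List using (List; []; _∷_; length; _++_; map)
open import Data.List.Membership.Propositional using (_∈_)
open import Data.List.Membership.Propositional.Properties using (∈-∃++; ∈-++⁺ˡ; ∈-filter⁺; ∈-allFin)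
import Data.List.Properties as Listₚ
open import Data.List.Relation.Binary.Permutation.Propositional using (_↭_; ↭-refl; ↭-sym; ↭-trans; prep; swap; refl)
open import Data.List.Relation.Binary.Permutation.Propositional.Properties using (All-resp-↭; ↭-length; map⁺; catMaybes-↭; ++⁺ˡ; ++⁺ʳ; shift; shifts)
open import Data.List.Relation.Unary.All as All using (All; []; _∷_)
import Data.List.Relation.Unary.All.Properties as Allₚ
open import Data.List.Relation.Unary.AllPairs using (AllPairs; []; _∷_)
open import Data.List.Relation.Unary.Any using (here; there)
open import Data.List.Relation.Unary.Unique.Propositional using (Unique)
import Data.List.Relation.Unary.Unique.Propositional.Properties as Uniqueₚ
open import Data.Maybe as Maybe using (Maybe; just; nothing)
open import Data.Maybe.Relation.Unary.All as MAll using (just; nothing)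
open import Data.Nat as ℕ using (ℕ; zero; suc; _+_; _*_; _^_; _≤_; _<_; z≤n; s≤s)
open import Data.Nat.DivMod using (_%_; _/_; [m+n]%n≡m%n; [m+kn]%n≡m%n; %-distribˡ-+; m%[n*o]/o≡m/o%n; m*n%n≡0)
open import Data.Nat.ListAction using (sum)
import Data.Nat.Properties as ℕₚ
open import Data.Nat.Tactic.RingSolver using (solve-∀)
open import Data.Product using (Σ; ∃; _×_; _,_; proj₁; proj₂)
open import Data.Sum using (_⊎_; inj₁; inj₂)
open import Data.Unit using (⊤; tt)
open import Data.Vec as Vec using (Vec; []; _∷_; zipWith; replicate; lookup)
import Data.Vec.Properties as Vecₚ
open import Function using (_∘_; case_of_)
open import Function.Bundles using (Equivalence)
open import Relation.Binary.Definitions as Tri using (Tri)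
open import Relation.Binary.PropositionalEquality using (_≡_; _≢_; refl; sym; trans; cong; cong₂; subst; subst₂; module ≡-Reasoning)
open import Relation.Nullary using (¬_; Dec; yes; no; does; contradiction)
open import Relation.Nullary.Decidable using (map′; dec-true; dec-false; _×-dec_; ¬?)

-- Dividing the number of zeros by 4 and reducing modulo 2 only uses that number modulo 8. Zeros and
-- nonzeros together number 2 to the power of the edge count, which is the same for G ─ v and G ─ w;
-- so nonzeros modulo 8 are compared. The elimination of `u` must hold for counts in ℕ, whereas
-- determinants over 𝔽₂ give it only modulo 2. The gap is a single configuration, and it is excluded
-- because the intersection of two cuts that avoid the given edges avoids them too. A neighbour of v
-- of degree three in G ─ v exists unless v is joined to its neighbours with multiplicities 2+2 or
-- 4. Then series reductions or a disconnection show that both counts vanish modulo 8. All matrices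
-- keep one column for each vertex of G. Deleting v, choosing a root and eliminating `u` each just
-- add a ground row `unit`, so that G ─ v and G ─ w are treated in the same space. Only the
-- comparison with the graph in the statement removes a column.

Bits : ℕ → Set
Bits = Vec Bool

private variable
  k m n : ℕ
  X X′ : Set

xor-interchange : ∀ a b c d → (a xor b) xor (c xor d) ≡ (a xor c) xor (b xor d)
xor-interchange false false c d = refl
xor-interchange false true  c d = Boolₚ.not-distribʳ-xor c d
xor-interchange true  false c d = Boolₚ.not-distribˡ-xor c d
xor-interchange true  true  false d = sym (Boolₚ.not-involutive d)
xor-interchange true  true  true  d = refl

-- Linear algebra over 𝔽₂

infixr 6 _⊕_
_⊕_ : Bits n → Bits n → Bits n
_⊕_ = zipWith _xor_

𝟎 : Bits n
𝟎 = replicate _ false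

dot : Bits n → Bits n → Bool
dot []      []      = false
dot (a ∷ r) (b ∷ s) = (a ∧ b) xor dot r s

unit : Fin n → Bits n
unit zero    = true ∷ 𝟎
unit (suc i) = false ∷ unit i

dot-comm : (r s : Bits n) → dot r s ≡ dot s r
dot-comm []      []      = refl
dot-comm (a ∷ r) (b ∷ s) = cong₂ _xor_ (∧-comm a b) (dot-comm r s)

dot-𝟎ˡ : (s : Bits n) → dot 𝟎 s ≡ false
dot-𝟎ˡ []      = refl
dot-𝟎ˡ (_ ∷ s) = dot-𝟎ˡ s

dot-𝟎ʳ : (r : Bits n) → dot r 𝟎 ≡ false
dot-𝟎ʳ r = trans (dot-comm r 𝟎) (dot-𝟎ˡ r)

dot-⊕ˡ : (r r′ s : Bits n) → dot (r ⊕ r′) s ≡ dot r s xor dot r′ s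
dot-⊕ˡ []      []        []      = refl
dot-⊕ˡ (a ∷ r) (a′ ∷ r′) (b ∷ s) =
  trans (cong₂ _xor_ (Boolₚ.∧-distribʳ-xor b a a′) (dot-⊕ˡ r r′ s))
          (xor-interchange (a ∧ b) (a′ ∧ b) (dot r s) (dot r′ s))

dot-⊕ʳ : (r s s′ : Bits n) → dot r (s ⊕ s′) ≡ dot r s xor dot r s′
dot-⊕ʳ r s s′ = trans (dot-comm r _)
  (trans (dot-⊕ˡ s s′ r) (cong₂ _xor_ (dot-comm s r) (dot-comm s′ r)))

dot-unit : (i : Fin n) (s : Bits n) → dot (unit i) s ≡ lookup s i
dot-unit zero    (b ∷ s) = trans (cong (b xor_) (dot-𝟎ˡ s)) (xor-identityʳ b)
dot-unit (suc i) (b ∷ s) = dot-unit i s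

⊕-self : (s : Bits n) → s ⊕ s ≡ 𝟎
⊕-self []      = refl
⊕-self (b ∷ s) = cong₂ _∷_ (xor-same b) (⊕-self s)

⊕-comm : (r s : Bits n) → r ⊕ s ≡ s ⊕ r
⊕-comm = Vecₚ.zipWith-comm xor-comm

⊕≡𝟎⇒≡ : (r s : Bits n) → r ⊕ s ≡ 𝟎 → r ≡ s
⊕≡𝟎⇒≡ []          []          _  = refl
⊕≡𝟎⇒≡ (false ∷ r) (false ∷ s) eq = cong (false ∷_) (⊕≡𝟎⇒≡ r s (cong Vec.tail eq))
⊕≡𝟎⇒≡ (true ∷ r)  (true ∷ s)  eq = cong (true ∷_) (⊕≡𝟎⇒≡ r s (cong Vec.tail eq))
⊕≡𝟎⇒≡ (false ∷ r) (true ∷ s)  ()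
⊕≡𝟎⇒≡ (true ∷ r)  (false ∷ s) ()

_≟ᵛ_ : (r s : Bits n) → Dec (r ≡ s)
_≟ᵛ_ = Vecₚ.≡-dec Bool._≟_

search : {P : Bits n → Set} → (∀ s → Dec (P s)) → Dec (∃ P)
search {zero}  P? = map′ ([] ,_) (λ { ([] , p) → p }) (P? [])
search {suc n} P? with search (λ s → P? (false ∷ s)) | search (λ s → P? (true ∷ s))
... | yes (s , p) | _           = yes (false ∷ s , p)
... | no _        | yes (s , p) = yes (true ∷ s , p)
... | no ¬p       | no ¬q       = no λ { (false ∷ s , p) → ¬p (s , p) ; (true ∷ s , p) → ¬q (s , p) }

Null : List (Bits n) → Bits n → Set
Null rows s = All (λ r → dot r s ≡ false) rows

null? : (rows : List (Bits n)) (s : Bits n) → Dec (Null rows s)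
null? rows s = All.all? (λ r → dot r s Bool.≟ false) rows

null-⊕ : (rows : List (Bits n)) {s s′ : Bits n} → Null rows s → Null rows s′ → Null rows (s ⊕ s′)
null-⊕ rows ns ns′ = All.zipWith (λ { {r} (p , q) → trans (dot-⊕ʳ r _ _) (cong₂ _xor_ p q) }) (ns , ns′)

Singular : List (Bits n) → Set
Singular rows = ∃ λ s → s ≢ 𝟎 × Null rows s

singular? : (rows : List (Bits n)) → Dec (Singular rows)
singular? rows = search λ s → ¬? (s ≟ᵛ 𝟎) ×-dec null? rows s

eliminate : Bits n → Bits (suc n) → Bits n
eliminate r₀ (true  ∷ r) = r ⊕ r₀
eliminate r₀ (false ∷ r) = r

-- `dot r₀ s ∷ s` is the general vector killed by the pivot row `true ∷ r₀`; on these vectors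
-- elimination does not change what a row does.
dot-eliminate : (r₀ : Bits n) (r : Bits (suc n)) (s : Bits n) →
                dot r (dot r₀ s ∷ s) ≡ dot (eliminate r₀ r) s
dot-eliminate r₀ (true  ∷ r) s = trans (xor-comm (dot r₀ s) _) (sym (dot-⊕ˡ r r₀ s))
dot-eliminate r₀ (false ∷ r) s = refl

pivot : (rows : List (Bits (suc n))) →
        All (λ r → Vec.head r ≡ false) rows ⊎ ∃ λ r₀ → ∃ λ rest → rows ↭ (true ∷ r₀) ∷ rest
pivot [] = inj₁ []
pivot ((true ∷ r) ∷ rows) = inj₂ (r , rows , ↭-refl)
pivot ((false ∷ r) ∷ rows) with pivot rows
... | inj₁ all              = inj₁ (refl ∷ all)
... | inj₂ (r₀ , rest , p) = inj₂ (r₀ , (false ∷ r) ∷ rest , ↭-trans (prep _ p) (swap _ _ ↭-refl))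

nullVector : (rows : List (Bits n)) → length rows < n → Singular rows
nullVector {zero}  rows ()
nullVector {suc n} rows lt with pivot rows
... | inj₁ heads = true ∷ 𝟎 , (λ ()) , All.map (λ { {b ∷ r} refl → dot-𝟎ʳ r }) heads
... | inj₂ (r₀ , rest , p) with nullVector (map (eliminate r₀) rest) shorter
  where
  shorter : length (map (eliminate r₀) rest) < n
  shorter = subst (_< n) (sym (Listₚ.length-map (eliminate r₀) rest))
    (ℕₚ.≤-pred (subst (λ l → suc l ≤ suc n) (↭-length p) lt))
...   | s , s≢𝟎 , ns = dot r₀ s ∷ s , (λ eq → s≢𝟎 (cong Vec.tail eq)) ,
  All-resp-↭ (↭-sym p) (xor-same (dot r₀ s) ∷ nulls rest ns)
  where
  nulls : ∀ rest → Null (map (eliminate r₀) rest) s → Null rest (dot r₀ s ∷ s)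
  nulls []         []       = []
  nulls (r ∷ rest) (p ∷ ps) = trans (dot-eliminate r₀ r s) p ∷ nulls rest ps

-- The determinant of a square matrix over 𝔽₂ is 1 exactly when the matrix is nonsingular;
-- lists of the wrong length get the value 0.
opaque
  det : List (Bits n) → Bool
  det {n} rows = does (length rows ℕ.≟ n) ∧ not (does (singular? rows))

opaque
  unfolding det

  det-singular : (rows : List (Bits n)) → Singular rows → det rows ≡ false
  det-singular {n} rows sing rewrite dec-true (singular? rows) sing = ∧-zeroʳ _

  det-length : (rows : List (Bits n)) → length rows ≢ n → det rows ≡ false
  det-length {n} rows ≢n rewrite dec-false (length rows ℕ.≟ n) ≢n = refl

  det-nonsingular : (rows : List (Bits n)) → length rows ≡ n → ¬ Singular rows → det rows ≡ true
  det-nonsingular {n} rows len ¬sing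
    rewrite dec-true (length rows ℕ.≟ n) len | dec-false (singular? rows) ¬sing = refl

det-true : (rows : List (Bits n)) → det rows ≡ true → length rows ≡ n × ¬ Singular rows
det-true {n} rows eq = decide (length rows ℕ.≟ n) (singular? rows)
  where
  decide : Dec (length rows ≡ n) → Dec (Singular rows) → length rows ≡ n × ¬ Singular rows
  decide (yes len) (no ¬sing) = len , ¬sing
  decide (yes len) (yes sing) = contradiction (trans (sym eq) (det-singular rows sing)) λ ()
  decide (no ¬len) _          = contradiction (trans (sym eq) (det-length rows ¬len)) λ ()

-- Only the shape and the existence of a kernel vector matter, so matrices of different sizes can be
-- compared; `det-insertZero` relies on this.
det-cong : ∀ {m} (A : List (Bits m)) (B : List (Bits n)) →
           (length A ≡ m → length B ≡ n) → (length B ≡ n → length A ≡ m) →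
           (Singular A → Singular B) → (Singular B → Singular A) → det A ≡ det B
det-cong {n} {m} A B l l′ f g = decide (length A ℕ.≟ m) (singular? A)
  where
  decide : Dec (length A ≡ m) → Dec (Singular A) → det A ≡ det B
  decide (no ¬l)  _       = trans (det-length A ¬l) (sym (det-length B (¬l ∘ l′)))
  decide (yes la) (yes s) = trans (det-singular A s) (sym (det-singular B (f s)))
  decide (yes la) (no ¬s) = trans (det-nonsingular A la ¬s) (sym (det-nonsingular B (l la) (¬s ∘ g)))

det-↭ : {A B : List (Bits n)} → A ↭ B → det A ≡ det B
det-↭ {n} {A} {B} p = det-cong A B (trans (sym (↭-length p))) (trans (↭-length p))
  (λ { (s , nz , k) → s , nz , All-resp-↭ p k }) (λ { (s , nz , k) → s , nz , All-resp-↭ (↭-sym p) k })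

-- A definition by kernels hides that `det` is linear in the first row; `axis` exhibits it as a dot
-- product. `axis≡` lets a known kernel vector `z` play the part of `axis`, up to vanishing.
record Cross (A : List (Bits n)) : Set where
  field
    axis  : Bits n
    det-∷ : ∀ r → det (r ∷ A) ≡ dot r axis
    axis≡ : ∀ z → z ≢ 𝟎 → Null A z → axis ≡ 𝟎 ⊎ axis ≡ z

private
  zeroCross : (A : List (Bits n)) → (∀ r → det (r ∷ A) ≡ false) → Cross A
  zeroCross A eq = record
    { axis = 𝟎 ; det-∷ = λ r → trans (eq r) (sym (dot-𝟎ʳ r)) ; axis≡ = λ _ _ _ → inj₁ refl }

-- The generalised cross product: it spans the common kernel if that is a line, and is 0 otherwise.
cross : (A : List (Bits n)) → Cross A
cross {n} A with suc (length A) ℕ.≟ n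
... | no ¬len = zeroCross A λ r → det-length (r ∷ A) ¬len
... | yes len with nullVector A (ℕₚ.≤-reflexive len)
... | k₀ , k₀≢𝟎 , null₀ with search (λ s → (¬? (s ≟ᵛ 𝟎) ×-dec ¬? (s ≟ᵛ k₀)) ×-dec null? A s)
-- A kernel of dimension at least two meets every hyperplane: any further row kills `k₀`, `k₁` or
-- their sum.
... | yes (k₁ , (k₁≢𝟎 , k₁≢k₀) , null₁) = zeroCross A λ r → det-singular (r ∷ A) (killed r)
  where
  killed : ∀ r → Singular (r ∷ A)
  killed r with dot r k₀ in eq₀ | dot r k₁ in eq₁
  ... | false | _     = k₀ , k₀≢𝟎 , eq₀ ∷ null₀
  ... | true  | false = k₁ , k₁≢𝟎 , eq₁ ∷ null₁
  ... | true  | true  = k₁ ⊕ k₀ , k₁≢k₀ ∘ ⊕≡𝟎⇒≡ k₁ k₀ ,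
                        trans (dot-⊕ʳ r k₁ k₀) (cong₂ _xor_ eq₁ eq₀) ∷ null-⊕ A null₁ null₀
... | no unique = record { axis = k₀ ; det-∷ = value ; axis≡ = spans }
  where
  spans : ∀ z → z ≢ 𝟎 → Null A z → k₀ ≡ 𝟎 ⊎ k₀ ≡ z
  spans z z≢𝟎 nz with z ≟ᵛ k₀
  ... | yes z≡k₀ = inj₂ (sym z≡k₀)
  ... | no  z≢k₀ = contradiction (z , (z≢𝟎 , z≢k₀) , nz) unique
  value : ∀ r → det (r ∷ A) ≡ dot r k₀
  value r with dot r k₀ in eq
  ... | false = det-singular (r ∷ A) (k₀ , k₀≢𝟎 , eq ∷ null₀)
  ... | true  = det-nonsingular (r ∷ A) len λ where
    (s , s≢𝟎 , ds ∷ ns) → case spans s s≢𝟎 ns of λ where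
      (inj₁ k₀≡𝟎) → k₀≢𝟎 k₀≡𝟎
      (inj₂ k₀≡s) → contradiction (trans (sym eq) (trans (cong (dot r) k₀≡s) ds)) λ ()

det-⊕ : (r r′ : Bits n) (A : List (Bits n)) → det ((r ⊕ r′) ∷ A) ≡ det (r ∷ A) xor det (r′ ∷ A)
det-⊕ r r′ A = trans (det-∷ (r ⊕ r′))
  (trans (dot-⊕ˡ r r′ axis) (sym (cong₂ _xor_ (det-∷ r) (det-∷ r′))))
  where open Cross (cross A)

det-𝟎 : (A : List (Bits n)) → det (𝟎 ∷ A) ≡ false
det-𝟎 A = trans (det-∷ 𝟎) (dot-𝟎ˡ axis)
  where open Cross (cross A)

-- Dropping one of two equal rows keeps the kernel and leaves fewer rows than columns.
det-repeat : (r : Bits n) (A : List (Bits n)) → det (r ∷ r ∷ A) ≡ false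
det-repeat {n} r A with suc (suc (length A)) ℕ.≟ n
... | no ¬len = det-length (r ∷ r ∷ A) ¬len
... | yes len with nullVector (r ∷ A) (ℕₚ.≤-reflexive len)
... | s , s≢𝟎 , d ∷ ns = det-singular (r ∷ r ∷ A) (s , s≢𝟎 , d ∷ d ∷ ns)

det-swap : (r r′ : Bits n) (A : List (Bits n)) → det (r ∷ r′ ∷ A) ≡ det (r′ ∷ r ∷ A)
det-swap r r′ A = det-↭ (swap r r′ ↭-refl)

det-⊕₂ : (p r r′ : Bits n) (A : List (Bits n)) →
         det (p ∷ (r ⊕ r′) ∷ A) ≡ det (p ∷ r ∷ A) xor det (p ∷ r′ ∷ A)
det-⊕₂ p r r′ A = trans (det-swap p (r ⊕ r′) A)
  (trans (det-⊕ r r′ (p ∷ A)) (cong₂ _xor_ (det-swap r p A) (det-swap r′ p A)))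

det-shear : (r r′ : Bits n) (A : List (Bits n)) → det (r ∷ r′ ∷ A) ≡ det (r ∷ (r ⊕ r′) ∷ A)
det-shear r r′ A = sym (trans (det-⊕₂ r r r′ A) (cong (_xor det (r ∷ r′ ∷ A)) (det-repeat r A)))

det-null : {z : Bits n} (A : List (Bits n)) → z ≢ 𝟎 → Null A z → det A ≡ false
det-null {z = z} A z≢𝟎 nz = det-singular A (z , z≢𝟎 , nz)

-- The axis of `A` is 0 or `z`, so the determinant sees the first row only through `dot r z`. With
-- `z` a cut, any edge across it can stand for any other.
det-replace : {z : Bits n} (A : List (Bits n)) → z ≢ 𝟎 → Null A z → (r r′ : Bits n) →
              dot r z ≡ dot r′ z → det (r ∷ A) ≡ det (r′ ∷ A)
det-replace {z = z} A z≢𝟎 nz r r′ eq with cross A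
... | record { axis = k ; det-∷ = det-∷ ; axis≡ = axis≡ } with axis≡ z z≢𝟎 nz
... | inj₁ k≡𝟎 = trans (det-∷ r) (trans (cong (dot r) k≡𝟎) (trans (dot-𝟎ʳ r)
                 (sym (trans (det-∷ r′) (trans (cong (dot r′) k≡𝟎) (dot-𝟎ʳ r′))))))
... | inj₂ k≡z = trans (det-∷ r) (trans (cong (dot r) k≡z) (trans eq
                 (sym (trans (det-∷ r′) (cong (dot r′) k≡z)))))

-- Sums over all points of 𝔽₂ᵐ

⟦_⟧ : Bool → ℕ
⟦ true  ⟧ = 1
⟦ false ⟧ = 0

odd : ℕ → Bool
odd zero    = false
odd (suc n) = not (odd n)

odd-+ : ∀ a b → odd (a + b) ≡ odd a xor odd b
odd-+ zero    b = refl
odd-+ (suc a) b = trans (cong not (odd-+ a b)) (Boolₚ.not-distribˡ-xor (odd a) (odd b))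

odd-⟦⟧ : ∀ b → odd ⟦ b ⟧ ≡ b
odd-⟦⟧ true  = refl
odd-⟦⟧ false = refl

⟦⟧-∧ : ∀ a b → ⟦ a ∧ b ⟧ ≡ ⟦ a ⟧ * ⟦ b ⟧
⟦⟧-∧ true  b = sym (ℕₚ.+-identityʳ ⟦ b ⟧)
⟦⟧-∧ false b = refl

+-interchange : ∀ a b c d → (a + b) + (c + d) ≡ (a + c) + (b + d)
+-interchange = solve-∀

Σᵛ : (Bits m → ℕ) → ℕ
Σᵛ {zero}  f = f []
Σᵛ {suc m} f = Σᵛ (λ xs → f (false ∷ xs)) + Σᵛ (λ xs → f (true ∷ xs))

Σᵛ-cong : {f g : Bits m → ℕ} → (∀ xs → f xs ≡ g xs) → Σᵛ f ≡ Σᵛ g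
Σᵛ-cong {zero}  eq = eq []
Σᵛ-cong {suc m} eq = cong₂ _+_ (Σᵛ-cong (λ xs → eq (false ∷ xs))) (Σᵛ-cong (λ xs → eq (true ∷ xs)))

Σᵛ-+ : (f g : Bits m → ℕ) → Σᵛ (λ xs → f xs + g xs) ≡ Σᵛ f + Σᵛ g
Σᵛ-+ {zero}  f g = refl
Σᵛ-+ {suc m} f g = trans
  (cong₂ _+_ (Σᵛ-+ (λ xs → f (false ∷ xs)) (λ xs → g (false ∷ xs))) (Σᵛ-+ (λ xs → f (true ∷ xs)) (λ xs → g (true ∷ xs))))
  (+-interchange (Σᵛ (λ xs → f (false ∷ xs))) _ _ _)

Σᵛ-* : ∀ c (f : Bits m → ℕ) → Σᵛ (λ xs → c * f xs) ≡ c * Σᵛ f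
Σᵛ-* {zero}  c f = refl
Σᵛ-* {suc m} c f = trans (cong₂ _+_ (Σᵛ-* c (λ xs → f (false ∷ xs))) (Σᵛ-* c (λ xs → f (true ∷ xs))))
  (sym (ℕₚ.*-distribˡ-+ c (Σᵛ (λ xs → f (false ∷ xs))) _))

⨁ : (Bits m → Bool) → Bool
⨁ {zero}  f = f []
⨁ {suc m} f = ⨁ (λ xs → f (false ∷ xs)) xor ⨁ (λ xs → f (true ∷ xs))

⨁-cong : {f g : Bits m → Bool} → (∀ xs → f xs ≡ g xs) → ⨁ f ≡ ⨁ g
⨁-cong {zero}  eq = eq []
⨁-cong {suc m} eq = cong₂ _xor_ (⨁-cong (λ xs → eq (false ∷ xs))) (⨁-cong (λ xs → eq (true ∷ xs)))

⨁-xor : (f g : Bits m → Bool) → ⨁ (λ xs → f xs xor g xs) ≡ ⨁ f xor ⨁ g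
⨁-xor {zero}  f g = refl
⨁-xor {suc m} f g = trans
  (cong₂ _xor_ (⨁-xor (λ xs → f (false ∷ xs)) (λ xs → g (false ∷ xs))) (⨁-xor (λ xs → f (true ∷ xs)) (λ xs → g (true ∷ xs))))
  (xor-interchange (⨁ (λ xs → f (false ∷ xs))) _ _ _)

odd-Σᵛ : (f : Bits m → Bool) → odd (Σᵛ (λ xs → ⟦ f xs ⟧)) ≡ ⨁ f
odd-Σᵛ {zero}  f = odd-⟦⟧ (f [])
odd-Σᵛ {suc m} f = trans (odd-+ (Σᵛ (λ xs → ⟦ f (false ∷ xs) ⟧)) _)
  (cong₂ _xor_ (odd-Σᵛ (λ xs → f (false ∷ xs))) (odd-Σᵛ (λ xs → f (true ∷ xs))))

-- The value at x of the polynomial ∑_F Φ(F) ∏_{e ∉ F} x_e over 𝔽₂.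
poly : (Bits m → Bool) → Bits m → Bool
poly {zero}  Φ []       = Φ []
poly {suc m} Φ (x ∷ xs) = (x ∧ poly (λ F → Φ (false ∷ F)) xs) xor poly (λ F → Φ (true ∷ F)) xs

poly-cong : {Φ Φ′ : Bits m → Bool} → (∀ F → Φ F ≡ Φ′ F) → ∀ xs → poly Φ xs ≡ poly Φ′ xs
poly-cong {zero}  eq []       = eq []
poly-cong {suc m} eq (x ∷ xs) =
  cong₂ (λ a b → (x ∧ a) xor b) (poly-cong (λ F → eq (false ∷ F)) xs) (poly-cong (λ F → eq (true ∷ F)) xs)

poly-xor : (Φ Φ′ : Bits m → Bool) → ∀ xs → poly (λ F → Φ F xor Φ′ F) xs ≡ poly Φ xs xor poly Φ′ xs
poly-xor {zero}  Φ Φ′ []       = refl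
poly-xor {suc m} Φ Φ′ (x ∷ xs) = trans
  (cong₂ (λ a b → (x ∧ a) xor b) (poly-xor (λ F → Φ (false ∷ F)) (λ F → Φ′ (false ∷ F)) xs)
                                 (poly-xor (λ F → Φ (true ∷ F)) (λ F → Φ′ (true ∷ F)) xs))
  (trans (cong (_xor _) (Boolₚ.∧-distribˡ-xor x (poly (λ F → Φ (false ∷ F)) xs) _))
           (xor-interchange (x ∧ poly (λ F → Φ (false ∷ F)) xs) _ _ _))

poly-false : {Φ : Bits m → Bool} → (∀ F → Φ F ≡ false) → ∀ xs → poly Φ xs ≡ false
poly-false {zero}  eq []       = eq []
poly-false {suc m} eq (x ∷ xs) =
  trans (cong₂ (λ a b → (x ∧ a) xor b) (poly-false (λ F → eq (false ∷ F)) xs) (poly-false (λ F → eq (true ∷ F)) xs))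
          (cong (_xor false) (∧-zeroʳ x))

-- A monomial summed over all points gives 0 unless it contains every variable, and the one that
-- does belongs to the empty set `𝟎`.
⨁-poly : (Φ : Bits m → Bool) → ⨁ (poly Φ) ≡ Φ 𝟎
⨁-poly {zero}  Φ = refl
⨁-poly {suc m} Φ = begin
  ⨁ (poly Φ₁) xor ⨁ (λ xs → poly Φ₀ xs xor poly Φ₁ xs)        ≡⟨ cong (⨁ (poly Φ₁) xor_) (⨁-xor (poly Φ₀) (poly Φ₁)) ⟩
  ⨁ (poly Φ₁) xor (⨁ (poly Φ₀) xor ⨁ (poly Φ₁))              ≡⟨ cancel (⨁ (poly Φ₁)) (⨁ (poly Φ₀)) ⟩
  ⨁ (poly Φ₀)                                                 ≡⟨ ⨁-poly Φ₀ ⟩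
  Φ 𝟎                                                         ∎
  where
  open ≡-Reasoning
  Φ₀ Φ₁ : Bits m → Bool
  Φ₀ F = Φ (false ∷ F)
  Φ₁ F = Φ (true ∷ F)
  cancel : ∀ a b → a xor (b xor a) ≡ b
  cancel false b     = xor-identityʳ b
  cancel true  false = refl
  cancel true  true  = refl

select : (Q : List X) → Bits (length Q) → List X
select []      []          = []
select (e ∷ Q) (true  ∷ F) = e ∷ select Q F
select (e ∷ Q) (false ∷ F) = select Q F

select-𝟎 : (Q : List X) → select Q 𝟎 ≡ []
select-𝟎 []      = refl
select-𝟎 (e ∷ Q) = select-𝟎 Q

polyOf : (List X → Bool) → (Q : List X) → Bits (length Q) → Bool
polyOf Φ Q = poly (λ F → Φ (select Q F))

Symmetric : (List X → Bool) → Set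
Symmetric Φ = ∀ {A B} → A ↭ B → Φ A ≡ Φ B

permute : {Q Q′ : List X} → Q ↭ Q′ → Bits (length Q) → Bits (length Q′)
permute refl         xs           = xs
permute (prep e p)   (x ∷ xs)     = x ∷ permute p xs
permute (swap e f p) (x ∷ y ∷ xs) = y ∷ x ∷ permute p xs
permute (_↭_.trans p q)  xs           = permute q (permute p xs)

polyOf-permute : {Q Q′ : List X} (p : Q ↭ Q′) (Φ : List X → Bool) → Symmetric Φ →
                 ∀ xs → polyOf Φ Q xs ≡ polyOf Φ Q′ (permute p xs)
polyOf-permute refl         Φ sΦ xs           = refl
polyOf-permute (prep e p)   Φ sΦ (x ∷ xs)     =
  cong₂ (λ a b → (x ∧ a) xor b) (polyOf-permute p Φ sΦ xs) (polyOf-permute p (Φ ∘ (e ∷_)) (sΦ ∘ prep e) xs)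
polyOf-permute {Q = e ∷ f ∷ Q} (swap e f p) Φ sΦ (x ∷ y ∷ xs) = trans
  (cong₂ _xor_ (cong (x ∧_) (cong₂ (λ a b → (y ∧ a) xor b) (polyOf-permute p Φ sΦ xs)
                                    (polyOf-permute p (Φ ∘ (f ∷_)) (sΦ ∘ prep f) xs)))
               (cong₂ (λ a b → (y ∧ a) xor b) (polyOf-permute p (Φ ∘ (e ∷_)) (sΦ ∘ prep e) xs)
                      (trans (poly-cong (λ F → sΦ (swap e f refl)) xs)
                               (polyOf-permute p (λ A → Φ (f ∷ e ∷ A)) (λ q → sΦ (prep f (prep e q))) xs))))
  (exchange x y _ _ _ _)
  where
  exchange : ∀ x y a b c d → (x ∧ ((y ∧ a) xor b)) xor ((y ∧ c) xor d) ≡ (y ∧ ((x ∧ a) xor c)) xor ((x ∧ b) xor d)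
  exchange false false a b c d = refl
  exchange false true  a b c d = refl
  exchange true  false a b c d = refl
  exchange true  true  a b c d = xor-interchange a b c d
polyOf-permute (_↭_.trans p q)  Φ sΦ xs           =
  trans (polyOf-permute p Φ sΦ xs) (polyOf-permute q Φ sΦ (permute p xs))

Σᵛ-permute : {Q Q′ : List X} (p : Q ↭ Q′) (f : Bits (length Q′) → ℕ) → Σᵛ (λ xs → f (permute p xs)) ≡ Σᵛ f
Σᵛ-permute refl         f = refl
Σᵛ-permute (prep e p)   f = cong₂ _+_ (Σᵛ-permute p (λ xs → f (false ∷ xs))) (Σᵛ-permute p (λ xs → f (true ∷ xs)))
Σᵛ-permute (swap e g p) f = trans
  (cong₂ _+_ (cong₂ _+_ (Σᵛ-permute p (λ xs → f (false ∷ false ∷ xs))) (Σᵛ-permute p (λ xs → f (true ∷ false ∷ xs))))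
             (cong₂ _+_ (Σᵛ-permute p (λ xs → f (false ∷ true ∷ xs))) (Σᵛ-permute p (λ xs → f (true ∷ true ∷ xs)))))
  (+-interchange (Σᵛ (λ xs → f (false ∷ false ∷ xs))) _ _ _)
Σᵛ-permute (_↭_.trans p q)  f = trans (Σᵛ-permute p (λ xs → f (permute q xs))) (Σᵛ-permute q f)

nonzeros : (List X → Bool) → List X → ℕ
nonzeros Φ Q = Σᵛ (λ xs → ⟦ polyOf Φ Q xs ⟧)

nonzeros-↭ : {Φ : List X → Bool} → Symmetric Φ → {Q Q′ : List X} → Q ↭ Q′ → nonzeros Φ Q ≡ nonzeros Φ Q′
nonzeros-↭ {Φ = Φ} sΦ {Q} {Q′} p = trans (Σᵛ-cong (λ xs → cong ⟦_⟧ (polyOf-permute p Φ sΦ xs)))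
  (Σᵛ-permute p (λ xs → ⟦ polyOf Φ Q′ xs ⟧))

-- Sums over ordered bipartitions of a list; entries `nothing` are skipped.

run : List (Maybe X) → (List X → List X → ℕ) → ℕ
run []             W = W [] []
run (nothing ∷ fs) W = run fs W
run (just r ∷ fs)  W = run fs (λ A B → W (r ∷ A) B + W A (r ∷ B))

run-cong : {P : X → Set} {W W′ : List X → List X → ℕ} (fs : List (Maybe X)) → All (MAll.All P) fs →
           (∀ A B → All P A → All P B → W A B ≡ W′ A B) → run fs W ≡ run fs W′
run-cong []             []              eq = eq [] [] [] []
run-cong (nothing ∷ fs) (nothing ∷ all) eq = run-cong fs all eq
run-cong (just r ∷ fs)  (just p ∷ all)  eq = run-cong fs all
  λ A B pA pB → cong₂ _+_ (eq (r ∷ A) B (p ∷ pA) pB) (eq A (r ∷ B) pA (p ∷ pB))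

run-ext : {W W′ : List X → List X → ℕ} (fs : List (Maybe X)) → (∀ A B → W A B ≡ W′ A B) → run fs W ≡ run fs W′
run-ext []             eq = eq [] []
run-ext (nothing ∷ fs) eq = run-ext fs eq
run-ext (just r ∷ fs)  eq = run-ext fs λ A B → cong₂ _+_ (eq (r ∷ A) B) (eq A (r ∷ B))

run-+ : (fs : List (Maybe X)) (W W′ : List X → List X → ℕ) →
        run fs (λ A B → W A B + W′ A B) ≡ run fs W + run fs W′
run-+ []             W W′ = refl
run-+ (nothing ∷ fs) W W′ = run-+ fs W W′
run-+ (just r ∷ fs)  W W′ = trans
  (run-ext fs λ A B → +-interchange (W (r ∷ A) B) (W′ (r ∷ A) B) (W A (r ∷ B)) (W′ A (r ∷ B)))
  (run-+ fs (λ A B → W (r ∷ A) B + W A (r ∷ B)) (λ A B → W′ (r ∷ A) B + W′ A (r ∷ B)))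

run-* : (fs : List (Maybe X)) (c : ℕ) (W : List X → List X → ℕ) → run fs (λ A B → c * W A B) ≡ c * run fs W
run-* []             c W = refl
run-* (nothing ∷ fs) c W = run-* fs c W
run-* (just r ∷ fs)  c W = trans (run-ext fs λ A B → sym (ℕₚ.*-distribˡ-+ c (W (r ∷ A) B) (W A (r ∷ B))))
  (run-* fs c (λ A B → W (r ∷ A) B + W A (r ∷ B)))

run-zero : (fs : List (Maybe X)) → run fs (λ _ _ → 0) ≡ 0
run-zero []             = refl
run-zero (nothing ∷ fs) = run-zero fs
run-zero (just r ∷ fs)  = run-zero fs

run-flip : (fs : List (Maybe X)) (W : List X → List X → ℕ) → run fs (λ A B → W B A) ≡ run fs W
run-flip []             W = refl
run-flip (nothing ∷ fs) W = run-flip fs W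
run-flip (just r ∷ fs)  W = trans (run-ext fs λ A B → ℕₚ.+-comm (W B (r ∷ A)) (W (r ∷ B) A))
  (run-flip fs (λ A B → W (r ∷ A) B + W A (r ∷ B)))

Symmetric₂ : (List X → List X → ℕ) → Set
Symmetric₂ W = ∀ {A A′ B B′} → A ↭ A′ → B ↭ B′ → W A B ≡ W A′ B′

run-↭ : {W : List X → List X → ℕ} → Symmetric₂ W → {fs gs : List (Maybe X)} → fs ↭ gs → run fs W ≡ run gs W
run-↭ sW refl = refl
run-↭ sW (prep nothing p) = run-↭ sW p
run-↭ sW (prep (just r) p) = run-↭ (λ q q′ → cong₂ _+_ (sW (prep r q) q′) (sW q (prep r q′))) p
run-↭ sW (swap nothing nothing p) = run-↭ sW p
run-↭ sW (swap nothing (just r) p) = run-↭ (λ q q′ → cong₂ _+_ (sW (prep r q) q′) (sW q (prep r q′))) p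
run-↭ sW (swap (just r) nothing p) = run-↭ (λ q q′ → cong₂ _+_ (sW (prep r q) q′) (sW q (prep r q′))) p
run-↭ {W = W} sW {gs = _ ∷ _ ∷ gs} (swap (just r) (just s) p) = trans
  (run-↭ (λ q q′ → cong₂ _+_ (cong₂ _+_ (sW (prep r (prep s q)) q′) (sW (prep s q) (prep r q′)))
                             (cong₂ _+_ (sW (prep r q) (prep s q′)) (sW q (prep r (prep s q′))))) p)
  (run-ext gs λ A B → trans
    (cong₂ _+_ (cong (_+ W (s ∷ A) (r ∷ B)) (sW (swap r s refl) refl)) (cong (W (r ∷ A) (s ∷ B) +_) (sW refl (swap r s refl))))
    (+-interchange (W (s ∷ r ∷ A) B) (W (s ∷ A) (r ∷ B)) (W (r ∷ A) (s ∷ B)) (W A (s ∷ r ∷ B))))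
run-↭ sW (_↭_.trans p q) = trans (run-↭ sW p) (run-↭ sW q)

private
  -- The product of `x p + p′` and `x q + q′`, summed over x = 0 and x = 1.
  cross-terms : ∀ p p′ q q′ →
    (p′ ∧ q′) xor ((p xor p′) ∧ (q xor q′)) ≡ (p ∧ q) xor ((p′ ∧ q) xor (p ∧ q′))
  cross-terms false false q     q′    = refl
  cross-terms false true  false false = refl
  cross-terms false true  false true  = refl
  cross-terms false true  true  false = refl
  cross-terms false true  true  true  = refl
  cross-terms true  false q     q′    = refl
  cross-terms true  true  false false = refl
  cross-terms true  true  false true  = refl
  cross-terms true  true  true  false = refl
  cross-terms true  true  true  true  = refl

  ⨁-product-∷ : (e : X) (Q : List X) (Φ Φ′ : List X → Bool) →
    ⨁ (λ xs → polyOf Φ (e ∷ Q) xs ∧ polyOf Φ′ (e ∷ Q) xs) ≡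
    ⨁ (λ xs → polyOf Φ Q xs ∧ polyOf Φ′ Q xs) xor
      (⨁ (λ xs → polyOf (Φ ∘ (e ∷_)) Q xs ∧ polyOf Φ′ Q xs) xor ⨁ (λ xs → polyOf Φ Q xs ∧ polyOf (Φ′ ∘ (e ∷_)) Q xs))
  ⨁-product-∷ e Q Φ Φ′ = trans
    (sym (⨁-xor (λ xs → polyOf (Φ ∘ (e ∷_)) Q xs ∧ polyOf (Φ′ ∘ (e ∷_)) Q xs)
                (λ xs → (polyOf Φ Q xs xor polyOf (Φ ∘ (e ∷_)) Q xs) ∧ (polyOf Φ′ Q xs xor polyOf (Φ′ ∘ (e ∷_)) Q xs))))
    (trans (⨁-cong λ xs → cross-terms (polyOf Φ Q xs) (polyOf (Φ ∘ (e ∷_)) Q xs) (polyOf Φ′ Q xs) (polyOf (Φ′ ∘ (e ∷_)) Q xs))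
    (trans (⨁-xor (λ xs → polyOf Φ Q xs ∧ polyOf Φ′ Q xs) _)
             (cong (⨁ (λ xs → polyOf Φ Q xs ∧ polyOf Φ′ Q xs) xor_)
               (⨁-xor (λ xs → polyOf (Φ ∘ (e ∷_)) Q xs ∧ polyOf Φ′ Q xs) (λ xs → polyOf Φ Q xs ∧ polyOf (Φ′ ∘ (e ∷_)) Q xs)))))

  -- `c` counts the elements already given to one of the two sets in the course of the induction, so
  -- that `t` bounds the sizes of the whole sets.
  Supported : (Φ Φ′ : List X → Bool) (c t : ℕ) → Set
  Supported Φ Φ′ c t = ∀ A B → length A + length B + c < t → Φ A ∧ Φ′ B ≡ false

  supportedˡ : (Φ Φ′ : List X → Bool) {c t : ℕ} (e : X) → Supported Φ Φ′ c t → Supported (Φ ∘ (e ∷_)) Φ′ (suc c) t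
  supportedˡ Φ Φ′ {t = t} e h A B lt = h (e ∷ A) B (subst (_< t) (ℕₚ.+-suc (length A + length B) _) lt)

  supportedʳ : (Φ Φ′ : List X → Bool) {c t : ℕ} (e : X) → Supported Φ Φ′ c t → Supported Φ (Φ′ ∘ (e ∷_)) (suc c) t
  supportedʳ Φ Φ′ {c} {t} e h A B lt = h A (e ∷ B) (subst (_< t) (rearrange (length A) (length B) c) lt)
    where
    rearrange : ∀ a b c → a + b + suc c ≡ a + suc b + c
    rearrange = solve-∀

  ⨁-product-small : (Q : List X) (Φ Φ′ : List X → Bool) (c t : ℕ) → Supported Φ Φ′ c t → length Q + c < t →
                    ⨁ (λ xs → polyOf Φ Q xs ∧ polyOf Φ′ Q xs) ≡ false
  ⨁-product-small []      Φ Φ′ c t h lt = h [] [] lt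
  ⨁-product-small (e ∷ Q) Φ Φ′ c t h lt = trans (⨁-product-∷ e Q Φ Φ′)
    (cong₂ _xor_ (⨁-product-small Q Φ Φ′ c t h (ℕₚ.<-trans (ℕₚ.n<1+n _) lt))
      (cong₂ _xor_ (⨁-product-small Q (Φ ∘ (e ∷_)) Φ′ (suc c) t (supportedˡ Φ Φ′ e h) lt′)
                   (⨁-product-small Q Φ (Φ′ ∘ (e ∷_)) (suc c) t (supportedʳ Φ Φ′ e h) lt′)))
    where lt′ = subst (_< t) (sym (ℕₚ.+-suc (length Q) c)) lt

-- Since squares collapse over 𝔽₂, a product of two monomials survives the summation when each
-- variable occurs in at least one factor, that is, when the two edge sets are disjoint. `Supported`
-- removes the disjoint pairs that do not exhaust `Q`, which leaves the ordered bipartitions.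
⨁-product : (Q : List X) (Φ Φ′ : List X → Bool) (c t : ℕ) → Supported Φ Φ′ c t → length Q + c ≡ t →
            ⨁ (λ xs → polyOf Φ Q xs ∧ polyOf Φ′ Q xs) ≡ odd (run (map just Q) (λ A B → ⟦ Φ A ⟧ * ⟦ Φ′ B ⟧))
⨁-product []      Φ Φ′ c t h eq = trans (sym (odd-⟦⟧ _)) (cong odd (⟦⟧-∧ (Φ []) (Φ′ [])))
⨁-product (e ∷ Q) Φ Φ′ c t h eq = trans (⨁-product-∷ e Q Φ Φ′) (trans
    (cong₂ _xor_ (⨁-product-small Q Φ Φ′ c t h (ℕₚ.≤-reflexive eq))
      (cong₂ _xor_ (⨁-product Q (Φ ∘ (e ∷_)) Φ′ (suc c) t (supportedˡ Φ Φ′ e h) eq′)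
                   (⨁-product Q Φ (Φ′ ∘ (e ∷_)) (suc c) t (supportedʳ Φ Φ′ e h) eq′)))
    (trans (sym (odd-+ (run (map just Q) (λ A B → ⟦ Φ (e ∷ A) ⟧ * ⟦ Φ′ B ⟧)) _))
             (cong odd (sym (run-+ (map just Q) (λ A B → ⟦ Φ (e ∷ A) ⟧ * ⟦ Φ′ B ⟧) (λ A B → ⟦ Φ A ⟧ * ⟦ Φ′ (e ∷ B) ⟧))))))
    where eq′ = trans (ℕₚ.+-suc (length Q) c) eq

-- Edge vectors and identities special to graphs

edge : Fin n → Fin n → Bits n
edge a b = unit a ⊕ unit b

dot-edge : (a b : Fin n) (s : Bits n) → dot (edge a b) s ≡ lookup s a xor lookup s b
dot-edge a b s = trans (dot-⊕ˡ (unit a) (unit b) s) (cong₂ _xor_ (dot-unit a s) (dot-unit b s))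

lookup-unit-self : (i : Fin n) → lookup (unit i) i ≡ true
lookup-unit-self zero    = refl
lookup-unit-self (suc i) = lookup-unit-self i

lookup-unit-other : {i j : Fin n} → i ≢ j → lookup (unit i) j ≡ false
lookup-unit-other {i = zero}  {zero}  i≢j = contradiction refl i≢j
lookup-unit-other {i = zero}  {suc j} i≢j = Vecₚ.lookup-replicate j false
lookup-unit-other {i = suc i} {zero}  i≢j = refl
lookup-unit-other {i = suc i} {suc j} i≢j = lookup-unit-other (i≢j ∘ cong suc)

true⇒≢𝟎 : {s : Bits n} (i : Fin n) → lookup s i ≡ true → s ≢ 𝟎
true⇒≢𝟎 i eq refl = contradiction (trans (sym eq) (Vecₚ.lookup-replicate i false)) λ ()

unit≢𝟎 : (i : Fin n) → unit i ≢ 𝟎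
unit≢𝟎 i = true⇒≢𝟎 i (lookup-unit-self i)

edge-⊕ : (u a b : Fin n) → edge u a ⊕ edge u b ≡ edge a b
edge-⊕ u a b = go (unit u) (unit a) (unit b)
  where
  cancel : ∀ x y z → (x xor y) xor (x xor z) ≡ y xor z
  cancel x y z = trans (xor-interchange x y x z) (cong (_xor (y xor z)) (xor-same x))
  go : ∀ {n} (r s t : Bits n) → (r ⊕ s) ⊕ (r ⊕ t) ≡ s ⊕ t
  go []      []      []      = refl
  go (x ∷ r) (y ∷ s) (z ∷ t) = cong₂ _∷_ (cancel x y z) (go r s t)

edge-comm : (a b : Fin n) → edge a b ≡ edge b a
edge-comm a b = ⊕-comm (unit a) (unit b)

edge-self : (a : Fin n) → edge a a ≡ 𝟎
edge-self a = ⊕-self (unit a)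

-- Special to rows coming from graphs; it excludes the one case in which `triples≡pairings` would fail.
Closed : Bits n → Set
Closed r = ∀ s s′ → dot r s ≡ false → dot r s′ ≡ false → dot r (zipWith _∧_ s s′) ≡ false

unit-closed : (a : Fin n) → Closed (unit a)
unit-closed a s s′ p q = trans (dot-unit a _) (trans (Vecₚ.lookup-zipWith _∧_ a s s′)
  (cong (_∧ lookup s′ a) (trans (sym (dot-unit a s)) p)))

xor-false : ∀ x y → x xor y ≡ false → x ≡ y
xor-false false false _ = refl
xor-false true  true  _ = refl

xor-true : ∀ x y → x xor y ≡ true → y ≡ not x
xor-true false true  _ = refl
xor-true true  false _ = refl

edge-closed : (a b : Fin n) → Closed (edge a b)
edge-closed a b s s′ p q = begin
  dot (edge a b) (zipWith _∧_ s s′)                               ≡⟨ dot-edge a b _ ⟩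
  lookup (zipWith _∧_ s s′) a xor lookup (zipWith _∧_ s s′) b     ≡⟨ cong₂ _xor_ (Vecₚ.lookup-zipWith _∧_ a s s′) (Vecₚ.lookup-zipWith _∧_ b s s′) ⟩
  (lookup s a ∧ lookup s′ a) xor (lookup s b ∧ lookup s′ b)       ≡⟨ cong₂ (λ x y → (x ∧ y) xor (lookup s b ∧ lookup s′ b))
                                                                       (xor-false (lookup s a) (lookup s b) (trans (sym (dot-edge a b s)) p))
                                                                       (xor-false (lookup s′ a) (lookup s′ b) (trans (sym (dot-edge a b s′)) q)) ⟩
  (lookup s b ∧ lookup s′ b) xor (lookup s b ∧ lookup s′ b)       ≡⟨ xor-same (lookup s b ∧ lookup s′ b) ⟩
  false                                                           ∎
  where open ≡-Reasoning

null-product : {M : List (Bits n)} → All Closed M → ∀ {s s′} → Null M s → Null M s′ → Null M (zipWith _∧_ s s′)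
null-product []       []       []       = []
null-product (c ∷ cs) (p ∷ ps) (q ∷ qs) = c _ _ p q ∷ null-product cs ps qs

-- Among four vertices joined by three components two share a component.
not-all-separated : {M : List (Bits n)} → All Closed M → (a b c d : Fin n) →
  det (edge a b ∷ edge a c ∷ M) ≡ true → det (edge a b ∷ edge a d ∷ M) ≡ true →
  det (edge a c ∷ edge a d ∷ M) ≡ true → det (edge b c ∷ edge b d ∷ M) ≡ true → ⊥
not-all-separated {n} {M} closed a b c d abc abd acd bcd =
  conflict (lookup k₁ a) (lookup k₂ a) refl refl
  where
  len : length (edge a c ∷ M) < n
  len = ℕₚ.≤-reflexive (proj₁ (det-true _ abc))
  separate : ∀ {r r′ s} → det (r ∷ r′ ∷ M) ≡ true → s ≢ 𝟎 → dot r s ≡ false → dot r′ s ≡ false → Null M s → ⊥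
  separate eq s≢𝟎 p q ns = proj₂ (det-true _ eq) (_ , s≢𝟎 , p ∷ q ∷ ns)
  K₁ = nullVector (edge a c ∷ M) len
  K₂ = nullVector (edge a b ∷ M) len
  k₁ = proj₁ K₁
  k₂ = proj₁ K₂
  n₁ = All.tail (proj₂ (proj₂ K₁))
  n₂ = All.tail (proj₂ (proj₂ K₂))
  same : ∀ x y (s : Bits n) → dot (edge x y) s ≡ false → lookup s y ≡ lookup s x
  same x y s eq = sym (xor-false _ _ (trans (sym (dot-edge x y s)) eq))
  other : ∀ x y (s : Bits n) → (dot (edge x y) s ≡ false → ⊥) → lookup s y ≡ not (lookup s x)
  other x y s ¬eq = xor-true _ _ (trans (sym (dot-edge x y s)) (¬-not ¬eq))
  k₁c = same a c k₁ (All.head (proj₂ (proj₂ K₁)))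
  k₁b = other a b k₁ λ eq → separate abc (proj₁ (proj₂ K₁)) eq (All.head (proj₂ (proj₂ K₁))) n₁
  k₁d = other a d k₁ λ eq → separate acd (proj₁ (proj₂ K₁)) (All.head (proj₂ (proj₂ K₁))) eq n₁
  k₂b = same a b k₂ (All.head (proj₂ (proj₂ K₂)))
  k₂c = other a c k₂ λ eq → separate abc (proj₁ (proj₂ K₂)) (All.head (proj₂ (proj₂ K₂))) eq n₂
  k₂d = other a d k₂ λ eq → separate abd (proj₁ (proj₂ K₂)) (All.head (proj₂ (proj₂ K₂))) eq n₂
  -- `k₁` separates {a, c} from {b, d}, and `k₂` separates {a, b} from {c, d}. Exactly one of the
  -- four vertices lies in the intersection, which therefore fails to separate the other three,
  -- against the hypothesis on that triple.
  k₁₂ = zipWith _∧_ k₁ k₂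
  nk : Null M k₁₂
  nk = null-product closed n₁ n₂
  at : ∀ x {p q} → lookup k₁ x ≡ p → lookup k₂ x ≡ q → lookup k₁₂ x ≡ p ∧ q
  at x p q = trans (Vecₚ.lookup-zipWith _∧_ x k₁ k₂) (cong₂ _∧_ p q)
  equal : ∀ x y {p} → lookup k₁₂ x ≡ p → lookup k₁₂ y ≡ p → dot (edge x y) k₁₂ ≡ false
  equal x y {p} eq eq′ = trans (dot-edge x y k₁₂) (trans (cong₂ _xor_ eq eq′) (xor-same p))
  conflict : ∀ p q → lookup k₁ a ≡ p → lookup k₂ a ≡ q → ⊥
  conflict p q eq₁ eq₂ = go p q (at a eq₁ eq₂) (at b (trans k₁b (cong not eq₁)) (trans k₂b eq₂))
    (at c (trans k₁c eq₁) (trans k₂c (cong not eq₂))) (at d (trans k₁d (cong not eq₁)) (trans k₂d (cong not eq₂)))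
    where
    go : ∀ p q → lookup k₁₂ a ≡ p ∧ q → lookup k₁₂ b ≡ not p ∧ q → lookup k₁₂ c ≡ p ∧ not q → lookup k₁₂ d ≡ not p ∧ not q → ⊥
    go false false ka kb kc kd = separate abc (true⇒≢𝟎 d kd) (equal a b ka kb) (equal a c ka kc) nk
    go false true  ka kb kc kd = separate acd (true⇒≢𝟎 b kb) (equal a c ka kc) (equal a d ka kd) nk
    go true  false ka kb kc kd = separate abd (true⇒≢𝟎 c kc) (equal a b ka kb) (equal a d ka kd) nk
    go true  true  ka kb kc kd = separate bcd (true⇒≢𝟎 a ka) (equal b c kb kc) (equal b d kb kd) nk

-- By linearity all seven determinants are 𝔽₂-sums of the first three on the left. The two sides
-- then agree as integers unless these three are all 1, when they would be 4 and 0;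
-- `not-all-separated` excludes that.
triples≡pairings : {M : List (Bits n)} → All Closed M → (a b c d : Fin n) →
  ⟦ det (edge a b ∷ edge a c ∷ M) ⟧ + ⟦ det (edge a b ∷ edge a d ∷ M) ⟧ +
  ⟦ det (edge a c ∷ edge a d ∷ M) ⟧ + ⟦ det (edge b c ∷ edge b d ∷ M) ⟧ ≡
  ⟦ det (edge a b ∷ edge c d ∷ M) ⟧ + ⟦ det (edge a c ∷ edge b d ∷ M) ⟧ + ⟦ det (edge a d ∷ edge b c ∷ M) ⟧
triples≡pairings {n} {M} closed a b c d = go _ _ _ _ _ _ _ w₁ w₂ w₃ o₄
    (λ x y z → not-all-separated closed a b c d x y z (trans o₄ (cong₂ _xor_ x (cong₂ _xor_ y z))))
  where
  split : ∀ r x y z → det (r ∷ edge y z ∷ M) ≡ det (r ∷ edge x y ∷ M) xor det (r ∷ edge x z ∷ M)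
  split r x y z = trans (cong (λ e → det (r ∷ e ∷ M)) (sym (edge-⊕ x y z))) (det-⊕₂ r (edge x y) (edge x z) M)
  w₁ = split (edge a b) a c d
  w₂ : det (edge a c ∷ edge b d ∷ M) ≡ det (edge a b ∷ edge a c ∷ M) xor det (edge a c ∷ edge a d ∷ M)
  w₂ = trans (split (edge a c) a b d) (cong (_xor _) (det-swap (edge a c) (edge a b) M))
  w₃ : det (edge a d ∷ edge b c ∷ M) ≡ det (edge a b ∷ edge a d ∷ M) xor det (edge a c ∷ edge a d ∷ M)
  w₃ = trans (split (edge a d) a b c) (cong₂ _xor_ (det-swap (edge a d) (edge a b) M) (det-swap (edge a d) (edge a c) M))
  o₄ : det (edge b c ∷ edge b d ∷ M) ≡
       det (edge a b ∷ edge a c ∷ M) xor (det (edge a b ∷ edge a d ∷ M) xor det (edge a c ∷ edge a d ∷ M))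
  o₄ = begin
    det (edge b c ∷ edge b d ∷ M)
      ≡⟨ split (edge b c) a b d ⟩
    det (edge b c ∷ edge a b ∷ M) xor det (edge b c ∷ edge a d ∷ M)
      ≡⟨ cong₂ _xor_ (trans (det-swap (edge b c) (edge a b) M) (trans (split (edge a b) a b c)
                       (cong (_xor det (edge a b ∷ edge a c ∷ M)) (det-repeat (edge a b) M))))
                     (trans (det-swap (edge b c) (edge a d) M) w₃) ⟩
    det (edge a b ∷ edge a c ∷ M) xor (det (edge a b ∷ edge a d ∷ M) xor det (edge a c ∷ edge a d ∷ M)) ∎
    where open ≡-Reasoning
  go : ∀ x y z o p q r → p ≡ x xor y → q ≡ x xor z → r ≡ y xor z → o ≡ x xor (y xor z) →
       (x ≡ true → y ≡ true → z ≡ true → ⊥) →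
       ⟦ x ⟧ + ⟦ y ⟧ + ⟦ z ⟧ + ⟦ o ⟧ ≡ ⟦ p ⟧ + ⟦ q ⟧ + ⟦ r ⟧
  go false false false _ _ _ _ refl refl refl refl _ = refl
  go false false true  _ _ _ _ refl refl refl refl _ = refl
  go false true  false _ _ _ _ refl refl refl refl _ = refl
  go false true  true  _ _ _ _ refl refl refl refl _ = refl
  go true  false false _ _ _ _ refl refl refl refl _ = refl
  go true  false true  _ _ _ _ refl refl refl refl _ = refl
  go true  true  false _ _ _ _ refl refl refl refl _ = refl
  go true  true  true  _ _ _ _ refl refl refl refl ¬t = ⊥-elim (¬t refl refl refl)

-- The local identity for eliminating a vertex

module Star (u : Fin n) {M : List (Bits n)} (closed : All Closed M) (null : Null M (unit u)) where

  private
    edge-null : ∀ x y → u ≢ x → u ≢ y → dot (edge x y) (unit u) ≡ false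
    edge-null x y u≢x u≢y = trans (dot-edge x y (unit u)) (cong₂ _xor_ (lookup-unit-other u≢x) (lookup-unit-other u≢y))

    edge-u : ∀ x → u ≢ x → dot (edge u x) (unit u) ≡ dot (unit u) (unit u)
    edge-u x u≢x = trans (dot-edge u x (unit u)) (trans (cong₂ _xor_ (lookup-unit-self u) (lookup-unit-other u≢x))
      (sym (trans (dot-unit u (unit u)) (lookup-unit-self u))))

  star₀ : det M ≡ false
  star₀ = det-null M (unit≢𝟎 u) null

  star₁ : ∀ x → u ≢ x → det (edge u x ∷ M) ≡ det (unit u ∷ M)
  star₁ x u≢x = det-replace M (unit≢𝟎 u) null (edge u x) (unit u) (edge-u x u≢x)

  -- Adding one star edge to the others moves these away from `u`. It is then the only row that sees
  -- `u`, and `unit u` can replace it.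
  star₂ : ∀ x y → u ≢ x → u ≢ y → det (edge u x ∷ edge u y ∷ M) ≡ det (unit u ∷ edge x y ∷ M)
  star₂ x y u≢x u≢y = begin
    det (edge u x ∷ edge u y ∷ M)               ≡⟨ det-shear (edge u x) (edge u y) M ⟩
    det (edge u x ∷ (edge u x ⊕ edge u y) ∷ M)  ≡⟨ cong (λ e → det (edge u x ∷ e ∷ M)) (edge-⊕ u x y) ⟩
    det (edge u x ∷ edge x y ∷ M)               ≡⟨ det-replace (edge x y ∷ M) (unit≢𝟎 u) (edge-null x y u≢x u≢y ∷ null)
                                                     (edge u x) (unit u) (edge-u x u≢x) ⟩
    det (unit u ∷ edge x y ∷ M)                 ∎
    where open ≡-Reasoning

  star₃ : ∀ x y z → u ≢ x → u ≢ y → u ≢ z →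
          det (edge u x ∷ edge u y ∷ edge u z ∷ M) ≡ det (edge x y ∷ edge x z ∷ unit u ∷ M)
  star₃ x y z u≢x u≢y u≢z = begin
    det (edge u x ∷ edge u y ∷ edge u z ∷ M)               ≡⟨ det-shear (edge u x) (edge u y) _ ⟩
    det (edge u x ∷ (edge u x ⊕ edge u y) ∷ edge u z ∷ M)  ≡⟨ cong (λ e → det (edge u x ∷ e ∷ edge u z ∷ M)) (edge-⊕ u x y) ⟩
    det (edge u x ∷ edge x y ∷ edge u z ∷ M)               ≡⟨ det-↭ (prep _ (swap _ _ refl)) ⟩
    det (edge u x ∷ edge u z ∷ edge x y ∷ M)               ≡⟨ det-shear (edge u x) (edge u z) _ ⟩
    det (edge u x ∷ (edge u x ⊕ edge u z) ∷ edge x y ∷ M)  ≡⟨ cong (λ e → det (edge u x ∷ e ∷ edge x y ∷ M)) (edge-⊕ u x z) ⟩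
    det (edge u x ∷ edge x z ∷ edge x y ∷ M)               ≡⟨ det-replace (edge x z ∷ edge x y ∷ M) (unit≢𝟎 u)
                                                                (edge-null x z u≢x u≢z ∷ edge-null x y u≢x u≢y ∷ null)
                                                                (edge u x) (unit u) (edge-u x u≢x) ⟩
    det (unit u ∷ edge x z ∷ edge x y ∷ M)                 ≡⟨ det-↭ (↭-trans (swap _ _ refl) (↭-trans (prep _ (swap _ _ refl)) (swap _ _ refl))) ⟩
    det (edge x y ∷ edge x z ∷ unit u ∷ M)                 ∎
    where open ≡-Reasoning

  triples : ∀ a b c d → u ≢ a → u ≢ b → u ≢ c → u ≢ d →
            ⟦ det (edge u a ∷ edge u b ∷ edge u c ∷ M) ⟧ + ⟦ det (edge u a ∷ edge u b ∷ edge u d ∷ M) ⟧ +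
            ⟦ det (edge u a ∷ edge u c ∷ edge u d ∷ M) ⟧ + ⟦ det (edge u b ∷ edge u c ∷ edge u d ∷ M) ⟧ ≡
            ⟦ det (unit u ∷ edge a b ∷ edge c d ∷ M) ⟧ + ⟦ det (unit u ∷ edge a c ∷ edge b d ∷ M) ⟧ +
            ⟦ det (unit u ∷ edge a d ∷ edge b c ∷ M) ⟧
  triples a b c d u≢a u≢b u≢c u≢d = trans
    (cong₂ _+_ (cong₂ _+_ (cong₂ _+_ (cong ⟦_⟧ (star₃ a b c u≢a u≢b u≢c)) (cong ⟦_⟧ (star₃ a b d u≢a u≢b u≢d)))
      (cong ⟦_⟧ (star₃ a c d u≢a u≢c u≢d))) (cong ⟦_⟧ (star₃ b c d u≢b u≢c u≢d)))
    (trans (triples≡pairings (unit-closed u ∷ closed) a b c d)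
    (cong₂ _+_ (cong₂ _+_ (cong ⟦_⟧ (rotate _ _)) (cong ⟦_⟧ (rotate _ _))) (cong ⟦_⟧ (rotate _ _))))
    where
    rotate : ∀ r s → det (r ∷ s ∷ unit u ∷ M) ≡ det (unit u ∷ r ∷ s ∷ M)
    rotate r s = det-↭ (↭-trans (prep _ (swap _ _ refl)) (swap _ _ refl))

-- One step of `run`, isolated so that the entries at `u` can be distributed while the distribution
-- of all other entries is held fixed.
act : Maybe X → (List X → List X → ℕ) → List X → List X → ℕ
act nothing  W = W
act (just r) W = λ A B → W (r ∷ A) B + W A (r ∷ B)

run-∷ : (f : Maybe X) (fs : List (Maybe X)) (W : List X → List X → ℕ) → run (f ∷ fs) W ≡ run fs (act f W)
run-∷ nothing  fs W = refl
run-∷ (just r) fs W = refl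

pairWeight : (List X → Bool) → List X → List X → ℕ
pairWeight D A B = ⟦ D A ⟧ * ⟦ D B ⟧

-- An edge of G seen in G ─ v: edges at v disappear; loops, even at v, become the row 0 and so annihilate the count.
factor : Fin n → Fin n → Fin n → Maybe (Bits n)
factor v x y = if does (v Fin.≟ x) xor does (v Fin.≟ y) then nothing else just (edge x y)

factor-comm : (v x y : Fin n) → factor v x y ≡ factor v y x
factor-comm v x y = cong₂ (λ t e → if t then nothing else just e) (xor-comm (does (v Fin.≟ x)) _) (edge-comm x y)

factor-self : (v x : Fin n) → factor v x x ≡ just 𝟎
factor-self v x rewrite xor-same (does (v Fin.≟ x)) | edge-self x = refl

-- Primed quantities belong to the second tree.
private
  four : ∀ t α α′ o₁ o₂ o₃ o₄ o₁′ o₂′ o₃′ o₄′ ab ac ad bc bd cd ab′ ac′ ad′ bc′ bd′ cd′ w₁ w₂ w₃ w₁′ w₂′ w₃′ →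
    o₁ + o₂ + o₃ + o₄ ≡ w₁ + w₂ + w₃ → o₁′ + o₂′ + o₃′ + o₄′ ≡ w₁′ + w₂′ + w₃′ →
    ((t * 0 + o₄ * α′) + (o₃ * α′ + cd * ab′) + ((o₂ * α′ + bd * ac′) + (ad * bc′ + α * o₁′))) +
    ((o₁ * α′ + bc * ad′) + (ac * bd′ + α * o₂′) + ((ab * cd′ + α * o₃′) + (α * o₄′ + 0))) ≡
    ((w₁ * α′ + cd * ab′) + (ab * cd′ + α * w₁′)) + ((w₂ * α′ + bd * ac′) + (ac * bd′ + α * w₂′)) +
    ((w₃ * α′ + bc * ad′) + (ad * bc′ + α * w₃′))
  four t α α′ o₁ o₂ o₃ o₄ o₁′ o₂′ o₃′ o₄′ ab ac ad bc bd cd ab′ ac′ ad′ bc′ bd′ cd′ w₁ w₂ w₃ w₁′ w₂′ w₃′ eq eq′ = begin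
    _ ≡⟨ lhs t (o₁ * α′) (o₂ * α′) (o₃ * α′) (o₄ * α′) (α * o₁′) (α * o₂′) (α * o₃′) (α * o₄′)
           (cd * ab′) (bd * ac′) (ad * bc′) (bc * ad′) (ac * bd′) (ab * cd′) ⟩
    (o₁ * α′ + o₂ * α′ + o₃ * α′ + o₄ * α′) + (α * o₁′ + α * o₂′ + α * o₃′ + α * o₄′) + L
      ≡⟨ cong (_+ L) (cong₂ _+_ (distribʳ o₁ o₂ o₃ o₄ α′) (distribˡ o₁′ o₂′ o₃′ o₄′ α)) ⟩
    (o₁ + o₂ + o₃ + o₄) * α′ + α * (o₁′ + o₂′ + o₃′ + o₄′) + L
      ≡⟨ cong (_+ L) (cong₂ _+_ (cong (_* α′) eq) (cong (α *_) eq′)) ⟩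
    (w₁ + w₂ + w₃) * α′ + α * (w₁′ + w₂′ + w₃′) + L
      ≡⟨ rhs w₁ w₂ w₃ w₁′ w₂′ w₃′ α α′ (cd * ab′) (bd * ac′) (ad * bc′) (bc * ad′) (ac * bd′) (ab * cd′) ⟩
    _ ∎
    where
    open ≡-Reasoning
    L = cd * ab′ + bd * ac′ + ad * bc′ + bc * ad′ + ac * bd′ + ab * cd′
    lhs : ∀ t x₁ x₂ x₃ x₄ y₁ y₂ y₃ y₄ l₁ l₂ l₃ l₄ l₅ l₆ →
      ((t * 0 + x₄) + (x₃ + l₁) + ((x₂ + l₂) + (l₃ + y₁))) + ((x₁ + l₄) + (l₅ + y₂) + ((l₆ + y₃) + (y₄ + 0))) ≡
      (x₁ + x₂ + x₃ + x₄) + (y₁ + y₂ + y₃ + y₄) + (l₁ + l₂ + l₃ + l₄ + l₅ + l₆)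
    lhs = solve-∀
    distribʳ : ∀ a b c d e → a * e + b * e + c * e + d * e ≡ (a + b + c + d) * e
    distribʳ = solve-∀
    distribˡ : ∀ a b c d e → e * a + e * b + e * c + e * d ≡ e * (a + b + c + d)
    distribˡ = solve-∀
    rhs : ∀ w₁ w₂ w₃ w₁′ w₂′ w₃′ α α′ l₁ l₂ l₃ l₄ l₅ l₆ →
      (w₁ + w₂ + w₃) * α′ + α * (w₁′ + w₂′ + w₃′) + (l₁ + l₂ + l₃ + l₄ + l₅ + l₆) ≡
      ((w₁ * α′ + l₁) + (l₆ + α * w₁′)) + ((w₂ * α′ + l₂) + (l₅ + α * w₂′)) + ((w₃ * α′ + l₄) + (l₃ + α * w₃′))
    rhs = solve-∀

det-𝟎∈ : {A : List (Bits n)} → 𝟎 ∈ A → det A ≡ false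
det-𝟎∈ 𝟎∈A with ∈-∃++ 𝟎∈A
... | xs , ys , refl = trans (det-↭ (shift 𝟎 xs ys)) (det-𝟎 (xs ++ ys))

module Local (Z : List (Bits n)) (u : Fin n) (A B : List (Bits n))
             (closedA : All Closed (A ++ Z)) (closedB : All Closed (B ++ Z))
             (nullA : Null (A ++ Z) (unit u)) (nullB : Null (B ++ Z) (unit u)) where

  W W′ : List (Bits n) → List (Bits n) → ℕ
  W  = pairWeight (λ A → det (A ++ Z))
  W′ = pairWeight (λ A → det (unit u ∷ A ++ Z))

  private
    module SA = Star u closedA nullA
    module SB = Star u closedB nullB
    pA pB : Fin n → Fin n → ℕ
    pA x y = ⟦ det (unit u ∷ edge x y ∷ A ++ Z) ⟧
    pB x y = ⟦ det (unit u ∷ edge x y ∷ B ++ Z) ⟧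

  -- On the left a split 4+0 of the star gives 0 because `u` would be isolated in one tree, 3+1 is
  -- `triples`, and 2+2 turns each pair into one edge between its far ends. On the right the 3+1
  -- splits become the terms with both new edges in the same tree, and the 2+2 splits those with one
  -- in each.
  local₄ : ∀ a b c d → u ≢ a → u ≢ b → u ≢ c → u ≢ d →
    act (just (edge u d)) (act (just (edge u c)) (act (just (edge u b)) (act (just (edge u a)) W))) A B ≡
    act (just (edge c d)) (act (just (edge a b)) W′) A B + act (just (edge b d)) (act (just (edge a c)) W′) A B +
    act (just (edge b c)) (act (just (edge a d)) W′) A B
  local₄ a b c d u≢a u≢b u≢c u≢d
    with triplesA ← SA.triples a b c d u≢a u≢b u≢c u≢d | triplesB ← SB.triples a b c d u≢a u≢b u≢c u≢d
    rewrite SA.star₀ | SB.star₀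
          | SA.star₁ a u≢a | SB.star₁ a u≢a
          | SA.star₁ b u≢b | SB.star₁ b u≢b
          | SA.star₁ c u≢c | SB.star₁ c u≢c
          | SA.star₁ d u≢d | SB.star₁ d u≢d
          | SA.star₂ a b u≢a u≢b | SB.star₂ a b u≢a u≢b
          | SA.star₂ a c u≢a u≢c | SB.star₂ a c u≢a u≢c
          | SA.star₂ a d u≢a u≢d | SB.star₂ a d u≢a u≢d
          | SA.star₂ b c u≢b u≢c | SB.star₂ b c u≢b u≢c
          | SA.star₂ b d u≢b u≢d | SB.star₂ b d u≢b u≢d
          | SA.star₂ c d u≢c u≢d | SB.star₂ c d u≢c u≢d
    = four ⟦ det (edge u a ∷ edge u b ∷ edge u c ∷ edge u d ∷ A ++ Z) ⟧ ⟦ det (unit u ∷ A ++ Z) ⟧ ⟦ det (unit u ∷ B ++ Z) ⟧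
        ⟦ det (edge u a ∷ edge u b ∷ edge u c ∷ A ++ Z) ⟧ ⟦ det (edge u a ∷ edge u b ∷ edge u d ∷ A ++ Z) ⟧
        ⟦ det (edge u a ∷ edge u c ∷ edge u d ∷ A ++ Z) ⟧ ⟦ det (edge u b ∷ edge u c ∷ edge u d ∷ A ++ Z) ⟧
        ⟦ det (edge u a ∷ edge u b ∷ edge u c ∷ B ++ Z) ⟧ ⟦ det (edge u a ∷ edge u b ∷ edge u d ∷ B ++ Z) ⟧
        ⟦ det (edge u a ∷ edge u c ∷ edge u d ∷ B ++ Z) ⟧ ⟦ det (edge u b ∷ edge u c ∷ edge u d ∷ B ++ Z) ⟧
        (pA a b) (pA a c) (pA a d) (pA b c) (pA b d) (pA c d) (pB a b) (pB a c) (pB a d) (pB b c) (pB b d) (pB c d)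
        ⟦ det (unit u ∷ edge a b ∷ edge c d ∷ A ++ Z) ⟧ ⟦ det (unit u ∷ edge a c ∷ edge b d ∷ A ++ Z) ⟧
        ⟦ det (unit u ∷ edge a d ∷ edge b c ∷ A ++ Z) ⟧
        ⟦ det (unit u ∷ edge a b ∷ edge c d ∷ B ++ Z) ⟧ ⟦ det (unit u ∷ edge a c ∷ edge b d ∷ B ++ Z) ⟧
        ⟦ det (unit u ∷ edge a d ∷ edge b c ∷ B ++ Z) ⟧ triplesA triplesB

  local₃ : ∀ a b c → u ≢ a → u ≢ b → u ≢ c →
    act (just (edge u c)) (act (just (edge u b)) (act (just (edge u a)) W)) A B ≡
    act (just (edge a b)) W′ A B + act (just (edge a c)) W′ A B + act (just (edge b c)) W′ A B
  local₃ a b c u≢a u≢b u≢c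
    rewrite SA.star₀ | SB.star₀
          | SA.star₁ a u≢a | SB.star₁ a u≢a
          | SA.star₁ b u≢b | SB.star₁ b u≢b
          | SA.star₁ c u≢c | SB.star₁ c u≢c
          | SA.star₂ a b u≢a u≢b | SB.star₂ a b u≢a u≢b
          | SA.star₂ a c u≢a u≢c | SB.star₂ a c u≢a u≢c
          | SA.star₂ b c u≢b u≢c | SB.star₂ b c u≢b u≢c
    = three ⟦ det (edge u a ∷ edge u b ∷ edge u c ∷ A ++ Z) ⟧ ⟦ det (unit u ∷ A ++ Z) ⟧ ⟦ det (unit u ∷ B ++ Z) ⟧
        (pA a b) (pA a c) (pA b c) (pB a b) (pB a c) (pB b c)
    where
    three : ∀ t α α′ ab ac bc ab′ ac′ bc′ →
      ((t * 0 + bc * α′) + (ac * α′ + α * ab′)) + ((ab * α′ + α * ac′) + (α * bc′ + 0)) ≡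
      (ab * α′ + α * ab′) + (ac * α′ + α * ac′) + (bc * α′ + α * bc′)
    three = solve-∀

  local₂ : ∀ a b → u ≢ a → u ≢ b →
    act (just (edge u b)) (act (just (edge u a)) W) A B ≡ W′ A B + W′ A B
  local₂ a b u≢a u≢b
    rewrite SA.star₀ | SB.star₀
          | SA.star₁ a u≢a | SB.star₁ a u≢a
          | SA.star₁ b u≢b | SB.star₁ b u≢b
    = two ⟦ det (edge u a ∷ edge u b ∷ A ++ Z) ⟧ ⟦ det (unit u ∷ A ++ Z) ⟧ ⟦ det (unit u ∷ B ++ Z) ⟧
    where
    two : ∀ t α α′ → (t * 0 + α * α′) + (α * α′ + 0) ≡ α * α′ + α * α′
    two = solve-∀

  local₀ : W A B ≡ 0
  local₀ rewrite det-null (A ++ Z) (unit≢𝟎 u) nullA = refl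

  local₁ : ∀ a → act (just (edge u a)) W A B ≡ 0
  local₁ a rewrite det-null (A ++ Z) (unit≢𝟎 u) nullA | det-null (B ++ Z) (unit≢𝟎 u) nullB =
    trans (ℕₚ.+-identityʳ _) (ℕₚ.*-zeroʳ ⟦ det (edge u a ∷ A ++ Z) ⟧)

  private
    W′-zeroˡ : ∀ X Y → 𝟎 ∈ X → W′ X Y ≡ 0
    W′-zeroˡ X Y 𝟎∈ rewrite det-𝟎∈ {A = unit u ∷ X ++ Z} (there (∈-++⁺ˡ 𝟎∈)) = refl
    W′-zeroʳ : ∀ X Y → 𝟎 ∈ Y → W′ X Y ≡ 0
    W′-zeroʳ X Y 𝟎∈ rewrite det-𝟎∈ {A = unit u ∷ Y ++ Z} (there (∈-++⁺ˡ 𝟎∈)) = ℕₚ.*-zeroʳ ⟦ det (unit u ∷ X ++ Z) ⟧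

  loopˡ : ∀ f → act f (act (just 𝟎) W′) A B ≡ 0
  loopˡ nothing  = cong₂ _+_ (W′-zeroˡ _ _ (here refl)) (W′-zeroʳ A _ (here refl))
  loopˡ (just r) = cong₂ _+_
    (cong₂ _+_ (W′-zeroˡ _ _ (here refl)) (W′-zeroʳ (r ∷ A) _ (here refl)))
    (cong₂ _+_ (W′-zeroˡ _ _ (here refl)) (W′-zeroʳ A _ (here refl)))

  loopʳ : ∀ f → act (just 𝟎) (act f W′) A B ≡ 0
  loopʳ nothing  = loopˡ nothing
  loopʳ (just r) = cong₂ _+_
    (cong₂ _+_ (W′-zeroˡ _ _ (there (here refl))) (W′-zeroˡ (𝟎 ∷ A) _ (here refl)))
    (cong₂ _+_ (W′-zeroʳ (r ∷ A) _ (here refl)) (W′-zeroʳ A _ (there (here refl))))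

private
  facᵇ : Bool → X → Maybe X
  facᵇ t r = if t then nothing else just r

-- An edge from `u` to `v` is absent from G ─ v, so the identity degenerates according to which of
-- `a`, `b`, `c`, `d` are `v`. A pairing of two copies of `v` creates a loop at `v`; its row is `𝟎`,
-- so that term vanishes as it should.
local : (Z : List (Bits n)) (u : Fin n) (A B : List (Bits n)) →
  All Closed (A ++ Z) → All Closed (B ++ Z) → Null (A ++ Z) (unit u) → Null (B ++ Z) (unit u) →
  (v a b c d : Fin n) → v ≢ u → u ≢ a → u ≢ b → u ≢ c → u ≢ d →
  let W  = pairWeight (λ A → det (A ++ Z))
      W′ = pairWeight (λ A → det (unit u ∷ A ++ Z)) in
  act (factor v u d) (act (factor v u c) (act (factor v u b) (act (factor v u a) W))) A B ≡
  act (factor v c d) (act (factor v a b) W′) A B + act (factor v b d) (act (factor v a c) W′) A B +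
  act (factor v b c) (act (factor v a d) W′) A B
local Z u A B closedA closedB nullA nullB v a b c d v≢u u≢a u≢b u≢c u≢d =
  go (does (v Fin.≟ u)) (does (v Fin.≟ a)) (does (v Fin.≟ b)) (does (v Fin.≟ c)) (does (v Fin.≟ d))
     (dec-false (v Fin.≟ u) v≢u) (is a) (is b) (is c) (is d)
  where
  open Local Z u A B closedA closedB nullA nullB
  is : ∀ x → does (v Fin.≟ x) ≡ true → v ≡ x
  is x eq with v Fin.≟ x
  ... | yes v≡x = v≡x
  loop : ∀ {x y} → v ≡ x → v ≡ y → edge x y ≡ 𝟎
  loop refl refl = edge-self v
  zeroˡ : ∀ {x y} f → v ≡ x → v ≡ y → act f (act (just (edge x y)) W′) A B ≡ 0
  zeroˡ f p q = trans (cong (λ e → act f (act (just e) W′) A B) (loop p q)) (loopˡ f)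
  zeroʳ : ∀ {x y} f → v ≡ x → v ≡ y → act (just (edge x y)) (act f W′) A B ≡ 0
  zeroʳ f p q = trans (cong (λ e → act (just e) (act f W′) A B) (loop p q)) (loopʳ f)
  swap₂₃ : ∀ x y z → x + y + z ≡ x + z + y
  swap₂₃ = solve-∀
  rotate : ∀ x y z → x + y + z ≡ z + x + y
  rotate = solve-∀
  reverse : ∀ x y z → x + y + z ≡ z + y + x
  reverse = solve-∀
  go : ∀ cu ca cb cc cd → cu ≡ false → (ca ≡ true → v ≡ a) → (cb ≡ true → v ≡ b) → (cc ≡ true → v ≡ c) → (cd ≡ true → v ≡ d) →
    act (facᵇ (cu xor cd) (edge u d)) (act (facᵇ (cu xor cc) (edge u c)) (act (facᵇ (cu xor cb) (edge u b)) (act (facᵇ (cu xor ca) (edge u a)) W))) A B ≡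
    act (facᵇ (cc xor cd) (edge c d)) (act (facᵇ (ca xor cb) (edge a b)) W′) A B + act (facᵇ (cb xor cd) (edge b d)) (act (facᵇ (ca xor cc) (edge a c)) W′) A B +
    act (facᵇ (cb xor cc) (edge b c)) (act (facᵇ (ca xor cd) (edge a d)) W′) A B
  go .false false false false false refl va vb vc vd = local₄ a b c d u≢a u≢b u≢c u≢d
  go .false false false false true  refl va vb vc vd = local₃ a b c u≢a u≢b u≢c
  go .false false false true  false refl va vb vc vd = trans (local₃ a b d u≢a u≢b u≢d) (swap₂₃ (act (just (edge a b)) W′ A B) (act (just (edge a d)) W′ A B) _)
  go .false false true  false false refl va vb vc vd = trans (local₃ a c d u≢a u≢c u≢d) (rotate (act (just (edge a c)) W′ A B) (act (just (edge a d)) W′ A B) _)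
  go .false true  false false false refl va vb vc vd = trans (local₃ b c d u≢b u≢c u≢d) (reverse (act (just (edge b c)) W′ A B) (act (just (edge b d)) W′ A B) _)
  go .false false false true  true  refl va vb vc vd = trans (local₂ a b u≢a u≢b)
    (sym (cong (λ x → x + W′ A B + W′ A B) (zeroʳ (just (edge a b)) (vc refl) (vd refl))))
  go .false false true  false true  refl va vb vc vd = trans (local₂ a c u≢a u≢c)
    (sym (cong (λ x → x + W′ A B) (trans (cong (W′ A B +_) (zeroʳ (just (edge a c)) (vb refl) (vd refl))) (ℕₚ.+-identityʳ _))))
  go .false true  false false true  refl va vb vc vd = trans (local₂ b c u≢b u≢c)
    (sym (trans (cong (W′ A B + W′ A B +_) (zeroˡ (just (edge b c)) (va refl) (vd refl))) (ℕₚ.+-identityʳ _)))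
  go .false false true  true  false refl va vb vc vd = trans (local₂ a d u≢a u≢d)
    (sym (trans (cong (W′ A B + W′ A B +_) (zeroʳ (just (edge a d)) (vb refl) (vc refl))) (ℕₚ.+-identityʳ _)))
  go .false true  false true  false refl va vb vc vd = trans (local₂ b d u≢b u≢d)
    (sym (cong (λ x → x + W′ A B) (trans (cong (W′ A B +_) (zeroˡ (just (edge b d)) (va refl) (vc refl))) (ℕₚ.+-identityʳ _))))
  go .false true  true  false false refl va vb vc vd = trans (local₂ c d u≢c u≢d)
    (sym (cong (λ x → x + W′ A B + W′ A B) (zeroˡ (just (edge c d)) (va refl) (vb refl))))
  go .false false true  true  true  refl va vb vc vd = trans (local₁ a)
    (sym (cong₂ _+_ (cong₂ _+_ (zeroʳ nothing (vc refl) (vd refl)) (zeroʳ nothing (vb refl) (vd refl))) (zeroʳ nothing (vb refl) (vc refl))))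
  go .false true  false true  true  refl va vb vc vd = trans (local₁ b)
    (sym (cong₂ _+_ (cong₂ _+_ (zeroʳ nothing (vc refl) (vd refl)) (zeroˡ nothing (va refl) (vc refl))) (zeroˡ nothing (va refl) (vd refl))))
  go .false true  true  false true  refl va vb vc vd = trans (local₁ c)
    (sym (cong₂ _+_ (cong₂ _+_ (zeroˡ nothing (va refl) (vb refl)) (zeroʳ nothing (vb refl) (vd refl))) (zeroˡ nothing (va refl) (vd refl))))
  go .false true  true  true  false refl va vb vc vd = trans (local₁ d)
    (sym (cong₂ _+_ (cong₂ _+_ (zeroˡ nothing (va refl) (vb refl)) (zeroˡ nothing (va refl) (vc refl))) (zeroʳ nothing (vb refl) (vc refl))))
  go .false true  true  true  true  refl va vb vc vd = trans local₀
    (sym (cong₂ _+_ (cong₂ _+_ (zeroˡ (just (edge c d)) (va refl) (vb refl)) (zeroˡ (just (edge b d)) (va refl) (vc refl))) (zeroˡ (just (edge b c)) (va refl) (vd refl))))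

-- Edge lists up to order and orientation

Edge : ℕ → Set
Edge n = Fin n × Fin n

infix 4 _≈_
-- Orientation is ignored along with order because `pull` writes all edges at `u` with `u` in front.
data _≈_ {n} : List (Edge n) → List (Edge n) → Set where
  refl  : ∀ {E} → E ≈ E
  prep  : ∀ e {E E′} → E ≈ E′ → e ∷ E ≈ e ∷ E′
  swap  : ∀ e f {E} → e ∷ f ∷ E ≈ f ∷ e ∷ E
  flip  : ∀ x y {E} → (x , y) ∷ E ≈ (y , x) ∷ E
  ≈-trans : ∀ {E E′ E″} → E ≈ E′ → E′ ≈ E″ → E ≈ E″

All-≈ : {P : Edge n → Set} → (∀ {x y} → P (x , y) → P (y , x)) → {E E′ : List (Edge n)} → E ≈ E′ → All P E → All P E′
All-≈ flipP refl        ps           = ps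
All-≈ flipP (prep e q)  (p ∷ ps)     = p ∷ All-≈ flipP q ps
All-≈ flipP (swap e f)  (p ∷ p′ ∷ ps) = p′ ∷ p ∷ ps
All-≈ flipP (flip x y)  (p ∷ ps)     = flipP p ∷ ps
All-≈ flipP (≈-trans q r) ps           = All-≈ flipP r (All-≈ flipP q ps)

map-≈ : {f : Edge n → X} → (∀ x y → f (x , y) ≡ f (y , x)) → {E E′ : List (Edge n)} → E ≈ E′ → map f E ↭ map f E′
map-≈ eq refl        = refl
map-≈ eq (prep e q)  = prep _ (map-≈ eq q)
map-≈ eq (swap e f)  = swap _ _ refl
map-≈ {f = f} eq (flip x y {E}) = subst (λ z → f (x , y) ∷ map f E ↭ z ∷ map f E) (eq x y) refl
map-≈ eq (≈-trans q r) = ↭-trans (map-≈ eq q) (map-≈ eq r)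

deg : Fin n → List (Edge n) → ℕ
deg u []            = 0
deg u ((x , y) ∷ E) = ⟦ does (u Fin.≟ x) ⟧ + ⟦ does (u Fin.≟ y) ⟧ + deg u E

deg-≈ : (u : Fin n) {E E′ : List (Edge n)} → E ≈ E′ → deg u E ≡ deg u E′
deg-≈ u refl = refl
deg-≈ u (prep (x , y) q) = cong (⟦ does (u Fin.≟ x) ⟧ + ⟦ does (u Fin.≟ y) ⟧ +_) (deg-≈ u q)
deg-≈ u (swap (x , y) (z , t) {E}) = exchange (⟦ does (u Fin.≟ x) ⟧ + ⟦ does (u Fin.≟ y) ⟧) (⟦ does (u Fin.≟ z) ⟧ + ⟦ does (u Fin.≟ t) ⟧) (deg u E)
  where
  exchange : ∀ p q r → p + (q + r) ≡ q + (p + r)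
  exchange = solve-∀
deg-≈ u (flip x y {E}) = cong (_+ deg u E) (ℕₚ.+-comm ⟦ does (u Fin.≟ x) ⟧ ⟦ does (u Fin.≟ y) ⟧)
deg-≈ u (≈-trans q r) = trans (deg-≈ u q) (deg-≈ u r)

≈-length : {E E′ : List (Edge n)} → E ≈ E′ → length E ≡ length E′
≈-length refl        = refl
≈-length (prep e q)  = cong suc (≈-length q)
≈-length (swap e f)  = refl
≈-length (flip x y)  = refl
≈-length (≈-trans q r) = trans (≈-length q) (≈-length r)

NonLoop : Edge n → Set
NonLoop (x , y) = x ≢ y

Avoids : Fin n → Edge n → Set
Avoids u (x , y) = u ≢ x × u ≢ y

shift-≈ : (e : Edge n) (D E : List (Edge n)) → e ∷ D ++ E ≈ D ++ e ∷ E
shift-≈ e []      E = refl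
shift-≈ e (f ∷ D) E = ≈-trans (swap e f) (prep f (shift-≈ e D E))

pull : (u : Fin n) (E : List (Edge n)) → All NonLoop E → ∃ λ as → ∃ λ E′ →
       E ≈ map (u ,_) as ++ E′ × length as ≡ deg u E × All (Avoids u) E′ × All (u ≢_) as
pull u [] [] = [] , [] , refl , refl , [] , []
pull u ((x , y) ∷ E) (x≢y ∷ nl) with pull u E nl
... | as , E′ , E≈ , len , av , u≢as with u Fin.≟ x | u Fin.≟ y
...   | yes u≡x    | yes u≡y    = contradiction (trans (sym u≡x) u≡y) x≢y
...   | yes refl | no u≢y     = y ∷ as , E′ , prep _ E≈ , cong suc len , av , u≢y ∷ u≢as
...   | no u≢x     | yes refl = x ∷ as , E′ , ≈-trans (flip x u) (prep _ E≈) , cong suc len , av , u≢x ∷ u≢as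
...   | no u≢x     | no u≢y     = as , (x , y) ∷ E′ , ≈-trans (prep _ E≈) (shift-≈ _ (map (u ,_) as) E′) , len , (u≢x , u≢y) ∷ av , u≢as

-- Invariance of the number of spanning tree bipartitions

factors : Fin n → List (Edge n) → List (Maybe (Bits n))
factors v = map (λ (x , y) → factor v x y)

-- The number of ordered partitions of the edges of G ─ v into two spanning trees, with the vertices of Z grounded.
treePairs : Fin n → List (Bits n) → List (Edge n) → ℕ
treePairs v Z E = run (factors v E) (pairWeight (λ A → det (A ++ Z)))

pairWeight-sym : (Z : List (Bits n)) → Symmetric₂ (pairWeight (λ A → det (A ++ Z)))
pairWeight-sym Z p q = cong₂ (λ x y → ⟦ x ⟧ * ⟦ y ⟧) (det-↭ (++⁺ʳ Z p)) (det-↭ (++⁺ʳ Z q))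

treePairs-≈ : (v : Fin n) (Z : List (Bits n)) {E E′ : List (Edge n)} → E ≈ E′ → treePairs v Z E ≡ treePairs v Z E′
treePairs-≈ v Z q = run-↭ (pairWeight-sym Z) (map-≈ (factor-comm v) q)

treePairs-loop : (v : Fin n) (Z : List (Bits n)) (x : Fin n) (E : List (Edge n)) → treePairs v Z ((x , x) ∷ E) ≡ 0
treePairs-loop v Z x E rewrite factor-self v x = trans (run-ext fs vanish) (run-zero fs)
  where
  fs = factors v E
  vanish : ∀ A B → ⟦ det (𝟎 ∷ A ++ Z) ⟧ * ⟦ det (B ++ Z) ⟧ + ⟦ det (A ++ Z) ⟧ * ⟦ det (𝟎 ∷ B ++ Z) ⟧ ≡ 0
  vanish A B rewrite det-𝟎 (A ++ Z) | det-𝟎 (B ++ Z) = ℕₚ.*-zeroʳ ⟦ det (A ++ Z) ⟧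

avoids-factor : (u v : Fin n) (E : List (Edge n)) → All (Avoids u) E →
  All (MAll.All (λ r → Closed r × dot r (unit u) ≡ false)) (factors v E)
avoids-factor u v []            []                 = []
avoids-factor u v ((x , y) ∷ E) ((u≢x , u≢y) ∷ av) = good (does (v Fin.≟ x) xor does (v Fin.≟ y)) ∷ avoids-factor u v E av
  where
  good : ∀ t → MAll.All (λ r → Closed r × dot r (unit u) ≡ false) (if t then nothing else just (edge x y))
  good true  = nothing
  good false = just (edge-closed x y , trans (dot-edge x y (unit u)) (cong₂ _xor_ (lookup-unit-other u≢x) (lookup-unit-other u≢y)))

-- The eliminated vertex keeps its column: it is grounded by adding `unit u` to `Z`, so matrix sizes
-- stay fixed during the recursion of `treePairs-swap`.
treePairs-split : (v u a b c d : Fin n) (Z : List (Bits n)) (E : List (Edge n)) → v ≢ u → u ≢ a → u ≢ b → u ≢ c → u ≢ d →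
  All Closed Z → Null Z (unit u) → All (Avoids u) E →
  treePairs v Z ((u , a) ∷ (u , b) ∷ (u , c) ∷ (u , d) ∷ E) ≡
  treePairs v (unit u ∷ Z) ((a , b) ∷ (c , d) ∷ E) + treePairs v (unit u ∷ Z) ((a , c) ∷ (b , d) ∷ E) +
  treePairs v (unit u ∷ Z) ((a , d) ∷ (b , c) ∷ E)
treePairs-split {n} v u a b c d Z E v≢u u≢a u≢b u≢c u≢d closed null av = begin
  run (factor v u a ∷ factor v u b ∷ factor v u c ∷ factor v u d ∷ fs) W
    ≡⟨ trans (run-∷ (factor v u a) _ _) (trans (run-∷ (factor v u b) _ _) (trans (run-∷ (factor v u c) _ _) (run-∷ (factor v u d) _ _))) ⟩
  run fs (act (factor v u d) (act (factor v u c) (act (factor v u b) (act (factor v u a) W))))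
    ≡⟨ run-cong fs (avoids-factor u v E av) (λ A B gA gB → local Z u A B (Allₚ.++⁺ (All.map proj₁ gA) closed) (Allₚ.++⁺ (All.map proj₁ gB) closed)
         (Allₚ.++⁺ (All.map proj₂ gA) null) (Allₚ.++⁺ (All.map proj₂ gB) null) v a b c d v≢u u≢a u≢b u≢c u≢d) ⟩
  run fs (λ A B → T a b c d A B + T a c b d A B + T a d b c A B)
    ≡⟨ trans (run-+ fs (λ A B → T a b c d A B + T a c b d A B) (T a d b c)) (cong (_+ run fs (T a d b c)) (run-+ fs (T a b c d) (T a c b d))) ⟩
  run fs (T a b c d) + run fs (T a c b d) + run fs (T a d b c)
    ≡⟨ cong₂ _+_ (cong₂ _+_ (back a b c d) (back a c b d)) (back a d b c) ⟩
  _ ∎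
  where
  open ≡-Reasoning
  fs = factors v E
  W W′ : List (Bits n) → List (Bits n) → ℕ
  W  = pairWeight (λ A → det (A ++ Z))
  W′ = pairWeight (λ A → det (unit u ∷ A ++ Z))
  T : Fin n → Fin n → Fin n → Fin n → List (Bits n) → List (Bits n) → ℕ
  T a b c d = act (factor v c d) (act (factor v a b) W′)
  back : ∀ a b c d → run fs (T a b c d) ≡ treePairs v (unit u ∷ Z) ((a , b) ∷ (c , d) ∷ E)
  back a b c d = trans (sym (trans (run-∷ (factor v a b) _ _) (run-∷ (factor v c d) _ _)))
    (run-ext (factor v a b ∷ factor v c d ∷ fs) λ A B →
      cong₂ (λ x y → ⟦ x ⟧ * ⟦ y ⟧) (det-↭ (↭-sym (shift (unit u) A Z))) (det-↭ (↭-sym (shift (unit u) B Z))))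

-- `U` lists the vertices still to be eliminated. Elimination keeps the degrees of the others, so
-- all of `U` stays 4-regular; once `U` is empty every edge joins `v` and `w` and disappears from
-- both sides.
treePairs-swap : (v w : Fin n) (U : List (Fin n)) (Z : List (Bits n)) (E : List (Edge n)) →
  All (λ u → v ≢ u × w ≢ u) U → AllPairs _≢_ U → All NonLoop E →
  All (λ (x , y) → x ∈ v ∷ w ∷ U × y ∈ v ∷ w ∷ U) E → All (λ u → deg u E ≡ 4) U →
  All Closed Z → All (λ u → Null Z (unit u)) U → treePairs v Z E ≡ treePairs w Z E
treePairs-swap {n} v w [] Z E [] [] nonloop ends [] closed [] =
  cong (λ fs → run fs (pairWeight (λ A → det (A ++ Z)))) (skip E nonloop ends)
  where
  other : ∀ {x : Fin n} {y} → x ≢ y → does (x Fin.≟ x) xor does (x Fin.≟ y) ≡ true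
  other {x} {y} x≢y rewrite dec-true (x Fin.≟ x) refl | dec-false (x Fin.≟ y) x≢y = refl
  skipped : ∀ x y → x ≢ y → x ∈ v ∷ w ∷ [] → y ∈ v ∷ w ∷ [] → factor v x y ≡ factor w x y
  skipped x y x≢y (here refl) (here refl) = contradiction refl x≢y
  skipped x y x≢y (there (here refl)) (there (here refl)) = contradiction refl x≢y
  skipped x y x≢y (here refl) (there (here refl)) = cong (λ t → if t then nothing else just (edge x y))
    (trans (other x≢y) (sym (trans (xor-comm (does (w Fin.≟ v)) _) (other (x≢y ∘ sym)))))
  skipped x y x≢y (there (here refl)) (here refl) = cong (λ t → if t then nothing else just (edge x y))
    (trans (trans (xor-comm (does (v Fin.≟ w)) _) (other (x≢y ∘ sym))) (sym (other x≢y)))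
  skip : ∀ E → All NonLoop E → All (λ (x , y) → x ∈ v ∷ w ∷ [] × y ∈ v ∷ w ∷ []) E →
         factors v E ≡ factors w E
  skip []            []         []              = refl
  skip ((x , y) ∷ E) (nl ∷ nls) ((p , q) ∷ pqs) = cong₂ _∷_ (skipped x y nl p q) (skip E nls pqs)
treePairs-swap {n} v w (u ∷ U) Z E ((v≢u , w≢u) ∷ apart) (u∉U ∷ unique) nonloop ends (deg4 ∷ degs) closed (null ∷ nulls)
  with pull u E nonloop
... | as , E′ , E≈ , len , av , u≢as with as | trans len deg4
... | a ∷ b ∷ c ∷ d ∷ [] | refl = combine u≢as
  where
  Z′ = unit u ∷ Z
  star = (u , a) ∷ (u , b) ∷ (u , c) ∷ (u , d) ∷ E′
  nonloop′ : All NonLoop star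
  nonloop′ = All-≈ (λ ≢ → ≢ ∘ sym) E≈ nonloop
  ends′ : All (λ (x , y) → x ∈ v ∷ w ∷ u ∷ U × y ∈ v ∷ w ∷ u ∷ U) star
  ends′ = All-≈ (λ (p , q) → q , p) E≈ ends
  drop-u : ∀ {x} → u ≢ x → x ∈ v ∷ w ∷ u ∷ U → x ∈ v ∷ w ∷ U
  drop-u u≢x (here p)                  = here p
  drop-u u≢x (there (here p))          = there (here p)
  drop-u u≢x (there (there (here p)))  = contradiction (sym p) u≢x
  drop-u u≢x (there (there (there p))) = there (there p)
  drop-ends : ∀ {E} → All (Avoids u) E → All (λ (x , y) → x ∈ v ∷ w ∷ u ∷ U × y ∈ v ∷ w ∷ u ∷ U) E →
              All (λ (x , y) → x ∈ v ∷ w ∷ U × y ∈ v ∷ w ∷ U) E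
  drop-ends []               []             = []
  drop-ends ((p , q) ∷ rest) ((r , s) ∷ es) = (drop-u p r , drop-u q s) ∷ drop-ends rest es
  null′ : ∀ {t} → u ≢ t × Null Z (unit t) → Null Z′ (unit t)
  null′ {t} (u≢t , nt) = trans (dot-unit u (unit t)) (lookup-unit-other (u≢t ∘ sym)) ∷ nt
  rest : ∀ {x y z t} → x ∈ v ∷ w ∷ U → y ∈ v ∷ w ∷ U → z ∈ v ∷ w ∷ U → t ∈ v ∷ w ∷ U →
         (∀ s → u ≢ s → deg s star ≡ deg s ((x , y) ∷ (z , t) ∷ E′)) →
         treePairs v Z′ ((x , y) ∷ (z , t) ∷ E′) ≡ treePairs w Z′ ((x , y) ∷ (z , t) ∷ E′)
  rest {x} {y} {z} {t} x∈ y∈ z∈ t∈ same with x Fin.≟ y | z Fin.≟ t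
  -- A pairing with a loop violates `NonLoop`, so the induction hypothesis does not cover it; both
  -- counts are 0 directly.
  ... | yes refl | _          = trans (treePairs-loop v Z′ x _) (sym (treePairs-loop w Z′ x _))
  ... | no _       | yes refl = trans (trans (treePairs-≈ v Z′ (swap (x , y) (z , z))) (treePairs-loop v Z′ z _))
                                  (sym (trans (treePairs-≈ w Z′ (swap (x , y) (z , z))) (treePairs-loop w Z′ z _)))
  ... | no x≢y     | no z≢t     = treePairs-swap v w U Z′ _ apart unique
    (x≢y ∷ z≢t ∷ All.tail (All.tail (All.tail (All.tail nonloop′))))
    ((x∈ , y∈) ∷ (z∈ , t∈) ∷ drop-ends av (All.tail (All.tail (All.tail (All.tail ends′)))))
    (All.zipWith (λ { {s} (u≢s , d4) → trans (sym (same s u≢s)) (trans (sym (deg-≈ s E≈)) d4) }) (u∉U , degs))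
    (unit-closed u ∷ closed) (All.zipWith null′ (u∉U , nulls))
  combine : All (u ≢_) (a ∷ b ∷ c ∷ d ∷ []) → treePairs v Z E ≡ treePairs w Z E
  combine (u≢a ∷ u≢b ∷ u≢c ∷ u≢d ∷ []) = trans (expand v v≢u) (trans
      (cong₂ _+_ (cong₂ _+_ (rest a∈ b∈ c∈ d∈ (λ s u≢s → trans (deg-star s u≢s) (arrange₁ (δ s a) (δ s b) (δ s c) (δ s d) _)))
                            (rest a∈ c∈ b∈ d∈ (λ s u≢s → trans (deg-star s u≢s) (arrange₂ (δ s a) (δ s b) (δ s c) (δ s d) _))))
                 (rest a∈ d∈ b∈ c∈ (λ s u≢s → trans (deg-star s u≢s) (arrange₃ (δ s a) (δ s b) (δ s c) (δ s d) _))))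
      (sym (expand w w≢u)))
    where
    expand : ∀ x → x ≢ u → treePairs x Z E ≡ treePairs x Z′ ((a , b) ∷ (c , d) ∷ E′) + treePairs x Z′ ((a , c) ∷ (b , d) ∷ E′) +
                                            treePairs x Z′ ((a , d) ∷ (b , c) ∷ E′)
    expand x x≢u = trans (treePairs-≈ x Z E≈) (treePairs-split x u a b c d Z E′ x≢u u≢a u≢b u≢c u≢d closed null av)
    a∈ = drop-u u≢a (proj₂ (All.head ends′))
    b∈ = drop-u u≢b (proj₂ (All.head (All.tail ends′)))
    c∈ = drop-u u≢c (proj₂ (All.head (All.tail (All.tail ends′))))
    d∈ = drop-u u≢d (proj₂ (All.head (All.tail (All.tail (All.tail ends′)))))
    δ : Fin n → Fin n → ℕ
    δ s x = ⟦ does (s Fin.≟ x) ⟧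
    deg-star : ∀ s → u ≢ s → deg s star ≡ δ s a + (δ s b + (δ s c + (δ s d + deg s E′)))
    deg-star s u≢s rewrite dec-false (s Fin.≟ u) (u≢s ∘ sym) = refl
    arrange₁ : ∀ a b c d e → a + (b + (c + (d + e))) ≡ a + b + (c + d + e)
    arrange₁ = solve-∀
    arrange₂ : ∀ a b c d e → a + (b + (c + (d + e))) ≡ a + c + (b + d + e)
    arrange₂ = solve-∀
    arrange₃ : ∀ a b c d e → a + (b + (c + (d + e))) ≡ a + d + (b + c + e)
    arrange₃ = solve-∀

-- Linear dependence

-- Comb A x t: x is a sum of a subfamily of A, nonempty iff t.
data Comb {n} : List (Bits n) → Bits n → Bool → Set where
  []   : Comb [] 𝟎 false
  skip : ∀ {r A x t} → Comb A x t → Comb (r ∷ A) x t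
  take : ∀ {r A x t} → Comb A x t → Comb (r ∷ A) (r ⊕ x) true

Dependent : List (Bits n) → Set
Dependent A = Comb A 𝟎 true

⊕-identityʳ : (r : Bits n) → r ⊕ 𝟎 ≡ r
⊕-identityʳ []      = refl
⊕-identityʳ (b ∷ r) = cong₂ _∷_ (xor-identityʳ b) (⊕-identityʳ r)

⊕-identityˡ : (r : Bits n) → 𝟎 ⊕ r ≡ r
⊕-identityˡ r = trans (⊕-comm 𝟎 r) (⊕-identityʳ r)

⊕-assoc : (r s t : Bits n) → (r ⊕ s) ⊕ t ≡ r ⊕ (s ⊕ t)
⊕-assoc = Vecₚ.zipWith-assoc xor-assoc

⊕-exchange : (r s t : Bits n) → r ⊕ (s ⊕ t) ≡ s ⊕ (r ⊕ t)
⊕-exchange r s t = trans (sym (⊕-assoc r s t)) (trans (cong (_⊕ t) (⊕-comm r s)) (⊕-assoc s r t))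

comb-↭ : {A B : List (Bits n)} → A ↭ B → ∀ {x t} → Comb A x t → Comb B x t
comb-↭ refl         c               = c
comb-↭ (prep r p)   (skip c)        = skip (comb-↭ p c)
comb-↭ (prep r p)   (take c)        = take (comb-↭ p c)
comb-↭ (swap r s p) (skip (skip c)) = skip (skip (comb-↭ p c))
comb-↭ (swap r s p) (skip (take c)) = take (skip (comb-↭ p c))
comb-↭ (swap r s p) (take (skip c)) = skip (take (comb-↭ p c))
comb-↭ (swap r s p) (take (take {x = x} c)) = subst (λ y → Comb _ y true) (⊕-exchange s r x) (take (take (comb-↭ p c)))
comb-↭ (_↭_.trans p q)  c               = comb-↭ q (comb-↭ p c)

comb-none : (A : List (Bits n)) → Comb A 𝟎 false
comb-none []      = []
comb-none (r ∷ A) = skip (comb-none A)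

comb-++ : {A B : List (Bits n)} → ∀ {x y t u} → Comb A x t → Comb B y u → Comb (A ++ B) (x ⊕ y) (t ∨ u)
comb-++ {y = y} [] d = subst (λ z → Comb _ z _) (sym (⊕-identityˡ y)) d
comb-++ (skip c) d = skip (comb-++ c d)
comb-++ {y = y} (take {r} {x = x} c) d = subst (λ z → Comb _ z true) (sym (⊕-assoc r x y)) (take (comb-++ c d))

comb-++⁻ : (A : List (Bits n)) {B : List (Bits n)} → ∀ {z v} → Comb (A ++ B) z v →
           ∃ λ x → ∃ λ y → ∃ λ t → ∃ λ u → Comb A x t × Comb B y u × z ≡ x ⊕ y × v ≡ t ∨ u
comb-++⁻ []      {z = z} {v} c = 𝟎 , z , false , v , [] , c , sym (⊕-identityˡ z) , refl
comb-++⁻ (r ∷ A) (skip c) with comb-++⁻ A c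
... | x , y , t , u , cx , cy , eq , eq′ = x , y , t , u , skip cx , cy , eq , eq′
comb-++⁻ (r ∷ A) (take c) with comb-++⁻ A c
... | x , y , t , u , cx , cy , eq , eq′ =
  r ⊕ x , y , true , u , take cx , cy , trans (cong (r ⊕_) eq) (sym (⊕-assoc r x y)) , refl

-- `R` takes in the rows already treated, so the induction always works at the front of `A`.
det-span : {A : List (Bits n)} {x : Bits n} {t : Bool} → Comb A x t → ∀ R → det (x ∷ A ++ R) ≡ false
det-span [] R = det-𝟎 R
det-span {x = x} (skip {r} {A} c) R =
  trans (det-↭ (prep x (↭-sym (shift r A R)))) (det-span c (r ∷ R))
det-span (take {r} {A} {x} c) R = trans (det-⊕ r x (r ∷ A ++ R))
  (cong₂ _xor_ (det-repeat r (A ++ R)) (trans (det-↭ (prep x (↭-sym (shift r A R)))) (det-span c (r ∷ R))))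

det-dependent : {A : List (Bits n)} → Dependent A → ∀ R → det (A ++ R) ≡ false
det-dependent c R = go c refl refl R
  where
  go : ∀ {A x t} → Comb A x t → x ≡ 𝟎 → t ≡ true → ∀ R → det (A ++ R) ≡ false
  go (skip {r} {A} c) eq eq′ R = trans (det-↭ (↭-sym (shift r A R))) (go c eq eq′ (r ∷ R))
  go (take {r} {A} {x} c) eq _ R = trans (cong (λ y → det (y ∷ A ++ R)) (⊕≡𝟎⇒≡ r x eq)) (det-span c R)

scale : Bool → Bits n → Bits n
scale true  r = r
scale false r = 𝟎

private
  comb-tails : (A : List (Bits (suc n))) → All (λ r → Vec.head r ≡ false) A → ∀ {x t} →
               Comb (map Vec.tail A) x t → Comb A (false ∷ x) t
  comb-tails []                []           []       = []
  comb-tails (_ ∷ A)           (_ ∷ heads)  (skip c) = skip (comb-tails A heads c)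
  comb-tails ((false ∷ r) ∷ A) (_ ∷ heads)  (take c) = take (comb-tails A heads c)
  comb-tails ((true ∷ r) ∷ A)  (() ∷ heads) (take c)

  -- `b` is the first coordinate of the lifted combination. It is also the parity of the number of
  -- times that elimination added `r₀`, hence the correction `scale b r₀`.
  comb-eliminate : (r₀ : Bits n) (A : List (Bits (suc n))) → ∀ {x t} → Comb (map (eliminate r₀) A) x t →
                   ∃ λ b → Comb A (b ∷ (x ⊕ scale b r₀)) t
  comb-eliminate r₀ [] [] = false , subst (λ y → Comb [] (false ∷ y) false) (sym (⊕-self 𝟎)) []
  comb-eliminate r₀ (r ∷ A) (skip c) with comb-eliminate r₀ A c
  ... | b , d = b , skip d
  comb-eliminate r₀ ((false ∷ r) ∷ A) (take {x = x} c) with comb-eliminate r₀ A c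
  ... | b , d = b , subst (λ y → Comb _ (b ∷ y) true) (sym (⊕-assoc r x (scale b r₀))) (take d)
  comb-eliminate r₀ ((true ∷ r) ∷ A) (take {x = x} c) with comb-eliminate r₀ A c
  ... | b , d = not b , subst (λ y → Comb _ (not b ∷ y) true) (eq b) (take d)
    where
    open ≡-Reasoning
    flip-scale : ∀ b → r₀ ⊕ scale (not b) r₀ ≡ scale b r₀
    flip-scale true  = ⊕-identityʳ r₀
    flip-scale false = ⊕-self r₀
    eq : ∀ b → r ⊕ (x ⊕ scale b r₀) ≡ ((r ⊕ r₀) ⊕ x) ⊕ scale (not b) r₀
    eq b = begin
      r ⊕ (x ⊕ scale b r₀)                   ≡⟨ cong (λ y → r ⊕ (x ⊕ y)) (sym (flip-scale b)) ⟩
      r ⊕ (x ⊕ (r₀ ⊕ scale (not b) r₀))     ≡⟨ cong (r ⊕_) (⊕-exchange x r₀ _) ⟩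
      r ⊕ (r₀ ⊕ (x ⊕ scale (not b) r₀))     ≡⟨ sym (⊕-assoc r r₀ _) ⟩
      (r ⊕ r₀) ⊕ (x ⊕ scale (not b) r₀)     ≡⟨ sym (⊕-assoc (r ⊕ r₀) x _) ⟩
      ((r ⊕ r₀) ⊕ x) ⊕ scale (not b) r₀     ∎

dependent-long : (A : List (Bits n)) → n < length A → Dependent A
dependent-long {zero}  ([] ∷ A) lt = take (comb-none A)
dependent-long {suc n} A        lt with pivot A
... | inj₁ heads = comb-tails A heads (dependent-long (map Vec.tail A)
  (subst (n <_) (sym (Listₚ.length-map Vec.tail A)) (ℕₚ.<-trans (ℕₚ.n<1+n n) lt)))
... | inj₂ (r₀ , rest , p) with comb-eliminate r₀ rest (dependent-long (map (eliminate r₀) rest)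
  (subst (n <_) (sym (Listₚ.length-map (eliminate r₀) rest)) (ℕₚ.≤-pred (subst (suc n <_) (↭-length p) lt))))
... | false , d = comb-↭ (↭-sym p) (skip (subst (λ y → Comb rest (false ∷ y) true) (⊕-self 𝟎) d))
... | true  , d = comb-↭ (↭-sym p) (subst (λ y → Comb ((true ∷ r₀) ∷ rest) y true) vanish (take d))
  where
  vanish : (true ∷ r₀) ⊕ (true ∷ (𝟎 ⊕ r₀)) ≡ 𝟎
  vanish = cong (false ∷_) (trans (cong (r₀ ⊕_) (⊕-identityˡ r₀)) (⊕-self r₀))

removeAt-⊕ : (r s : Bits (suc n)) (i : Fin (suc n)) → Vec.removeAt (r ⊕ s) i ≡ Vec.removeAt r i ⊕ Vec.removeAt s i
removeAt-⊕ (a ∷ r)         (b ∷ s)         zero    = refl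
removeAt-⊕ (a ∷ r@(_ ∷ _)) (b ∷ s@(_ ∷ _)) (suc i) = cong ((a xor b) ∷_) (removeAt-⊕ r s i)

removeAt-𝟎 : (i : Fin (suc n)) → Vec.removeAt 𝟎 i ≡ 𝟎 {n}
removeAt-𝟎 zero                = refl
removeAt-𝟎 {suc n} (suc i) = cong (false ∷_) (removeAt-𝟎 i)

dot-removeAt : (r s : Bits (suc n)) (i : Fin (suc n)) →
               dot r s ≡ (lookup r i ∧ lookup s i) xor dot (Vec.removeAt r i) (Vec.removeAt s i)
dot-removeAt (a ∷ r)         (b ∷ s)         zero    = refl
dot-removeAt (a ∷ r@(_ ∷ _)) (b ∷ s@(_ ∷ _)) (suc i) = trans (cong ((a ∧ b) xor_) (dot-removeAt r s i))
  (trans (sym (xor-assoc (a ∧ b) (lookup r i ∧ lookup s i) _)) (trans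
    (cong (_xor dot (Vec.removeAt r i) (Vec.removeAt s i)) (xor-comm (a ∧ b) _))
    (xor-assoc (lookup r i ∧ lookup s i) (a ∧ b) _)))

≢𝟎⇒true : (s : Bits n) → s ≢ 𝟎 → ∃ λ i → lookup s i ≡ true
≢𝟎⇒true []          s≢𝟎 = contradiction refl s≢𝟎
≢𝟎⇒true (true ∷ s)  s≢𝟎 = zero , refl
≢𝟎⇒true (false ∷ s) s≢𝟎 with ≢𝟎⇒true s (λ eq → s≢𝟎 (cong (false ∷_) eq))
... | i , eq = suc i , eq

removeAt≡𝟎 : (x : Bits (suc n)) (i : Fin (suc n)) → lookup x i ≡ false → Vec.removeAt x i ≡ 𝟎 → x ≡ 𝟎
removeAt≡𝟎 (a ∷ x)         zero    p q = cong₂ _∷_ p q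
removeAt≡𝟎 (a ∷ x@(_ ∷ _)) (suc i) p q = cong₂ _∷_ (cong Vec.head q) (removeAt≡𝟎 x i p (cong Vec.tail q))

-- Remove a column `i` at which the kernel vector `s` is 1. The rows are then too many and hence
-- dependent; the lifted combination is supported at `i` and orthogonal to `s`, so it is 0 there as
-- well.
dependent-singular : (A : List (Bits n)) → length A ≡ n → Singular A → Dependent A
dependent-singular {zero}  A len ([] , s≢𝟎 , ns) = contradiction refl s≢𝟎
dependent-singular {suc n} A len (s , s≢𝟎 , ns) with ≢𝟎⇒true s s≢𝟎
... | i , sᵢ with lift A ns (dependent-long (map (λ r → Vec.removeAt r i) A)
                 (ℕₚ.≤-reflexive (trans (sym len) (sym (Listₚ.length-map _ A)))))
  where
  lift : ∀ A → Null A s → ∀ {x t} → Comb (map (λ r → Vec.removeAt r i) A) x t →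
         ∃ λ y → Comb A y t × Vec.removeAt y i ≡ x × dot y s ≡ false
  lift []      []       []       = 𝟎 , [] , removeAt-𝟎 i , dot-𝟎ˡ s
  lift (r ∷ A) (p ∷ ps) (skip c) with lift A ps c
  ... | y , d , eq , dy = y , skip d , eq , dy
  lift (r ∷ A) (p ∷ ps) (take c) with lift A ps c
  ... | y , d , eq , dy = r ⊕ y , take d , trans (removeAt-⊕ r y i) (cong (Vec.removeAt r i ⊕_) eq) ,
                          trans (dot-⊕ˡ r y s) (cong₂ _xor_ p dy)
... | y , d , eq , dy = subst (λ z → Comb A z true) (removeAt≡𝟎 y i yᵢ eq) d
  where
  open ≡-Reasoning
  yᵢ : lookup y i ≡ false
  yᵢ = begin
    lookup y i                                                             ≡⟨ sym (Boolₚ.∧-identityʳ _) ⟩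
    lookup y i ∧ true                                                      ≡⟨ cong (lookup y i ∧_) (sym sᵢ) ⟩
    lookup y i ∧ lookup s i                                                ≡⟨ sym (xor-identityʳ _) ⟩
    (lookup y i ∧ lookup s i) xor false                                    ≡⟨ cong ((lookup y i ∧ lookup s i) xor_) (sym (trans (cong (λ z → dot z (Vec.removeAt s i)) eq) (dot-𝟎ˡ (Vec.removeAt s i)))) ⟩
    (lookup y i ∧ lookup s i) xor dot (Vec.removeAt y i) (Vec.removeAt s i) ≡⟨ sym (dot-removeAt y s i) ⟩
    dot y s                                                                ≡⟨ dy ⟩
    false                                                                  ∎

-- Grassmann–Plücker

private
  pickˡ : ∀ x y → (x ∧ true) xor (y ∧ false) ≡ x
  pickˡ x y = trans (cong₂ _xor_ (Boolₚ.∧-identityʳ x) (∧-zeroʳ y)) (xor-identityʳ x)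

  pickʳ : ∀ x y → (x ∧ false) xor (y ∧ true) ≡ y
  pickʳ x y = cong₂ _xor_ (∧-zeroʳ x) (Boolₚ.∧-identityʳ y)

-- Each term has a factor containing `a`, and the relation is symmetric in `b`, `c`, `d`. So either
-- every term vanishes or one may assume that `det (a ∷ b ∷ R)` is 1.
plücker : (a b c d : Bits n) (R : List (Bits n)) →
  (det (a ∷ b ∷ R) ∧ det (c ∷ d ∷ R)) xor ((det (a ∷ c ∷ R) ∧ det (b ∷ d ∷ R)) xor (det (a ∷ d ∷ R) ∧ det (b ∷ c ∷ R))) ≡ false
plücker {n} a b c d R = cases _ _ _ refl refl refl
  where
  -- If (a, b) is a basis of the functionals on the kernel of R, expand the others in it.
  expand : ∀ a b c d → det (a ∷ b ∷ R) ≡ true →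
           det (c ∷ d ∷ R) ≡ (det (a ∷ c ∷ R) ∧ det (b ∷ d ∷ R)) xor (det (a ∷ d ∷ R) ∧ det (b ∷ c ∷ R))
  expand a b c d ab = bilinear
    where
    len : suc (length R) < n
    len = ℕₚ.≤-reflexive (proj₁ (det-true _ ab))
    -- `ka` and `kb` will be the basis of the kernel of `R` dual to `a` and `b`.
    Kᵃ = nullVector (b ∷ R) len
    Kᵇ = nullVector (a ∷ R) len
    ka = proj₁ Kᵃ
    kb = proj₁ Kᵇ
    nka = All.tail (proj₂ (proj₂ Kᵃ))
    nkb = All.tail (proj₂ (proj₂ Kᵇ))
    a-ka : dot a ka ≡ true
    a-ka = ¬-not λ eq → proj₂ (det-true _ ab) (ka , proj₁ (proj₂ Kᵃ) , eq ∷ proj₂ (proj₂ Kᵃ))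
    b-ka : dot b ka ≡ false
    b-ka = All.head (proj₂ (proj₂ Kᵃ))
    a-kb : dot a kb ≡ false
    a-kb = All.head (proj₂ (proj₂ Kᵇ))
    b-kb : dot b kb ≡ true
    b-kb = ¬-not λ eq → proj₂ (det-true _ ab) (kb , proj₁ (proj₂ Kᵇ) , a-kb ∷ eq ∷ nkb)
    coord : Bits n → Bits n
    coord z = scale (dot a z) ka ⊕ scale (dot b z) kb
    dot-scale : ∀ r t (k : Bits n) → dot r (scale t k) ≡ t ∧ dot r k
    dot-scale r true  k = refl
    dot-scale r false k = dot-𝟎ʳ r
    null-scale : ∀ t {k} → Null R k → Null R (scale t k)
    null-scale true  nk = nk
    null-scale false nk = All.universal dot-𝟎ʳ R
    dot-coord : ∀ r z → dot r (coord z) ≡ (dot a z ∧ dot r ka) xor (dot b z ∧ dot r kb)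
    dot-coord r z = trans (dot-⊕ʳ r _ _) (cong₂ _xor_ (dot-scale r (dot a z) ka) (dot-scale r (dot b z) kb))
    reduce : ∀ z → Null R z → z ≡ coord z
    reduce z nz = ⊕≡𝟎⇒≡ z (coord z) (decide ((z ⊕ coord z) ≟ᵛ 𝟎))
      where
      at-a : dot a (z ⊕ coord z) ≡ false
      at-a = trans (dot-⊕ʳ a z (coord z)) (trans (cong (dot a z xor_)
        (trans (dot-coord a z) (trans (cong₂ (λ x y → (dot a z ∧ x) xor (dot b z ∧ y)) a-ka a-kb) (pickˡ (dot a z) (dot b z))))) (xor-same (dot a z)))
      at-b : dot b (z ⊕ coord z) ≡ false
      at-b = trans (dot-⊕ʳ b z (coord z)) (trans (cong (dot b z xor_)
        (trans (dot-coord b z) (trans (cong₂ (λ x y → (dot a z ∧ x) xor (dot b z ∧ y)) b-ka b-kb) (pickʳ (dot a z) (dot b z))))) (xor-same (dot b z)))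
      decide : Dec (z ⊕ coord z ≡ 𝟎) → z ⊕ coord z ≡ 𝟎
      decide (yes eq) = eq
      decide (no ≢)   = ⊥-elim (proj₂ (det-true _ ab) (_ , ≢ , at-a ∷ at-b ∷
        null-⊕ R nz (null-⊕ R (null-scale (dot a z) nka) (null-scale (dot b z) nkb))))
    split : ∀ r z → Null R z → dot r z ≡ (dot a z ∧ dot r ka) xor (dot b z ∧ dot r kb)
    split r z nz = trans (cong (dot r) (reduce z nz)) (dot-coord r z)
    -- On the kernel of R the row r agrees with r(ka)·a ⊕ r(kb)·b.
    repl : ∀ r R′ → (∀ z → Null R′ z → Null R z) →
           det (r ∷ R′) ≡ (dot r ka ∧ det (a ∷ R′)) xor (dot r kb ∧ det (b ∷ R′))
    repl r R′ sub = trans same (trans (det-⊕ (scale (dot r ka) a) (scale (dot r kb) b) R′)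
                    (cong₂ _xor_ (det-scale (dot r ka) a) (det-scale (dot r kb) b)))
      where
      r′ = scale (dot r ka) a ⊕ scale (dot r kb) b
      det-scale : ∀ t x → det (scale t x ∷ R′) ≡ t ∧ det (x ∷ R′)
      det-scale true  x = refl
      det-scale false x = det-𝟎 R′
      agree : ∀ z → Null R z → dot r z ≡ dot r′ z
      agree z nz = trans (split r z nz) (sym (trans (dot-⊕ˡ (scale (dot r ka) a) (scale (dot r kb) b) z)
        (cong₂ _xor_ (ds (dot r ka) a) (ds (dot r kb) b))))
        where
        ds : ∀ t x → dot (scale t x) z ≡ dot x z ∧ t
        ds true  x = sym (Boolₚ.∧-identityʳ _)
        ds false x = trans (dot-𝟎ˡ z) (sym (∧-zeroʳ _))
      same : det (r ∷ R′) ≡ det (r′ ∷ R′)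
      same = det-cong (r ∷ R′) (r′ ∷ R′) (λ l → l) (λ l → l)
        (λ { (z , z≢ , p ∷ nz) → z , z≢ , trans (sym (agree z (sub z nz))) p ∷ nz })
        (λ { (z , z≢ , p ∷ nz) → z , z≢ , trans (agree z (sub z nz)) p ∷ nz })
    value : ∀ r → det (a ∷ r ∷ R) ≡ dot r kb
    value r = trans (det-swap a r R) (trans (repl r (a ∷ R) (λ z → All.tail))
      (trans (cong₂ (λ x y → (dot r ka ∧ x) xor (dot r kb ∧ y)) (det-repeat a R) (trans (det-swap b a R) ab)) (pickʳ (dot r ka) (dot r kb))))
    value′ : ∀ r → det (b ∷ r ∷ R) ≡ dot r ka
    value′ r = trans (det-swap b r R) (trans (repl r (b ∷ R) (λ z → All.tail))
      (trans (cong₂ (λ x y → (dot r ka ∧ x) xor (dot r kb ∧ y)) ab (det-repeat b R)) (pickˡ (dot r ka) (dot r kb))))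
    bilinear : det (c ∷ d ∷ R) ≡ (det (a ∷ c ∷ R) ∧ det (b ∷ d ∷ R)) xor (det (a ∷ d ∷ R) ∧ det (b ∷ c ∷ R))
    bilinear = trans (repl c (d ∷ R) (λ z → All.tail)) (trans
      (cong₂ (λ x y → (dot c ka ∧ x) xor (dot c kb ∧ y)) (value d) (value′ d))
      (trans (h (dot c ka) (dot d kb) (dot c kb) (dot d ka))
      (sym (cong₂ _xor_ (cong₂ _∧_ (value c) (value′ d)) (cong₂ _∧_ (value d) (value′ c))))))
      where
      h : ∀ p q r s → (p ∧ q) xor (r ∧ s) ≡ (r ∧ s) xor (q ∧ p)
      h p q r s = trans (xor-comm (p ∧ q) (r ∧ s)) (cong ((r ∧ s) xor_) (∧-comm p q))
  finish₁ : ∀ {x y} → x ≡ y → x xor y ≡ false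
  finish₁ {x} refl = xor-same x
  cases : ∀ ab ac ad → det (a ∷ b ∷ R) ≡ ab → det (a ∷ c ∷ R) ≡ ac → det (a ∷ d ∷ R) ≡ ad →
    (ab ∧ det (c ∷ d ∷ R)) xor ((ac ∧ det (b ∷ d ∷ R)) xor (ad ∧ det (b ∷ c ∷ R))) ≡ false
  cases true ac ad p q r = finish₁ (trans (expand a b c d p) (cong₂ (λ x y → (x ∧ _) xor (y ∧ _)) q r))
  cases false true ad p q r = finish₁ (trans (expand a c b d q)
    (cong₂ _xor_ (cong (_∧ det (c ∷ d ∷ R)) p) (cong₂ _∧_ r (det-swap c b R))))
  cases false false true p q r = trans (expand a d b c r)
    (cong₂ _xor_ (cong (_∧ det (d ∷ c ∷ R)) p) (cong (_∧ det (d ∷ b ∷ R)) q))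
  cases false false false p q r = refl

comb : (Q : List (Bits n)) → Bits (length Q) → Bits n
comb []      []      = 𝟎
comb (e ∷ Q) (b ∷ g) = scale b e ⊕ comb Q g

anyTrue : Bits m → Bool
anyTrue []      = false
anyTrue (b ∷ g) = b ∨ anyTrue g

anyTrue-false : (g : Bits m) → anyTrue g ≡ false → g ≡ 𝟎
anyTrue-false []          eq = refl
anyTrue-false (false ∷ g) eq = cong (false ∷_) (anyTrue-false g eq)

anyTrue-𝟎 : ∀ m → anyTrue (𝟎 {m}) ≡ false
anyTrue-𝟎 zero    = refl
anyTrue-𝟎 (suc m) = anyTrue-𝟎 m

Supported-on : Bits m → Bits m → Set
Supported-on []          []      = ⊤
Supported-on (true  ∷ F) (_ ∷ g) = Supported-on F g
Supported-on (false ∷ F) (b ∷ g) = b ≡ false × Supported-on F g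

supported-𝟎 : (F : Bits m) → Supported-on F 𝟎
supported-𝟎 []          = tt
supported-𝟎 (true  ∷ F) = supported-𝟎 F
supported-𝟎 (false ∷ F) = refl , supported-𝟎 F

comb-select : (Q : List (Bits n)) (F g : Bits (length Q)) → Supported-on F g → Comb (select Q F) (comb Q g) (anyTrue g)
comb-select []      []          []          sup         = []
comb-select (e ∷ Q) (true  ∷ F) (true  ∷ g) sup         = take (comb-select Q F g sup)
comb-select (e ∷ Q) (true  ∷ F) (false ∷ g) sup         =
  skip (subst (λ x → Comb (select Q F) x (anyTrue g)) (sym (⊕-identityˡ _)) (comb-select Q F g sup))
comb-select (e ∷ Q) (false ∷ F) (false ∷ g) (_ , sup)   =
  subst (λ x → Comb (select Q F) x (anyTrue g)) (sym (⊕-identityˡ _)) (comb-select Q F g sup)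
comb-select (e ∷ Q) (false ∷ F) (true ∷ g)  (() , sup)

comb-select⁻ : (Q : List (Bits n)) (F : Bits (length Q)) → ∀ {x t} → Comb (select Q F) x t →
               ∃ λ g → Supported-on F g × comb Q g ≡ x × anyTrue g ≡ t
comb-select⁻ []      []          []       = [] , tt , refl , refl
comb-select⁻ (e ∷ Q) (true ∷ F)  (skip c) with comb-select⁻ Q F c
... | g , sup , eq , eq′ = false ∷ g , sup , trans (⊕-identityˡ _) eq , eq′
comb-select⁻ (e ∷ Q) (true ∷ F)  (take c) with comb-select⁻ Q F c
... | g , sup , eq , eq′ = true ∷ g , sup , cong (e ⊕_) eq , refl
comb-select⁻ (e ∷ Q) (false ∷ F) c with comb-select⁻ Q F c
... | g , sup , eq , eq′ = false ∷ g , (refl , sup) , trans (⊕-identityˡ _) eq , eq′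

comb-all : (Q : List (Bits n)) (g : Bits (length Q)) → Comb Q (comb Q g) (anyTrue g)
comb-all []      []          = []
comb-all (e ∷ Q) (true  ∷ g) = take (comb-all Q g)
comb-all (e ∷ Q) (false ∷ g) = skip (subst (λ x → Comb Q x (anyTrue g)) (sym (⊕-identityˡ _)) (comb-all Q g))

comb-all⁻ : (Q : List (Bits n)) → ∀ {x t} → Comb Q x t → ∃ λ g → comb Q g ≡ x × anyTrue g ≡ t
comb-all⁻ []      []       = [] , refl , refl
comb-all⁻ (e ∷ Q) (skip c) with comb-all⁻ Q c
... | g , eq , eq′ = false ∷ g , trans (⊕-identityˡ _) eq , eq′
comb-all⁻ (e ∷ Q) (take c) with comb-all⁻ Q c
... | g , eq , eq′ = true ∷ g , cong (e ⊕_) eq , refl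

column : Fin n → (Q : List (Bits n)) → Bits (length Q)
column i []      = []
column i (e ∷ Q) = lookup e i ∷ column i Q

lookup-⊕ : (r s : Bits n) (i : Fin n) → lookup (r ⊕ s) i ≡ lookup r i xor lookup s i
lookup-⊕ r s i = Vecₚ.lookup-zipWith _xor_ i r s

dot-column : (i : Fin n) (Q : List (Bits n)) (g : Bits (length Q)) → dot (column i Q) g ≡ lookup (comb Q g) i
dot-column i []      []      = sym (Vecₚ.lookup-replicate i false)
dot-column i (e ∷ Q) (b ∷ g) = trans (cong₂ _xor_ (scaled b) (dot-column i Q g)) (sym (lookup-⊕ (scale b e) (comb Q g) i))
  where
  scaled : ∀ b → lookup e i ∧ b ≡ lookup (scale b e) i
  scaled true  = Boolₚ.∧-identityʳ _
  scaled false = trans (∧-zeroʳ _) (sym (Vecₚ.lookup-replicate i false))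

comb-𝟎 : (Q : List (Bits n)) → comb Q 𝟎 ≡ 𝟎
comb-𝟎 []      = refl
comb-𝟎 (e ∷ Q) = trans (⊕-identityˡ _) (comb-𝟎 Q)

mix pick : Bits k × Bits k → Bool → Bits k
mix  (r , r₀) b = if b then r ⊕ r₀ else r
pick (r , r₀) b = if b then r else r₀

-- The row with index i is `r + y_i r₀`. Choosing `r` for the members of F and `r₀` for the others
-- matches the convention of `poly` that variables belong to the complement of F.
det-multilinear : (rs : Vec (Bits k × Bits k) m) (y : Bits m) (R : List (Bits k)) →
  det (Vec.toList (zipWith mix rs y) ++ R) ≡ poly (λ F → det (Vec.toList (zipWith pick rs F) ++ R)) y
det-multilinear []               []       R = refl
det-multilinear {m = suc m} ((r , r₀) ∷ rs) (b ∷ y) R = trans (det-↭ (↭-sym (shift (mix (r , r₀) b) (Vec.toList (zipWith mix rs y)) R)))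
  (trans (det-multilinear rs y (mix (r , r₀) b ∷ R)) (trans (poly-cong (λ F → det-↭ (shift _ (picks F) R)) y) (split b)))
  where
  picks : Bits m → List _
  picks F = Vec.toList (zipWith pick rs F)
  split : ∀ b → poly (λ F → det (mix (r , r₀) b ∷ picks F ++ R)) y ≡
                (b ∧ poly (λ F → det (r₀ ∷ picks F ++ R)) y) xor poly (λ F → det (r ∷ picks F ++ R)) y
  split false = refl
  split true  = trans (poly-cong (λ F → det-⊕ r r₀ (picks F ++ R)) y)
    (trans (poly-xor (λ F → det (r ∷ picks F ++ R)) _ y) (xor-comm (poly (λ F → det (r ∷ picks F ++ R)) y) _))

dot-++ : (r s : Bits m) (r′ s′ : Bits n) → dot (r Vec.++ r′) (s Vec.++ s′) ≡ dot r s xor dot r′ s′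
dot-++ []      []      r′ s′ = refl
dot-++ (a ∷ r) (b ∷ s) r′ s′ = trans (cong ((a ∧ b) xor_) (dot-++ r s r′ s′)) (sym (xor-assoc (a ∧ b) (dot r s) _))

𝟎-++ : ∀ m n → 𝟎 {m} Vec.++ 𝟎 {n} ≡ 𝟎
𝟎-++ zero    n = refl
𝟎-++ (suc m) n = cong (false ∷_) (𝟎-++ m n)

bool-ext : {a b : Bool} → (a ≡ true → b ≡ true) → (b ≡ true → a ≡ true) → a ≡ b
bool-ext {true}  f g = sym (f refl)
bool-ext {false} {true}  f g = g refl
bool-ext {false} {false} f g = refl

-- The symmetric bordered matrix of an electrical network: potentials s, currents g on the
-- rows Q, and Lagrange multipliers h, l for the rows q, r and P.
module Network (Q P : List (Bits n)) (q r : Bits n) where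

  qr : List (Bits n)
  qr = q ∷ r ∷ []

  K : ℕ
  K = n + (length Q + (2 + length P))

  row : Bits n → Bits (length Q) → Bits 2 → Bits (length P) → Bits K
  row s g h l = s Vec.++ (g Vec.++ (h Vec.++ l))

  dot-row : ∀ s g h l s′ g′ h′ l′ →
            dot (row s g h l) (row s′ g′ h′ l′) ≡ dot s s′ xor (dot g g′ xor (dot h h′ xor dot l l′))
  dot-row s g h l s′ g′ h′ l′ = trans (dot-++ s s′ _ _) (cong (dot s s′ xor_)
    (trans (dot-++ g g′ _ _) (cong (dot g g′ xor_) (dot-++ h h′ l l′))))

  unrow : (x : Bits K) → ∃ λ s → ∃ λ g → ∃ λ h → ∃ λ l → x ≡ row s g h l
  unrow x with Vec.splitAt n x
  ... | s , x′ , eq with Vec.splitAt (length Q) x′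
  ... | g , x″ , eq′ with Vec.splitAt 2 x″
  ... | h , l , eq″ = s , g , h , l , trans eq (cong (s Vec.++_) (trans eq′ (cong (g Vec.++_) eq″)))

  row-𝟎 : row 𝟎 𝟎 𝟎 𝟎 ≡ 𝟎
  row-𝟎 = trans (cong (λ x → 𝟎 {n} Vec.++ (𝟎 {length Q} Vec.++ x)) (𝟎-++ 2 (length P)))
          (trans (cong (𝟎 {n} Vec.++_) (𝟎-++ (length Q) _)) (𝟎-++ n _))

  sRow : Bits n → Bits K
  sRow s = row s 𝟎 𝟎 𝟎

  gRow : Bits (length Q) → Bits K
  gRow g = row 𝟎 g 𝟎 𝟎

  hRow : Bits 2 → Bits K
  hRow h = row 𝟎 𝟎 h 𝟎

  columnRow : Fin n → Bits K
  columnRow i = row 𝟎 (column i Q) (column i qr) (column i P)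

  dot-sRow : ∀ e s g h l → dot (sRow e) (row s g h l) ≡ dot e s
  dot-sRow e s g h l = trans (dot-row e 𝟎 𝟎 𝟎 s g h l) (trans
    (cong (dot e s xor_) (cong₂ _xor_ (dot-𝟎ˡ g) (cong₂ _xor_ (dot-𝟎ˡ h) (dot-𝟎ˡ l)))) (xor-identityʳ _))

  dot-gRow : ∀ e s g h l → dot (gRow e) (row s g h l) ≡ dot e g
  dot-gRow e s g h l = trans (dot-row 𝟎 e 𝟎 𝟎 s g h l) (trans
    (cong₂ _xor_ (dot-𝟎ˡ s) (cong (dot e g xor_) (cong₂ _xor_ (dot-𝟎ˡ h) (dot-𝟎ˡ l)))) (xor-identityʳ _))

  dot-hRow : ∀ e s g h l → dot (hRow e) (row s g h l) ≡ dot e h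
  dot-hRow e s g h l = trans (dot-row 𝟎 𝟎 e 𝟎 s g h l) (trans
    (cong₂ _xor_ (dot-𝟎ˡ s) (cong₂ _xor_ (dot-𝟎ˡ g) (cong (dot e h xor_) (dot-𝟎ˡ l)))) (xor-identityʳ _))

  total : Bits (length Q) → Bits 2 → Bits (length P) → Bits n
  total g h l = comb Q g ⊕ (comb qr h ⊕ comb P l)

  dot-columnRow : ∀ i s g h l → dot (columnRow i) (row s g h l) ≡ lookup (total g h l) i
  dot-columnRow i s g h l = trans (dot-row 𝟎 (column i Q) (column i qr) (column i P) s g h l) (trans
    (cong₂ _xor_ (dot-𝟎ˡ s) (cong₂ _xor_ (dot-column i Q g) (cong₂ _xor_ (dot-column i qr h) (dot-column i P l))))
    (sym (trans (lookup-⊕ (comb Q g) _ i) (cong (lookup (comb Q g) i xor_) (lookup-⊕ (comb qr h) (comb P l) i)))))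

  -- Kirchhoff's current law: at every vertex the currents and the multipliers of `q`, `r` and `P`
  -- cancel.
  columns : List (Bits K)
  columns = List.tabulate columnRow

  columns-null : ∀ s g h l → total g h l ≡ 𝟎 → Null columns (row s g h l)
  columns-null s g h l eq = Allₚ.tabulate⁺ λ i →
    trans (dot-columnRow i s g h l) (trans (cong (λ x → lookup x i) eq) (Vecₚ.lookup-replicate i false))

  columns-null⁻ : ∀ s g h l → Null columns (row s g h l) → total g h l ≡ 𝟎
  columns-null⁻ s g h l null = decide (total g h l ≟ᵛ 𝟎)
    where
    decide : Dec (total g h l ≡ 𝟎) → total g h l ≡ 𝟎
    decide (yes eq) = eq
    decide (no ≢𝟎) with ≢𝟎⇒true _ ≢𝟎
    ... | i , eq = contradiction (trans (sym eq) (trans (sym (dot-columnRow i s g h l)) (Allₚ.tabulate⁻ null i))) λ ()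

  sRows-null : ∀ A s g h l → Null A s → Null (map sRow A) (row s g h l)
  sRows-null A s g h l ns = Allₚ.map⁺ (All.map (λ {e} p → trans (dot-sRow e s g h l) p) ns)

  sRows-null⁻ : ∀ A s g h l → Null (map sRow A) (row s g h l) → Null A s
  sRows-null⁻ A s g h l ns = All.map (λ {e} p → trans (sym (dot-sRow e s g h l)) p) (Allₚ.map⁻ ns)

  pairs : (Q : List (Bits n)) → Vec (Bits n × Bits (length Q)) (length Q)
  pairs []      = []
  pairs (e ∷ Q) = (e , unit zero) ∷ Vec.map (λ (e , t) → e , false ∷ t) (pairs Q)

  -- Mixed by `y` these rows are Ohm's law, with `y` as resistances. Picking the first entry of a
  -- pair contracts the edge (no potential difference), picking the second deletes it (no current).
  edgeRows : Vec (Bits K × Bits K) (length Q)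
  edgeRows = Vec.map (λ (e , t) → sRow e , gRow t) (pairs Q)

  private
    PickNull : Vec (Bool × Bool) m → Bits m → Set
    PickNull []              []          = ⊤
    PickNull ((v , _) ∷ vs)  (true  ∷ F) = v ≡ false × PickNull vs F
    PickNull ((_ , v₀) ∷ vs) (false ∷ F) = v₀ ≡ false × PickNull vs F

    pick-null : (rs : Vec (Bits k × Bits k) m) (F : Bits m) (x : Bits k) →
                PickNull (Vec.map (λ (a , b) → dot a x , dot b x) rs) F → Null (Vec.toList (zipWith pick rs F)) x
    pick-null []       []          x tt      = []
    pick-null (_ ∷ rs) (true  ∷ F) x (p , q) = p ∷ pick-null rs F x q
    pick-null (_ ∷ rs) (false ∷ F) x (p , q) = p ∷ pick-null rs F x q

    pick-null⁻ : (rs : Vec (Bits k × Bits k) m) (F : Bits m) (x : Bits k) →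
                 Null (Vec.toList (zipWith pick rs F)) x → PickNull (Vec.map (λ (a , b) → dot a x , dot b x) rs) F
    pick-null⁻ []       []          x []      = tt
    pick-null⁻ (_ ∷ rs) (true  ∷ F) x (p ∷ q) = p , pick-null⁻ rs F x q
    pick-null⁻ (_ ∷ rs) (false ∷ F) x (p ∷ q) = p , pick-null⁻ rs F x q

    values : (Q : List (Bits n)) → Bits n → Bits (length Q) → Vec (Bool × Bool) (length Q)
    values []      s []      = []
    values (e ∷ Q) s (b ∷ g) = (dot e s , b) ∷ values Q s g

    values-pairs : ∀ Q s g → Vec.map (λ (e , t) → dot e s , dot t g) (pairs Q) ≡ values Q s g
    values-pairs []      s []      = refl
    values-pairs (e ∷ Q) s (b ∷ g) = cong₂ _∷_ (cong (dot e s ,_) (trans (cong (b xor_) (dot-𝟎ˡ g)) (xor-identityʳ b)))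
      (trans (sym (Vecₚ.map-∘ _ _ (pairs Q))) (values-pairs Q s g))

    values-edgeRows : ∀ s g h l → Vec.map (λ (a , b) → dot a (row s g h l) , dot b (row s g h l)) edgeRows ≡ values Q s g
    values-edgeRows s g h l = trans (sym (Vecₚ.map-∘ _ _ (pairs Q))) (trans
      (Vecₚ.map-cong (λ (e , t) → cong₂ _,_ (dot-sRow e s g h l) (dot-gRow t s g h l)) (pairs Q)) (values-pairs Q s g))

    values-null : ∀ Q s g F → Null (select Q F) s → Supported-on F g → PickNull (values Q s g) F
    values-null []      s []      []          []       sup       = tt
    values-null (e ∷ Q) s (b ∷ g) (true  ∷ F) (p ∷ ns) sup       = p , values-null Q s g F ns sup
    values-null (e ∷ Q) s (b ∷ g) (false ∷ F) ns       (p , sup) = p , values-null Q s g F ns sup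

    values-null⁻ : ∀ Q s g F → PickNull (values Q s g) F → Null (select Q F) s × Supported-on F g
    values-null⁻ []      s []      []          tt      = [] , tt
    values-null⁻ (e ∷ Q) s (b ∷ g) (true  ∷ F) (p , q) with values-null⁻ Q s g F q
    ... | ns , sup = p ∷ ns , sup
    values-null⁻ (e ∷ Q) s (b ∷ g) (false ∷ F) (p , q) with values-null⁻ Q s g F q
    ... | ns , sup = ns , p , sup

  picked : Bits (length Q) → List (Bits K)
  picked F = Vec.toList (zipWith pick edgeRows F)

  picked-null : ∀ F s g h l → Null (select Q F) s → Supported-on F g → Null (picked F) (row s g h l)
  picked-null F s g h l ns sup = pick-null edgeRows F _
    (subst (λ vs → PickNull vs F) (sym (values-edgeRows s g h l)) (values-null Q s g F ns sup))

  picked-null⁻ : ∀ F s g h l → Null (picked F) (row s g h l) → Null (select Q F) s × Supported-on F g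
  picked-null⁻ F s g h l ns = values-null⁻ Q s g F
    (subst (λ vs → PickNull vs F) (values-edgeRows s g h l) (pick-null⁻ edgeRows F _ ns))

  base : List (Bits K)
  base = map sRow P ++ columns

  -- Two further rows which force the potential to vanish on the rows of qr chosen by α
  -- and the multipliers of the rows of qr not chosen by β to vanish.
  record Closing (E : List (Bits K)) (α β : Bits 2) : Set where
    field
      two   : length E ≡ 2
      sizes : length (select qr α) ≡ length (select qr β)
      null  : ∀ s g h l → Null (select qr α) s → Supported-on β h → Null E (row s g h l)
      null⁻ : ∀ s g h l → Null E (row s g h l) → Null (select qr α) s × Supported-on β h

  module _ {E : List (Bits K)} {α β : Bits 2} (closing : Closing E α β) (F : Bits (length Q)) where
    open Closing closing

    private
      S : List (Bits n)
      S = select Q F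
      A B : List (Bits n)
      A = select qr α ++ P
      B = select qr β ++ P
      all : List (Bits K)
      all = picked F ++ E ++ base

      big-length : length all ≡ K
      big-length = begin
        length (picked F ++ E ++ base)                          ≡⟨ Listₚ.length-++ (picked F) ⟩
        length (picked F) + length (E ++ base)                  ≡⟨ cong₂ _+_ (Vecₚ.length-toList (zipWith pick edgeRows F)) (Listₚ.length-++ E) ⟩
        length Q + (length E + length base)                     ≡⟨ cong₂ (λ x y → length Q + (x + y)) two (Listₚ.length-++ (map sRow P)) ⟩
        length Q + (2 + (length (map sRow P) + length columns)) ≡⟨ cong₂ (λ x y → length Q + (2 + (x + y))) (Listₚ.length-map sRow P) (Listₚ.length-tabulate columnRow) ⟩
        length Q + (2 + (length P + n))                         ≡⟨ rearrange (length Q) (length P) n ⟩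
        K                                                       ∎
        where
        open ≡-Reasoning
        rearrange : ∀ a b c → a + (2 + (b + c)) ≡ c + (a + (2 + b))
        rearrange = solve-∀

      same-length : length (S ++ B) ≡ length (S ++ A)
      same-length = trans (Listₚ.length-++ S) (trans (cong (length S +_)
        (trans (Listₚ.length-++ (select qr β)) (trans (cong (_+ length P) (sym sizes)) (sym (Listₚ.length-++ (select qr α))))))
        (sym (Listₚ.length-++ S)))

      null-all : ∀ s g h l → Null (S ++ A) s → Supported-on F g → Supported-on β h → total g h l ≡ 𝟎 → Null all (row s g h l)
      null-all s g h l ns supF supβ eq = Allₚ.++⁺ (picked-null F s g h l (Allₚ.++⁻ˡ S ns) supF)
        (Allₚ.++⁺ (null s g h l (Allₚ.++⁻ˡ (select qr α) nsA) supβ)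
        (Allₚ.++⁺ (sRows-null P s g h l (Allₚ.++⁻ʳ (select qr α) nsA)) (columns-null s g h l eq)))
        where nsA = Allₚ.++⁻ʳ S ns

      null-all⁻ : ∀ s g h l → Null all (row s g h l) →
                  Null (S ++ A) s × Supported-on F g × Supported-on β h × total g h l ≡ 𝟎
      null-all⁻ s g h l ns with picked-null⁻ F s g h l (Allₚ.++⁻ˡ (picked F) ns) | null⁻ s g h l (Allₚ.++⁻ˡ E (Allₚ.++⁻ʳ (picked F) ns))
      ... | nS , supF | nα , supβ = Allₚ.++⁺ nS (Allₚ.++⁺ nα (sRows-null⁻ P s g h l (Allₚ.++⁻ˡ (map sRow P) nb))) , supF , supβ ,
                                    columns-null⁻ s g h l (Allₚ.++⁻ʳ (map sRow P) nb)
        where nb = Allₚ.++⁻ʳ E (Allₚ.++⁻ʳ (picked F) ns)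

      dependent⇒singular : Dependent (S ++ B) → Singular all
      dependent⇒singular c with comb-++⁻ S c
      ... | x , y , t , u , cS , cB , eq , eq′ with comb-++⁻ (select qr β) cB
      ... | y₁ , y₂ , u₁ , u₂ , cβ , cP , eq₂ , eq₂′ with comb-select⁻ Q F cS | comb-select⁻ qr β cβ | comb-all⁻ P cP
      ... | g , supF , gx , gt | h , supβ , hy , hu | l , ly , lu =
        row 𝟎 g h l , nonzero , null-all 𝟎 g h l (All.universal dot-𝟎ʳ _) supF supβ
          (trans (cong₂ _⊕_ gx (trans (cong₂ _⊕_ hy ly) (sym eq₂))) (sym eq))
        where
        nonzero : row 𝟎 g h l ≢ 𝟎
        nonzero x≡𝟎 with Vecₚ.++-injectiveʳ {n = n} 𝟎 𝟎 (trans x≡𝟎 (sym row-𝟎))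
        ... | eqs with Vecₚ.++-injective g 𝟎 eqs
        ... | g𝟎 , eqs′ with Vecₚ.++-injective h 𝟎 eqs′
        ... | h𝟎 , l𝟎 = contradiction (trans eq′ (cong₂ _∨_ (none g𝟎 gt) (trans eq₂′ (cong₂ _∨_ (none h𝟎 hu) (none l𝟎 lu))))) λ ()
          where
          none : ∀ {m} {w : Bits m} {t} → w ≡ 𝟎 → anyTrue w ≡ t → t ≡ false
          none {m} refl eq = trans (sym eq) (anyTrue-𝟎 m)

      forward : det all ≡ true → det (S ++ A) ≡ true × det (S ++ B) ≡ true
      forward eq = det-nonsingular (S ++ A) len ¬singA , det-nonsingular (S ++ B) (trans same-length len)
                     (¬depB ∘ dependent-singular (S ++ B) (trans same-length len))
        where
        ¬sing = proj₂ (det-true all eq)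
        ¬depB : ¬ Dependent (S ++ B)
        ¬depB = ¬sing ∘ dependent⇒singular
        ¬singA : ¬ Singular (S ++ A)
        ¬singA (s , s≢𝟎 , ns) = ¬sing (row s 𝟎 𝟎 𝟎 , (λ eq → s≢𝟎 (Vecₚ.++-injectiveˡ s 𝟎 (trans eq (sym row-𝟎)))) ,
          null-all s 𝟎 𝟎 𝟎 ns (supported-𝟎 F) (supported-𝟎 β)
            (trans (cong₂ _⊕_ (comb-𝟎 Q) (trans (cong₂ _⊕_ (comb-𝟎 qr) (comb-𝟎 P)) (⊕-self 𝟎))) (⊕-self 𝟎)))
        len : length (S ++ A) ≡ n
        -- A trivial kernel of `S ++ A` needs at least `n` rows, and independence of the equally
        -- long `S ++ B` allows at most `n`.
        len with ℕₚ.<-cmp (length (S ++ A)) n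
        ... | Tri.tri< lt _ _ = ⊥-elim (¬singA (nullVector (S ++ A) lt))
        ... | Tri.tri≈ _ eq _ = eq
        ... | Tri.tri> _ _ gt = ⊥-elim (¬depB (dependent-long (S ++ B) (subst (n <_) (sym same-length) gt)))

      backward : det (S ++ A) ≡ true → det (S ++ B) ≡ true → det all ≡ true
      backward eqA eqB = det-nonsingular all big-length λ { (x , x≢𝟎 , nx) → go x x≢𝟎 nx (unrow x) }
        where
        go : ∀ x → x ≢ 𝟎 → Null all x → (∃ λ s → ∃ λ g → ∃ λ h → ∃ λ l → x ≡ row s g h l) → ⊥
        go x x≢𝟎 nx (s , g , h , l , refl) with null-all⁻ s g h l nx
        ... | ns , supF , supβ , eq with s ≟ᵛ 𝟎 | anyTrue g ∨ (anyTrue h ∨ anyTrue l) in any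
        ... | no s≢𝟎     | _     = proj₂ (det-true (S ++ A) eqA) (s , s≢𝟎 , ns)
        ... | yes s≡𝟎    | true  = contradiction (trans (sym (det-dependent dep []))
                                     (trans (cong det (Listₚ.++-identityʳ (S ++ B))) eqB)) λ ()
          where
          dep : Dependent (S ++ B)
          dep = subst₂ (Comb (S ++ B)) eq any
            (comb-++ (comb-select Q F g supF) (comb-++ (comb-select qr β h supβ) (comb-all P l)))
        ... | yes s≡𝟎    | false = x≢𝟎 (trans (zeros (anyTrue g) (anyTrue h) (anyTrue l) refl refl refl any) row-𝟎)
          where
          zeros : ∀ a b c → anyTrue g ≡ a → anyTrue h ≡ b → anyTrue l ≡ c → a ∨ (b ∨ c) ≡ false → row s g h l ≡ row 𝟎 𝟎 𝟎 𝟎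
          zeros false false false p q r _ = cong₂ Vec._++_ s≡𝟎 (cong₂ Vec._++_ (anyTrue-false g p) (cong₂ Vec._++_ (anyTrue-false h q) (anyTrue-false l r)))

    -- Once every edge is contracted or deleted, the system decouples: the potentials range over the
    -- kernel of `S ++ A`, while currents and multipliers are the linear dependencies of `S ++ B`.
    -- The whole is nonsingular when both parts are trivial.
    big-det : det all ≡ det (S ++ A) ∧ det (S ++ B)
    big-det = bool-ext (λ eq → let p , q = forward eq in cong₂ _∧_ p q)
      (λ eq → let p , q = both _ _ eq in backward p q)
      where
      both : ∀ a b → a ∧ b ≡ true → a ≡ true × b ≡ true
      both true true _ = refl , refl

  -- The polynomials of an all-minors matrix-tree theorem: F has to complete both choices of
  -- terminals to a basis.
  minor : Bits 2 → Bits 2 → Bits (length Q) → Bool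
  minor α β = poly (λ F → det (select Q F ++ select qr α ++ P) ∧ det (select Q F ++ select qr β ++ P))

  private
    mixed : Bits (length Q) → List (Bits K)
    mixed y = Vec.toList (zipWith mix edgeRows y)

    minor-det : ∀ {a b α β} → Closing (a ∷ b ∷ []) α β → ∀ y → det (a ∷ b ∷ mixed y ++ base) ≡ minor α β y
    minor-det {a} {b} closing y = trans (det-↭ (↭-sym (shifts (mixed y) (a ∷ b ∷ []))))
      (trans (det-multilinear edgeRows y (a ∷ b ∷ base)) (poly-cong (big-det closing) y))

    h₁ h₂ : Bits 2
    h₁ = unit zero
    h₂ = unit (suc zero)

    t f : Bool
    t = true
    f = false

    at₁ : ∀ s g h l → dot (hRow h₁) (row s g h l) ≡ lookup h zero
    at₁ s g h l = trans (dot-hRow h₁ s g h l) (dot-unit zero h)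
    at₂ : ∀ s g h l → dot (hRow h₂) (row s g h l) ≡ lookup h (suc zero)
    at₂ s g h l = trans (dot-hRow h₂ s g h l) (dot-unit (suc zero) h)

    close-qr : Closing (sRow q ∷ sRow r ∷ []) (t ∷ t ∷ []) (t ∷ t ∷ [])
    close-qr = record { two = refl ; sizes = refl
      ; null  = λ s g h l ns _ → sRows-null qr s g h l ns
      ; null⁻ = λ { s g h@(_ ∷ _ ∷ []) l ns → sRows-null⁻ qr s g h l ns , tt } }

    close-h : Closing (hRow h₁ ∷ hRow h₂ ∷ []) (f ∷ f ∷ []) (f ∷ f ∷ [])
    close-h = record { two = refl ; sizes = refl
      ; null  = λ { s g h@(_ ∷ _ ∷ []) l [] (p , p′ , _) → trans (at₁ s g h l) p ∷ trans (at₂ s g h l) p′ ∷ [] }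
      ; null⁻ = λ { s g h@(_ ∷ _ ∷ []) l (p ∷ p′ ∷ []) → [] , trans (sym (at₁ s g h l)) p , trans (sym (at₂ s g h l)) p′ , tt } }

    close-s₁ : ∀ e α → select qr α ≡ e ∷ [] → Closing (sRow e ∷ hRow h₁ ∷ []) α (f ∷ t ∷ [])
    close-s₁ e α eq = record { two = refl ; sizes = cong length eq
      ; null  = λ { s g h@(_ ∷ _ ∷ []) l ns (p , _) → Allₚ.++⁺ (sRows-null (e ∷ []) s g h l (subst (λ A → Null A s) eq ns)) (trans (at₁ s g h l) p ∷ []) }
      ; null⁻ = λ { s g h@(_ ∷ _ ∷ []) l (p ∷ p′ ∷ []) →
          subst (λ A → Null A s) (sym eq) (sRows-null⁻ (e ∷ []) s g h l (p ∷ [])) , trans (sym (at₁ s g h l)) p′ , tt } }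

    close-s₂ : ∀ e α → select qr α ≡ e ∷ [] → Closing (sRow e ∷ hRow h₂ ∷ []) α (t ∷ f ∷ [])
    close-s₂ e α eq = record { two = refl ; sizes = cong length eq
      ; null  = λ { s g h@(_ ∷ _ ∷ []) l ns (p , _) → Allₚ.++⁺ (sRows-null (e ∷ []) s g h l (subst (λ A → Null A s) eq ns)) (trans (at₂ s g h l) p ∷ []) }
      ; null⁻ = λ { s g h@(_ ∷ _ ∷ []) l (p ∷ p′ ∷ []) →
          subst (λ A → Null A s) (sym eq) (sRows-null⁻ (e ∷ []) s g h l (p ∷ [])) , trans (sym (at₂ s g h l)) p′ , tt } }

  -- Jacobi's identity for the minors of the inverse of the network matrix.
  jacobi : ∀ y → (minor (t ∷ t ∷ []) (t ∷ t ∷ []) y ∧ minor (f ∷ f ∷ []) (f ∷ f ∷ []) y) xor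
                 ((minor (t ∷ f ∷ []) (f ∷ t ∷ []) y ∧ minor (f ∷ t ∷ []) (t ∷ f ∷ []) y) xor
                  (minor (t ∷ f ∷ []) (t ∷ f ∷ []) y ∧ minor (f ∷ t ∷ []) (f ∷ t ∷ []) y)) ≡ false
  jacobi y = trans
    (sym (cong₂ _xor_ (cong₂ _∧_ (minor-det close-qr y) (minor-det close-h y))
           (cong₂ _xor_ (cong₂ _∧_ (minor-det (close-s₁ q (t ∷ f ∷ []) refl) y) (minor-det (close-s₂ r (f ∷ t ∷ []) refl) y))
                        (cong₂ _∧_ (minor-det (close-s₂ q (t ∷ f ∷ []) refl) y) (minor-det (close-s₁ r (f ∷ t ∷ []) refl) y)))))
    -- The six pairs among these four rows are the six closings. `q` with `h₁` gives the
    -- off-diagonal minor, since suppressing the first multiplier leaves that of `r`; `q` with `h₂`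
    -- gives a diagonal one.
    (plücker (sRow q) (sRow r) (hRow h₁) (hRow h₂) (mixed y ++ base))

-- Counting modulo 8 at a vertex of degree three

Σᵛ-++ : ∀ k (f : Bits (k + m) → ℕ) → Σᵛ f ≡ Σᵛ {m} (λ y → Σᵛ {k} (λ α → f (α Vec.++ y)))
Σᵛ-++ zero    f = refl
Σᵛ-++ (suc k) f = trans (cong₂ _+_ (Σᵛ-++ k (λ x → f (false ∷ x))) (Σᵛ-++ k (λ x → f (true ∷ x))))
  (sym (Σᵛ-+ (λ y → Σᵛ {k} (λ α → f (false ∷ α Vec.++ y))) _))

All-select : {P : X → Set} {Q : List X} → All P Q → ∀ F → All P (select Q F)
All-select []       []          = []
All-select (p ∷ ps) (true  ∷ F) = p ∷ All-select ps F
All-select (p ∷ ps) (false ∷ F) = All-select ps F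

All-just : {P : X → Set} {Q : List X} → All P Q → All (MAll.All P) (map just Q)
All-just []       = []
All-just (p ∷ ps) = just p ∷ All-just ps

Σ-4-8 : (b : Bits m → Bool) (c : Bits m → ℕ) →
        Σᵛ (λ y → 4 * ⟦ b y ⟧ + 8 * c y) ≡ 4 * Σᵛ (λ y → ⟦ b y ⟧) + 8 * Σᵛ c
Σ-4-8 b c = trans (Σᵛ-+ (λ y → 4 * ⟦ b y ⟧) (λ y → 8 * c y)) (cong₂ _+_ (Σᵛ-* 4 (λ y → ⟦ b y ⟧)) (Σᵛ-* 8 c))

4*-mod-8 : ∀ a → 4 * a % 8 ≡ 4 * ⟦ odd a ⟧
4*-mod-8 zero          = refl
4*-mod-8 (suc zero)    = refl
4*-mod-8 (suc (suc a)) = trans (cong (_% 8) (rearrange a)) (trans ([m+kn]%n≡m%n (4 * a) 1 8)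
  (trans (4*-mod-8 a) (cong (λ b → 4 * ⟦ b ⟧) (sym (Boolₚ.not-involutive (odd a))))))
  where
  rearrange : ∀ a → 4 * suc (suc a) ≡ 4 * a + 1 * 8
  rearrange = solve-∀

4*+8*-mod-8 : ∀ a c → (4 * a + 8 * c) % 8 ≡ 4 * ⟦ odd a ⟧
4*+8*-mod-8 a c = trans (cong (λ x → (4 * a + x) % 8) (ℕₚ.*-comm 8 c)) (trans ([m+kn]%n≡m%n (4 * a) c 8) (4*-mod-8 a))

8*-mod-8 : ∀ a → 8 * a % 8 ≡ 0
8*-mod-8 a = trans (cong (_% 8) (ℕₚ.*-comm 8 a)) (m*n%n≡0 a 8)

-- d_A is the coefficient of ∏_{i ∉ A} α_i.
Ψ₃ : (d₀ d₁ d₂ d₃ d₁₂ d₁₃ d₂₃ d₁₂₃ : Bool) → Bits 3 → Bool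
Ψ₃ d₀ d₁ d₂ d₃ d₁₂ d₁₃ d₂₃ d₁₂₃ (a ∷ b ∷ c ∷ []) =
  (a ∧ ((b ∧ ((c ∧ d₀) xor d₃)) xor ((c ∧ d₂) xor d₂₃))) xor ((b ∧ ((c ∧ d₁) xor d₁₃)) xor ((c ∧ d₁₂) xor d₁₂₃))

module _ (Z : List (Bits n)) where

  private
    Φ : List (Bits n) → Bool
    Φ A = det (A ++ Z)

  Φ-sym : Symmetric Φ
  Φ-sym p = det-↭ (++⁺ʳ Z p)

  expand₃ : (e₁ e₂ e₃ : Bits n) (Q : List (Bits n)) →
    let d = λ A → polyOf (λ F → det (A ++ F ++ Z)) Q in
    nonzeros Φ (e₁ ∷ e₂ ∷ e₃ ∷ Q) ≡
    Σᵛ (λ y → Σᵛ {3} (λ α → ⟦ Ψ₃ (d [] y) (d (e₁ ∷ []) y) (d (e₂ ∷ []) y) (d (e₃ ∷ []) y) (d (e₁ ∷ e₂ ∷ []) y)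
                                 (d (e₁ ∷ e₃ ∷ []) y) (d (e₂ ∷ e₃ ∷ []) y) (d (e₁ ∷ e₂ ∷ e₃ ∷ []) y) α ⟧))
  expand₃ e₁ e₂ e₃ Q = Σᵛ-++ 3 (λ xs → ⟦ polyOf Φ (e₁ ∷ e₂ ∷ e₃ ∷ Q) xs ⟧)

  -- A vertex with three edges e₁, e₂, e₃; z is the cut separating it from the rest Q.
  module ThreeStar (e₁ e₂ e₃ z : Bits n) (Q : List (Bits n)) (z≢𝟎 : z ≢ 𝟎) (nullQ : Null Q z) (nullZ : Null Z z)
                   (ez₁ : dot e₁ z ≡ true) (ez₂ : dot e₂ z ≡ true) (ez₃ : dot e₃ z ≡ true) where

    private
      f₀ t₁₂ t₁₃ t₂₃ f₁₂₃ S : List (Bits n) → Bool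
      f₀   F = det (e₁ ∷ F ++ Z)
      t₁₂  F = det (e₁ ∷ e₂ ∷ F ++ Z)
      t₁₃  F = det (e₁ ∷ e₃ ∷ F ++ Z)
      t₂₃  F = det (e₂ ∷ e₃ ∷ F ++ Z)
      f₁₂₃ F = det (e₁ ∷ e₂ ∷ e₃ ∷ F ++ Z)
      -- This is `t₁₂ F ∨ t₁₃ F` written as a polynomial. By `d₂₃` it holds exactly when two of the
      -- three neighbour pairs are separated, and otherwise none is.
      S    F = (t₁₂ F xor t₁₃ F) xor (t₁₂ F ∧ t₁₃ F)

      module _ (F : List (Bits n)) (nullF : Null F z) where
        nullM : Null (F ++ Z) z
        nullM = Allₚ.++⁺ nullF nullZ
        d₀ : det (F ++ Z) ≡ false
        d₀ = det-null (F ++ Z) z≢𝟎 nullM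
        d₂ : det (e₂ ∷ F ++ Z) ≡ f₀ F
        d₂ = det-replace (F ++ Z) z≢𝟎 nullM e₂ e₁ (trans ez₂ (sym ez₁))
        d₃ : det (e₃ ∷ F ++ Z) ≡ f₀ F
        d₃ = det-replace (F ++ Z) z≢𝟎 nullM e₃ e₁ (trans ez₃ (sym ez₁))
        -- The sum of the three determinants is a single one with first rows `e₁ ⊕ e₂` and
        -- `e₂ ⊕ e₃`, and the cut `z` kills all of its rows.
        d₂₃ : t₂₃ F ≡ t₁₂ F xor t₁₃ F
        d₂₃ = solve (t₁₂ F) (t₁₃ F) (t₂₃ F) (begin
          (t₁₂ F xor t₁₃ F) xor t₂₃ F
            ≡⟨ cong (_xor t₂₃ F) (sym (det-⊕₂ e₁ e₂ e₃ (F ++ Z))) ⟩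
          det (e₁ ∷ (e₂ ⊕ e₃) ∷ F ++ Z) xor det (e₂ ∷ e₃ ∷ F ++ Z)
            ≡⟨ cong (det (e₁ ∷ (e₂ ⊕ e₃) ∷ F ++ Z) xor_) (det-shear e₂ e₃ (F ++ Z)) ⟩
          det (e₁ ∷ (e₂ ⊕ e₃) ∷ F ++ Z) xor det (e₂ ∷ (e₂ ⊕ e₃) ∷ F ++ Z)
            ≡⟨ sym (det-⊕ e₁ e₂ _) ⟩
          det ((e₁ ⊕ e₂) ∷ (e₂ ⊕ e₃) ∷ F ++ Z)
            ≡⟨ det-null _ z≢𝟎 (trans (dot-⊕ˡ e₁ e₂ z) (cong₂ _xor_ ez₁ ez₂) ∷ trans (dot-⊕ˡ e₂ e₃ z) (cong₂ _xor_ ez₂ ez₃) ∷ nullM) ⟩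
          false ∎)
          where
          open ≡-Reasoning
          solve : ∀ a b c → (a xor b) xor c ≡ false → c ≡ a xor b
          solve a b c eq = sym (xor-false (a xor b) c eq)

      Y : Set
      Y = Bits (length Q)

      f₀ʸ t₁₂ʸ t₁₃ʸ f₁₂₃ʸ f₁ʸ Sʸ : Y → Bool
      f₀ʸ   = polyOf f₀ Q
      t₁₂ʸ  = polyOf t₁₂ Q
      t₁₃ʸ  = polyOf t₁₃ Q
      f₁₂₃ʸ = polyOf f₁₂₃ Q
      f₁ʸ   = polyOf (λ F → t₁₂ F ∧ t₁₃ F) Q
      Sʸ    = polyOf S Q

      S-split : ∀ y → Sʸ y ≡ (t₁₂ʸ y xor t₁₃ʸ y) xor f₁ʸ y
      S-split y = trans (poly-xor (λ F → t₁₂ (select Q F) xor t₁₃ (select Q F)) _ y)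
        (cong (_xor f₁ʸ y) (poly-xor (λ F → t₁₂ (select Q F)) _ y))

      -- `jacobi` with `e₁` contracted, that is, put among the rows `P`. Diagonal minors simplify by
      -- `b ∧ b = b`; the off-diagonal one is `f₁ʸ`, the polynomial of the forests that separate the
      -- first neighbour from both others.
      dodgson : ∀ y → (f₁₂₃ʸ y ∧ f₀ʸ y) xor ((f₁ʸ y ∧ f₁ʸ y) xor (t₁₂ʸ y ∧ t₁₃ʸ y)) ≡ false
      dodgson y = trans (cong₂ _xor_ (cong₂ _∧_ (poly-cong (λ F → same (p₃ (select Q F))) y) (poly-cong (λ F → same (p₀ (select Q F))) y))
          (cong₂ _xor_ (cong₂ _∧_ (poly-cong (λ F → cong₂ _∧_ (p₂ (select Q F)) (p₂ (select Q F))) y)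
                                  (poly-cong (λ F → trans (∧-comm (t₁₂ (select Q F)) _) (cong₂ _∧_ (p₂ (select Q F)) (p₂ (select Q F)))) y))
                       (cong₂ _∧_ (poly-cong (λ F → same (p₂ (select Q F))) y) (poly-cong (λ F → same (p₂ (select Q F))) y))))
        (jacobi y)
        where
        open Network Q (e₁ ∷ Z) e₂ e₃
        ∧-same : ∀ b → b ∧ b ≡ b
        ∧-same true  = refl
        ∧-same false = refl
        same : ∀ {a b} → a ≡ b → a ≡ b ∧ b
        same {b = b} eq = trans eq (sym (∧-same b))
        p₀ : ∀ F → det (e₁ ∷ F ++ Z) ≡ det (F ++ e₁ ∷ Z)
        p₀ F = det-↭ (↭-sym (shift e₁ F Z))
        p₂ : ∀ F {e} → det (e₁ ∷ e ∷ F ++ Z) ≡ det (F ++ e ∷ e₁ ∷ Z)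
        p₂ F {e} = det-↭ (↭-trans (swap e₁ e refl) (↭-sym (shifts F (e ∷ e₁ ∷ []))))
        p₃ : ∀ F → det (e₁ ∷ e₂ ∷ e₃ ∷ F ++ Z) ≡ det (F ++ e₂ ∷ e₃ ∷ e₁ ∷ Z)
        p₃ F = det-↭ (↭-trans (↭-trans (swap e₁ e₂ refl) (prep e₂ (swap e₁ e₃ refl))) (↭-sym (shifts F (e₂ ∷ e₃ ∷ e₁ ∷ []))))

      b : Y → Bool
      b y = f₀ʸ y xor (Sʸ y xor (f₀ʸ y ∧ Sʸ y))

      -- For `f₀ = 0` the function of α is affine, hence balanced unless `t₁₂ = t₁₃ = 0`; Dodgson's
      -- relation then reads `f₁ = t₁₂ t₁₃` and turns `S` into that disjunction. For `f₀ = 1` it is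
      -- `ab + ac + bc` plus an affine part whose coefficients sum to 0, and it changes value under
      -- adding (1, 1, 1), so exactly 4 of the 8 points count.
      fibre : ∀ f₀ t₁₂ t₁₃ f₁₂₃ f₁ → (f₁₂₃ ∧ f₀) xor ((f₁ ∧ f₁) xor (t₁₂ ∧ t₁₃)) ≡ false →
        let S = (t₁₂ xor t₁₃) xor f₁
            v = Σᵛ {3} (λ α → ⟦ Ψ₃ false f₀ f₀ f₀ t₁₂ t₁₃ (t₁₂ xor t₁₃) f₁₂₃ α ⟧) in
        v ≡ 4 * ⟦ f₀ xor (S xor (f₀ ∧ S)) ⟧ + 8 * (v / 8)
      fibre false false false false false _ = refl
      fibre false false false true  false _ = refl
      fibre false false true  false false _ = refl
      fibre false false true  true  false _ = refl
      fibre false true  false false false _ = refl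
      fibre false true  false true  false _ = refl
      fibre false true  true  false true  _ = refl
      fibre false true  true  true  true  _ = refl
      fibre true  false false false false _ = refl
      fibre true  false false false true  _ = refl
      fibre true  false false true  false _ = refl
      fibre true  false false true  true  _ = refl
      fibre true  false true  false false _ = refl
      fibre true  false true  false true  _ = refl
      fibre true  false true  true  false _ = refl
      fibre true  false true  true  true  _ = refl
      fibre true  true  false false false _ = refl
      fibre true  true  false false true  _ = refl
      fibre true  true  false true  false _ = refl
      fibre true  true  false true  true  _ = refl
      fibre true  true  true  false false _ = refl
      fibre true  true  true  false true  _ = refl
      fibre true  true  true  true  false _ = refl
      fibre true  true  true  true  true  _ = refl

      value : Y → ℕ
      value y = Σᵛ {3} (λ α → ⟦ Ψ₃ false (f₀ʸ y) (f₀ʸ y) (f₀ʸ y) (t₁₂ʸ y) (t₁₃ʸ y) (t₁₂ʸ y xor t₁₃ʸ y) (f₁₂₃ʸ y) α ⟧)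

      count : nonzeros Φ (e₁ ∷ e₂ ∷ e₃ ∷ Q) ≡ 4 * Σᵛ (λ y → ⟦ b y ⟧) + 8 * Σᵛ (λ y → value y / 8)
      count = trans (expand₃ e₁ e₂ e₃ Q) (trans (Σᵛ-cong pointwise) (Σ-4-8 b (λ y → value y / 8)))
        where
        sel : ∀ F → Null (select Q F) z
        sel = All-select nullQ
        pointwise : ∀ y → _ ≡ 4 * ⟦ b y ⟧ + 8 * (value y / 8)
        pointwise y = trans (Σᵛ-cong {3} λ α → cong ⟦_⟧ (coefficients α))
          (trans (fibre (f₀ʸ y) (t₁₂ʸ y) (t₁₃ʸ y) (f₁₂₃ʸ y) (f₁ʸ y) (dodgson y))
                   (cong (λ s → 4 * ⟦ f₀ʸ y xor (s xor (f₀ʸ y ∧ s)) ⟧ + 8 * (value y / 8)) (sym (S-split y))))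
          where
          coefficients : ∀ α → Ψ₃ (polyOf (λ F → det (F ++ Z)) Q y) (f₀ʸ y) (polyOf (λ F → det (e₂ ∷ F ++ Z)) Q y)
              (polyOf (λ F → det (e₃ ∷ F ++ Z)) Q y) (t₁₂ʸ y) (t₁₃ʸ y) (polyOf t₂₃ Q y) (f₁₂₃ʸ y) α ≡
            Ψ₃ false (f₀ʸ y) (f₀ʸ y) (f₀ʸ y) (t₁₂ʸ y) (t₁₃ʸ y) (t₁₂ʸ y xor t₁₃ʸ y) (f₁₂₃ʸ y) α
          coefficients α
            rewrite poly-false (λ F → d₀ (select Q F) (sel F)) y
                  | poly-cong (λ F → d₂ (select Q F) (sel F)) y
                  | poly-cong (λ F → d₃ (select Q F) (sel F)) y
                  | poly-cong (λ F → d₂₃ (select Q F) (sel F)) y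
                  | poly-xor (λ F → t₁₂ (select Q F)) (λ F → t₁₃ (select Q F)) y = refl

      R : ℕ
      R = run (map just Q) (λ A B → ⟦ f₀ A ⟧ * ⟦ S B ⟧)

      -- The three edges split 1+2. The tree with one of them contributes `f₀`, whichever edge it
      -- is; the other one contributes the integer sum of `t₁₂`, `t₁₃`, `t₂₃`, which is twice `S`.
      -- The exchange of the two trees gives the other factor 2.
      pairs≡ : run (map just (e₁ ∷ e₂ ∷ e₃ ∷ Q)) (pairWeight Φ) ≡ 4 * R
      pairs≡ = begin
        run (map just Q) _
          ≡⟨ run-cong (map just Q) (All-just nullQ) pointwise ⟩
        run (map just Q) (λ A B → 2 * (⟦ f₀ A ⟧ * ⟦ S B ⟧) + 2 * (⟦ f₀ B ⟧ * ⟦ S A ⟧))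
          ≡⟨ run-+ (map just Q) (λ A B → 2 * (⟦ f₀ A ⟧ * ⟦ S B ⟧)) (λ A B → 2 * (⟦ f₀ B ⟧ * ⟦ S A ⟧)) ⟩
        run (map just Q) (λ A B → 2 * (⟦ f₀ A ⟧ * ⟦ S B ⟧)) + run (map just Q) (λ A B → 2 * (⟦ f₀ B ⟧ * ⟦ S A ⟧))
          ≡⟨ cong (run (map just Q) (λ A B → 2 * (⟦ f₀ A ⟧ * ⟦ S B ⟧)) +_) (run-flip (map just Q) (λ A B → 2 * (⟦ f₀ A ⟧ * ⟦ S B ⟧))) ⟩
        run (map just Q) (λ A B → 2 * (⟦ f₀ A ⟧ * ⟦ S B ⟧)) + run (map just Q) (λ A B → 2 * (⟦ f₀ A ⟧ * ⟦ S B ⟧))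
          ≡⟨ cong (λ x → x + x) (run-* (map just Q) 2 (λ A B → ⟦ f₀ A ⟧ * ⟦ S B ⟧)) ⟩
        2 * R + 2 * R
          ≡⟨ double R ⟩
        4 * R ∎
        where
        open ≡-Reasoning
        double : ∀ r → 2 * r + 2 * r ≡ 4 * r
        double = solve-∀
        splits : ∀ a b → ⟦ a ⟧ + ⟦ b ⟧ + ⟦ a xor b ⟧ ≡ 2 * ⟦ (a xor b) xor (a ∧ b) ⟧
        splits true  true  = refl
        splits true  false = refl
        splits false true  = refl
        splits false false = refl
        collect : ∀ f f′ x y w x′ y′ w′ t → ((t * 0 + w * f′) + (y * f′ + f * x′)) + ((x * f′ + f * y′) + (f * w′ + 0)) ≡
                                           f * (x′ + y′ + w′) + f′ * (x + y + w)
        collect = solve-∀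
        pull-two : ∀ f f′ s s′ → f * (2 * s′) + f′ * (2 * s) ≡ 2 * (f * s′) + 2 * (f′ * s)
        pull-two = solve-∀
        pointwise : ∀ A B → Null A z → Null B z →
          act (just e₃) (act (just e₂) (act (just e₁) (pairWeight Φ))) A B ≡ 2 * (⟦ f₀ A ⟧ * ⟦ S B ⟧) + 2 * (⟦ f₀ B ⟧ * ⟦ S A ⟧)
        pointwise A B nA nB rewrite d₀ A nA | d₀ B nB | d₂ A nA | d₂ B nB | d₃ A nA | d₃ B nB | d₂₃ A nA | d₂₃ B nB =
          trans (collect ⟦ f₀ A ⟧ ⟦ f₀ B ⟧ ⟦ t₁₂ A ⟧ ⟦ t₁₃ A ⟧ ⟦ t₁₂ A xor t₁₃ A ⟧ ⟦ t₁₂ B ⟧ ⟦ t₁₃ B ⟧ ⟦ t₁₂ B xor t₁₃ B ⟧ ⟦ f₁₂₃ A ⟧)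
          (trans (cong₂ (λ x y → ⟦ f₀ A ⟧ * x + ⟦ f₀ B ⟧ * y) (splits (t₁₂ B) (t₁₃ B)) (splits (t₁₂ A) (t₁₃ A)))
                   (pull-two ⟦ f₀ A ⟧ ⟦ f₀ B ⟧ ⟦ S A ⟧ ⟦ S B ⟧))

    -- `Q` has `2n - 7` edges: four of `2n` are at v and three at w. Trees of G ─ v ─ w have `n - 3`
    -- edges and 2-forests `n - 4`, so their sizes add up to the size of `Q`, as `⨁-product`
    -- requires. The terms `f₀` and `S` alone contribute their values at the empty set, which has
    -- the right size only for n = 3 and n = 4; hence `5 ≤ n`.
    module _ (Z2 : length Z ≡ 2) (n≥5 : 5 ≤ n) (lenQ : length Q + 7 ≡ n + n) where
      private
        ⨁f₀ : ⨁ f₀ʸ ≡ false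
        ⨁f₀ = trans (⨁-poly (λ F → f₀ (select Q F))) (trans (cong f₀ (select-𝟎 Q))
          (det-length _ λ eq → ℕₚ.<⇒≢ (ℕₚ.<-≤-trans (ℕₚ.m<n⇒m<1+n ℕₚ.≤-refl) n≥5) (trans (cong (suc) (sym Z2)) eq)))

        t-empty : ∀ e → det (e₁ ∷ e ∷ Z) ≡ false
        t-empty e = det-length _ λ eq → ℕₚ.<⇒≢ n≥5 (trans (cong (λ l → suc (suc l)) (sym Z2)) eq)

        ⨁S : ⨁ Sʸ ≡ false
        ⨁S = trans (⨁-poly (λ F → S (select Q F))) (trans (cong S (select-𝟎 Q))
          (cong₂ (λ x y → (x xor y) xor (x ∧ y)) (t-empty e₂) (t-empty e₃)))

        length-f₀ : ∀ A → f₀ A ≡ true → length A + 3 ≡ n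
        length-f₀ A eq = trans (trans (shape (length A)) (cong suc (trans (cong (length A +_) (sym Z2)) (sym (Listₚ.length-++ A)))))
          (proj₁ (det-true _ eq))
          where
          shape : ∀ a → a + 3 ≡ suc (a + 2)
          shape = solve-∀

        length-t : ∀ e B → det (e₁ ∷ e ∷ B ++ Z) ≡ true → length B + 4 ≡ n
        length-t e B eq = trans (trans (shape (length B)) (cong (λ l → suc (suc l)) (trans (cong (length B +_) (sym Z2)) (sym (Listₚ.length-++ B)))))
          (proj₁ (det-true _ eq))
          where
          shape : ∀ a → a + 4 ≡ suc (suc (a + 2))
          shape = solve-∀

        length-S : ∀ B → S B ≡ true → length B + 4 ≡ n
        length-S B eq with t₁₂ B in eq₁ | t₁₃ B in eq₂
        ... | true  | _     = length-t e₂ B eq₁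
        ... | false | true  = length-t e₃ B eq₂
        ... | false | false = contradiction eq λ ()

        supported : ∀ A B → length A + length B + 0 < length Q → f₀ A ∧ S B ≡ false
        supported A B lt with f₀ A in eq₁ | S B in eq₂
        ... | false | _     = refl
        ... | true  | false = refl
        ... | true  | true  = contradiction (trans (shape (length A) (length B)) (trans (cong₂ _+_ (length-f₀ A eq₁) (length-S B eq₂)) (sym lenQ)))
                                (ℕₚ.<⇒≢ (ℕₚ.+-monoˡ-< 7 lt))
          where
          shape : ∀ a b → a + b + 0 + 7 ≡ (a + 3) + (b + 4)
          shape = solve-∀

        parity : odd (Σᵛ (λ y → ⟦ b y ⟧)) ≡ odd R
        parity = trans (odd-Σᵛ b) (trans (⨁-xor f₀ʸ (λ y → Sʸ y xor (f₀ʸ y ∧ Sʸ y)))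
          (cong₂ _xor_ ⨁f₀ (trans (⨁-xor Sʸ (λ y → f₀ʸ y ∧ Sʸ y))
            (cong₂ _xor_ ⨁S (⨁-product Q f₀ S 0 (length Q) supported (ℕₚ.+-identityʳ _))))))

      threeStar : nonzeros Φ (e₁ ∷ e₂ ∷ e₃ ∷ Q) % 8 ≡ run (map just (e₁ ∷ e₂ ∷ e₃ ∷ Q)) (pairWeight Φ) % 8
      threeStar = trans (cong (_% 8) count) (trans (4*+8*-mod-8 (Σᵛ (λ y → ⟦ b y ⟧)) (Σᵛ (λ y → value y / 8)))
        (trans (cong (λ x → 4 * ⟦ x ⟧) parity) (trans (sym (4*-mod-8 R)) (cong (_% 8) (sym pairs≡)))))

  -- `z` marks vertices cut off from all grounds, so there is no spanning tree and both counts are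
  -- 0.
  degenerate : (z : Bits n) (R : List (Bits n)) → z ≢ 𝟎 → Null R z → Null Z z →
               nonzeros Φ R % 8 ≡ run (map just R) (pairWeight Φ) % 8
  degenerate z R z≢𝟎 nullR nullZ = cong (_% 8) (trans none (sym nothing-left))
    where
    vanish : ∀ A → Null A z → Φ A ≡ false
    vanish A nA = det-null (A ++ Z) z≢𝟎 (Allₚ.++⁺ nA nullZ)
    Σᵛ-zero : ∀ m → Σᵛ {m} (λ _ → 0) ≡ 0
    Σᵛ-zero zero    = refl
    Σᵛ-zero (suc m) = cong₂ _+_ (Σᵛ-zero m) (Σᵛ-zero m)
    none : nonzeros Φ R ≡ 0
    none = trans (Σᵛ-cong λ y → cong ⟦_⟧ (poly-false (λ F → vanish (select R F) (All-select nullR F)) y)) (Σᵛ-zero (length R))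
    nothing-left : run (map just R) (pairWeight Φ) ≡ 0
    nothing-left = trans (run-cong (map just R) (All-just nullR) (λ A B nA nB → cong (λ x → ⟦ x ⟧ * ⟦ Φ B ⟧) (vanish A nA))) (run-zero (map just R))

-- A vertex of degree two: its edges e, e′ act like a single one whose variable is the sum of theirs.
module Series (Z : List (Bits n)) (e e′ z : Bits n) (Q : List (Bits n)) (z≢𝟎 : z ≢ 𝟎)
              (nullQ : Null Q z) (nullZ : Null Z z) (ez : dot e z ≡ true) (e′z : dot e′ z ≡ true) where
  private
    f g : List (Bits n) → Bool
    f F = det (e ∷ F ++ Z)
    g F = det (e ∷ e′ ∷ F ++ Z)
    contract : ∀ F → det (F ++ e ∷ Z) ≡ f F
    contract F = det-↭ (shift e F Z)
    module _ (F : List (Bits n)) (nullF : Null F z) where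
      d₀ : det (F ++ Z) ≡ false
      d₀ = det-null (F ++ Z) z≢𝟎 (Allₚ.++⁺ nullF nullZ)
      d′ : det (e′ ∷ F ++ Z) ≡ f F
      d′ = det-replace (F ++ Z) z≢𝟎 (Allₚ.++⁺ nullF nullZ) e′ e (trans e′z (sym ez))

  -- Every value in 𝔽₂ is the sum of exactly two pairs.
  nonzeros-series : nonzeros (λ A → det (A ++ Z)) (e ∷ e′ ∷ Q) ≡ 2 * nonzeros (λ A → det (A ++ e ∷ Z)) (e′ ∷ Q)
  nonzeros-series = trans (Σᵛ-++ 2 (λ xs → ⟦ polyOf (λ A → det (A ++ Z)) (e ∷ e′ ∷ Q) xs ⟧)) (trans (Σᵛ-cong pointwise)
    (trans (Σᵛ-* 2 (λ y → ⟦ polyOf g Q y ⟧ + ⟦ polyOf f Q y xor polyOf g Q y ⟧)) (cong (2 *_) (sym single))))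
    where
    pointwise : ∀ y → Σᵛ {2} (λ α → ⟦ polyOf (λ A → det (A ++ Z)) (e ∷ e′ ∷ Q) (α Vec.++ y) ⟧) ≡
                      2 * (⟦ polyOf g Q y ⟧ + ⟦ polyOf f Q y xor polyOf g Q y ⟧)
    pointwise y
      rewrite poly-false (λ F → d₀ (select Q F) (All-select nullQ F)) y | poly-cong (λ F → d′ (select Q F) (All-select nullQ F)) y =
      fibre (polyOf f Q y) (polyOf g Q y)
      where
      fibre : ∀ f g → (⟦ g ⟧ + ⟦ f xor g ⟧) + (⟦ f xor g ⟧ + ⟦ f xor (f xor g) ⟧) ≡ 2 * (⟦ g ⟧ + ⟦ f xor g ⟧)
      fibre false false = refl
      fibre false true  = refl
      fibre true  false = refl
      fibre true  true  = refl
    single : nonzeros (λ A → det (A ++ e ∷ Z)) (e′ ∷ Q) ≡ Σᵛ (λ y → ⟦ polyOf g Q y ⟧ + ⟦ polyOf f Q y xor polyOf g Q y ⟧)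
    single = trans (Σᵛ-++ 1 (λ xs → ⟦ polyOf (λ A → det (A ++ e ∷ Z)) (e′ ∷ Q) xs ⟧)) (Σᵛ-cong λ y →
      cong₂ (λ f g → ⟦ g ⟧ + ⟦ f xor g ⟧) (poly-cong (λ F → contract (select Q F)) y) (poly-cong (λ F → det-↭ (shift e (e′ ∷ select Q F) Z)) y))

  -- Each tree has to take one of `e`, `e′`, and either of them crosses the cut `z` equally well.
  run-series : run (map just (e ∷ e′ ∷ Q)) (pairWeight (λ A → det (A ++ Z))) ≡ 2 * run (map just Q) (pairWeight (λ A → det (A ++ e ∷ Z)))
  run-series = trans (run-cong (map just Q) (All-just nullQ) pointwise) (run-* (map just Q) 2 _)
    where
    collect : ∀ t x → (t * 0 + x) + (x + 0) ≡ 2 * x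
    collect = solve-∀
    pointwise : ∀ A B → Null A z → Null B z →
      act (just e′) (act (just e) (pairWeight (λ A → det (A ++ Z)))) A B ≡ 2 * pairWeight (λ A → det (A ++ e ∷ Z)) A B
    pointwise A B nA nB rewrite d₀ A nA | d₀ B nB | d′ A nA | d′ B nB | contract A | contract B =
      collect ⟦ g A ⟧ (⟦ f A ⟧ * ⟦ f B ⟧)

-- Both trees would need the only edge across the cut.
run-lonely : (Z : List (Bits n)) (e z : Bits n) (Q : List (Bits n)) → z ≢ 𝟎 → Null Q z → Null Z z →
             run (map just (e ∷ Q)) (pairWeight (λ A → det (A ++ Z))) ≡ 0
run-lonely Z e z Q z≢𝟎 nullQ nullZ = trans (run-cong (map just Q) (All-just nullQ) pointwise) (run-zero (map just Q))
  where
  d₀ : ∀ F → Null F z → det (F ++ Z) ≡ false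
  d₀ F nF = det-null (F ++ Z) z≢𝟎 (Allₚ.++⁺ nF nullZ)
  pointwise : ∀ A B → Null A z → Null B z → act (just e) (pairWeight (λ A → det (A ++ Z))) A B ≡ 0
  pointwise A B nA nB rewrite d₀ A nA | d₀ B nB = trans (ℕₚ.+-identityʳ _) (ℕₚ.*-zeroʳ ⟦ det (e ∷ A ++ Z) ⟧)

-- Exchanging the two parts acts without fixed points on the bipartitions of a nonempty list.
run-square : (g : List (Bits n) → Bool) (Q : List (Bits n)) → 0 < length Q → ∃ λ r → run (map just Q) (pairWeight g) ≡ 2 * r
run-square g (e ∷ Q) _ = R , trans (run-+ (map just Q) W _) (cong (R +_) (trans
  (trans (run-ext (map just Q) (λ A B → ℕₚ.*-comm ⟦ g A ⟧ ⟦ g (e ∷ B) ⟧)) (run-flip (map just Q) W)) (sym (ℕₚ.+-identityʳ R))))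
  where
  W = λ A B → ⟦ g (e ∷ A) ⟧ * ⟦ g B ⟧
  R = run (map just Q) W

-- By `⨁-poly` the count has the parity of the determinant of `Z` alone, which is not square; so 4
-- times the count is divisible by 8.
nonzeros-even : (Z Q : List (Bits n)) → length Z ≢ n → ∀ {N} → N ≡ 4 * nonzeros (λ A → det (A ++ Z)) Q → N % 8 ≡ 0
nonzeros-even Z Q len eq = trans (cong (_% 8) eq) (trans (4*-mod-8 (nonzeros (λ A → det (A ++ Z)) Q))
  (cong (λ b → 4 * ⟦ b ⟧) (trans (odd-Σᵛ (polyOf (λ A → det (A ++ Z)) Q)) (trans (⨁-poly (λ F → det (select Q F ++ Z)))
    (trans (cong (λ F → det (F ++ Z)) (select-𝟎 Q)) (det-length Z len))))))

-- Two vertices of degree two, joined by the edge e.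
path : (Z : List (Bits n)) (e₁ e e₂ z₁ z₂ : Bits n) (Q : List (Bits n)) → z₁ ≢ 𝟎 → z₂ ≢ 𝟎 →
  Null Q z₁ → Null Q z₂ → Null Z z₁ → Null Z z₂ → dot e₁ z₁ ≡ true → dot e₁ z₂ ≡ false → dot e z₁ ≡ true → dot e z₂ ≡ true →
  dot e₂ z₁ ≡ false → dot e₂ z₂ ≡ true → 2 + length Z ≢ n →
  nonzeros (λ A → det (A ++ Z)) (e₁ ∷ e ∷ e₂ ∷ Q) % 8 ≡ run (map just (e₁ ∷ e ∷ e₂ ∷ Q)) (pairWeight (λ A → det (A ++ Z))) % 8
path Z e₁ e e₂ z₁ z₂ Q z₁≢𝟎 z₂≢𝟎 Qz₁ Qz₂ Zz₁ Zz₂ e₁z₁ e₁z₂ ez₁ ez₂ e₂z₁ e₂z₂ len = trans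
  -- Both sides are 0 modulo 8: two series reductions leave 4 times an even number of points, and
  -- after one reduction both trees would need `e₂`.
  (nonzeros-even (e ∷ e₁ ∷ Z) (e₂ ∷ Q) len (trans S₁.nonzeros-series (trans (cong (2 *_) S₂.nonzeros-series) (sym (ℕₚ.*-assoc 2 2 (nonzeros (λ A → det (A ++ e ∷ e₁ ∷ Z)) (e₂ ∷ Q)))))))
  (sym (cong (_% 8) (trans S₁.run-series (cong (2 *_) (run-lonely (e₁ ∷ Z) e₂ z₂ Q z₂≢𝟎 Qz₂ (e₁z₂ ∷ Zz₂))))))
  where
  module S₁ = Series Z e₁ e z₁ (e₂ ∷ Q) z₁≢𝟎 (e₂z₁ ∷ Qz₁) Zz₁ e₁z₁ ez₁
  module S₂ = Series (e₁ ∷ Z) e e₂ z₂ Q z₂≢𝟎 Qz₂ (e₁z₂ ∷ Zz₂) ez₂ e₂z₂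

-- Two nonadjacent vertices of degree two.
twoStars : (Z : List (Bits n)) (e₁ e₂ e₃ e₄ z₁ z₂ : Bits n) (Q : List (Bits n)) → z₁ ≢ 𝟎 → z₂ ≢ 𝟎 →
  Null Q z₁ → Null Q z₂ → Null Z z₁ → Null Z z₂ → dot e₁ z₁ ≡ true → dot e₁ z₂ ≡ false → dot e₂ z₁ ≡ true → dot e₂ z₂ ≡ false →
  dot e₃ z₁ ≡ false → dot e₃ z₂ ≡ true → dot e₄ z₁ ≡ false → dot e₄ z₂ ≡ true → 2 + length Z ≢ n → 0 < length Q →
  nonzeros (λ A → det (A ++ Z)) (e₁ ∷ e₂ ∷ e₃ ∷ e₄ ∷ Q) % 8 ≡ run (map just (e₁ ∷ e₂ ∷ e₃ ∷ e₄ ∷ Q)) (pairWeight (λ A → det (A ++ Z))) % 8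
twoStars {n} Z e₁ e₂ e₃ e₄ z₁ z₂ Q z₁≢𝟎 z₂≢𝟎 Qz₁ Qz₂ Zz₁ Zz₂ e₁z₁ e₁z₂ e₂z₁ e₂z₂ e₃z₁ e₃z₂ e₄z₁ e₄z₂ len pos
  with run-square (λ A → det (A ++ e₃ ∷ e₁ ∷ Z)) Q pos
... | r , eq = trans
  -- Again both sides are 0 modulo 8; on the side of the trees each reduction gives a factor 2, and
  -- `run-square` gives the third.
  (nonzeros-even (e₃ ∷ e₁ ∷ Z) (e₄ ∷ e₂ ∷ Q) len (trans S₁.nonzeros-series (trans (cong (2 *_)
    (trans (nonzeros-↭ (Φ-sym (e₁ ∷ Z)) (↭-sym (shift e₂ (e₃ ∷ e₄ ∷ []) Q))) S₂.nonzeros-series)) (sym (ℕₚ.*-assoc 2 2 (nonzeros (λ A → det (A ++ e₃ ∷ e₁ ∷ Z)) (e₄ ∷ e₂ ∷ Q)))))))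
  (sym (trans (cong (_% 8) (trans S₁.run-series (trans (cong (2 *_) (trans S₃.run-series (cong (2 *_) eq))) (shape r)))) (8*-mod-8 r)))
  where
  module S₁ = Series Z e₁ e₂ z₁ (e₃ ∷ e₄ ∷ Q) z₁≢𝟎 (e₃z₁ ∷ e₄z₁ ∷ Qz₁) Zz₁ e₁z₁ e₂z₁
  module S₂ = Series (e₁ ∷ Z) e₃ e₄ z₂ (e₂ ∷ Q) z₂≢𝟎 (e₂z₂ ∷ Qz₂) (e₁z₂ ∷ Zz₂) e₃z₂ e₄z₂
  module S₃ = Series (e₁ ∷ Z) e₃ e₄ z₂ Q z₂≢𝟎 Qz₂ (e₁z₂ ∷ Zz₂) e₃z₂ e₄z₂
  shape : ∀ r → 2 * (2 * (2 * r)) ≡ 8 * r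
  shape = solve-∀

-- The two counts agree, by the multiplicities of the edges at v

erow : Edge n → Bits n
erow (x , y) = edge x y

-- `unit v` neutralises the column of the deleted vertex; `unit w` is the usual root, which rules
-- out constant potentials on G ─ v.
Grounded : Fin n → Fin n → List (Bits n) → Bool
Grounded v w A = det (A ++ unit v ∷ unit w ∷ [])

-- `nonzeros (Grounded v w)` counts the points at which the Kirchhoff polynomial of G ─ v is odd.
Agrees : Fin n → Fin n → List (Edge n) → Set
Agrees v w E = nonzeros (Grounded v w) (map erow E) % 8 ≡ run (map just (map erow E)) (pairWeight (Grounded v w)) % 8

agrees-≈ : (v w : Fin n) {E E′ : List (Edge n)} → E ≈ E′ → Agrees v w E′ → Agrees v w E
agrees-≈ v w {E} {E′} q a = trans (cong (_% 8) (nonzeros-↭ (Φ-sym (unit v ∷ unit w ∷ [])) rows))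
  (trans a (cong (_% 8) (sym (run-↭ (pairWeight-sym (unit v ∷ unit w ∷ [])) (map⁺ just rows)))))
  where
  rows : map erow E ↭ map erow E′
  rows = map-≈ edge-comm q

-- A nonzero vector that vanishes on all of `xs` exists for dimension reasons, and any vertex in its
-- support will do.
fresh : (xs : List (Fin n)) → length xs < n → ∃ λ t → All (_≢ t) xs
fresh xs lt with nullVector (map unit xs) (subst (_< _) (sym (Listₚ.length-map unit xs)) lt)
... | s , s≢𝟎 , ns with ≢𝟎⇒true s s≢𝟎
... | t , st = t , All.map (λ { {x} p refl → contradiction (trans (sym st) (trans (sym (dot-unit t s)) p)) λ () }) (Allₚ.map⁻ ns)

occurrences : Fin n → List (Fin n) → ℕ
occurrences t []       = 0
occurrences t (a ∷ as) = ⟦ does (t Fin.≟ a) ⟧ + occurrences t as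

deg-star : (t u : Fin n) (as : List (Fin n)) (E : List (Edge n)) → t ≢ u →
           deg t (map (u ,_) as ++ E) ≡ occurrences t as + deg t E
deg-star t u []       E t≢u = refl
deg-star t u (a ∷ as) E t≢u rewrite dec-false (t Fin.≟ u) t≢u =
  trans (cong (⟦ does (t Fin.≟ a) ⟧ +_) (deg-star t u as E t≢u)) (sym (ℕₚ.+-assoc ⟦ does (t Fin.≟ a) ⟧ _ _))

-- The partitions of 4 without a part 1 are 2+2 and 4.
data Neighbours (as : List (Fin n)) : Set where
  single  : ∀ w → w ∈ as → occurrences w as ≡ 1 → Neighbours as
  doubles : ∀ w w′ → w ≢ w′ → w ∈ as → w′ ∈ as → occurrences w as ≡ 2 → occurrences w′ as ≡ 2 → Neighbours as
  quad    : ∀ w → w ∈ as → occurrences w as ≡ 4 → Neighbours as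

private
  data Is {n} (t x : Fin n) : Bool → Set where
    Y : t ≡ x → Is t x true
    N : t ≢ x → Is t x false

neighbours : (a b c d : Fin n) → Neighbours (a ∷ b ∷ c ∷ d ∷ [])
neighbours {n} a b c d = go (a Fin.≟ b) (c Fin.≟ d) (a Fin.≟ c) (b Fin.≟ d) (a Fin.≟ d) (b Fin.≟ c)
  where
  δ : ∀ {t x b} → Is t x b → ⟦ does (t Fin.≟ x) ⟧ ≡ ⟦ b ⟧
  δ {t} {x} (Y p) = cong ⟦_⟧ (dec-true (t Fin.≟ x) p)
  δ {t} {x} (N p) = cong ⟦_⟧ (dec-false (t Fin.≟ x) p)
  occ : ∀ t {x y z u} → Is t a x → Is t b y → Is t c z → Is t d u →
        occurrences t (a ∷ b ∷ c ∷ d ∷ []) ≡ ⟦ x ⟧ + (⟦ y ⟧ + (⟦ z ⟧ + (⟦ u ⟧ + 0)))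
  occ t p q r s = cong₂ _+_ (δ p) (cong₂ _+_ (δ q) (cong₂ _+_ (δ r) (cong (_+ 0) (δ s))))
  go : Dec (a ≡ b) → Dec (c ≡ d) → Dec (a ≡ c) → Dec (b ≡ d) → Dec (a ≡ d) → Dec (b ≡ c) → Neighbours (a ∷ b ∷ c ∷ d ∷ [])
  go (yes refl) (yes refl) (yes refl) _ _ _ = quad a (here refl) (occ a (Y refl) (Y refl) (Y refl) (Y refl))
  go (yes refl) (yes refl) (no a≢c) _ _ _ = doubles a c a≢c (here refl) (there (there (here refl)))
    (occ a (Y refl) (Y refl) (N a≢c) (N a≢c)) (occ c (N (a≢c ∘ sym)) (N (a≢c ∘ sym)) (Y refl) (Y refl))
  go (yes refl) (no c≢d) (yes refl) _ _ _ = single d (there (there (there (here refl))))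
    (occ d (N (c≢d ∘ sym)) (N (c≢d ∘ sym)) (N (c≢d ∘ sym)) (Y refl))
  go (yes refl) (no c≢d) (no a≢c) _ _ _ = single c (there (there (here refl)))
    (occ c (N (a≢c ∘ sym)) (N (a≢c ∘ sym)) (Y refl) (N c≢d))
  go (no a≢b) _ (yes refl) (yes refl) _ _ = doubles a b a≢b (here refl) (there (here refl))
    (occ a (Y refl) (N a≢b) (Y refl) (N a≢b)) (occ b (N (a≢b ∘ sym)) (Y refl) (N (a≢b ∘ sym)) (Y refl))
  go (no a≢b) _ (yes refl) (no b≢d) _ _ = single b (there (here refl))
    (occ b (N (a≢b ∘ sym)) (Y refl) (N (a≢b ∘ sym)) (N b≢d))
  go (no a≢b) _ (no a≢c) _ (yes refl) (yes refl) = doubles a b a≢b (here refl) (there (here refl))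
    (occ a (Y refl) (N a≢b) (N a≢b) (Y refl)) (occ b (N (a≢b ∘ sym)) (Y refl) (Y refl) (N (a≢b ∘ sym)))
  go (no a≢b) _ (no a≢c) _ (yes refl) (no b≢c) = single b (there (here refl))
    (occ b (N (a≢b ∘ sym)) (Y refl) (N b≢c) (N (a≢b ∘ sym)))
  go (no a≢b) _ (no a≢c) _ (no a≢d) _ = single a (here refl) (occ a (Y refl) (N a≢b) (N a≢c) (N a≢d))

avoids-++ : (u : Fin n) {E : List (Edge n)} (D : List (Edge n)) {E′ : List (Edge n)} →
            E ≈ D ++ E′ → All (Avoids u) E → All (Avoids u) D × All (Avoids u) E′
avoids-++ u D q ps = Allₚ.++⁻ D (All-≈ {P = Avoids u} (λ (p , q) → q , p) q ps)

nonLoop-++ : {E : List (Edge n)} (D : List (Edge n)) {E′ : List (Edge n)} → E ≈ D ++ E′ → All NonLoop E → All NonLoop E′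
nonLoop-++ D q ps = Allₚ.++⁻ʳ D (All-≈ {P = NonLoop} (λ ≢ → ≢ ∘ sym) q ps)

-- Here E is the edge list of G ─ v.
module _ (v : Fin n) (E : List (Edge n)) (avoid : All (Avoids v) E) (nonloop : All NonLoop E) (n≥5 : 5 ≤ n)
         (size : length E + 4 ≡ n + n) where

  private
    -- The indicator of all vertices but `v` and `w`: the cut that isolates `w` in G ─ v, normalised
    -- to vanish at both grounds.
    co : Fin n → Bits n
    co w = Vec.map not (unit v ⊕ unit w)

    lookup-co : ∀ w x → lookup (co w) x ≡ not (lookup (unit v) x xor lookup (unit w) x)
    lookup-co w x = trans (Vecₚ.lookup-map x not (unit v ⊕ unit w)) (cong not (lookup-⊕ (unit v) (unit w) x))

    co-v : ∀ {w} → v ≢ w → lookup (co w) v ≡ false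
    co-v {w} v≢w = trans (lookup-co w v) (cong₂ (λ x y → not (x xor y)) (lookup-unit-self v) (lookup-unit-other (v≢w ∘ sym)))

    co-w : ∀ {w} → v ≢ w → lookup (co w) w ≡ false
    co-w {w} v≢w = trans (lookup-co w w) (cong₂ (λ x y → not (x xor y)) (lookup-unit-other v≢w) (lookup-unit-self w))

    co-other : ∀ {w x} → v ≢ x → w ≢ x → lookup (co w) x ≡ true
    co-other {w} {x} v≢x w≢x = trans (lookup-co w x) (cong₂ (λ x y → not (x xor y)) (lookup-unit-other v≢x) (lookup-unit-other w≢x))

    value : (x y : Fin n) {p q : Bool} (s : Bits n) → lookup s x ≡ p → lookup s y ≡ q → dot (edge x y) s ≡ p xor q
    value x y s p q = trans (dot-edge x y s) (cong₂ _xor_ p q)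

    co-null : ∀ w E → All (Avoids v) E → All (Avoids w) E → Null (map erow E) (co w)
    co-null w [] [] [] = []
    co-null w ((x , y) ∷ E) ((v≢x , v≢y) ∷ avs) ((w≢x , w≢y) ∷ aws) =
      value x y (co w) (co-other v≢x w≢x) (co-other v≢y w≢y) ∷ co-null w E avs aws

    unit-null : ∀ w E → All (Avoids w) E → Null (map erow E) (unit w)
    unit-null w [] [] = []
    unit-null w ((x , y) ∷ E) ((w≢x , w≢y) ∷ aws) =
      value x y (unit w) (lookup-unit-other w≢x) (lookup-unit-other w≢y) ∷ unit-null w E aws

    Zco : ∀ {w} → v ≢ w → Null (unit v ∷ unit w ∷ []) (co w)
    Zco {w} v≢w = trans (dot-unit v (co w)) (co-v v≢w) ∷ trans (dot-unit w (co w)) (co-w v≢w) ∷ []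

    Zunit : ∀ {w w′} → v ≢ w′ → w ≢ w′ → Null (unit v ∷ unit w ∷ []) (unit w′)
    Zunit {w} {w′} v≢w′ w≢w′ = trans (dot-unit v _) (lookup-unit-other (v≢w′ ∘ sym)) ∷
                               trans (dot-unit w _) (lookup-unit-other (w≢w′ ∘ sym)) ∷ []

    co≢𝟎 : ∀ {w x} → v ≢ x → w ≢ x → co w ≢ 𝟎
    co≢𝟎 {w} {x} v≢x w≢x = true⇒≢𝟎 x (co-other v≢x w≢x)

  at-single : ∀ w → v ≢ w → deg w E ≡ 3 → Agrees v w E
  at-single w v≢w deg3 with pull w E nonloop
  ... | as , E₂ , E≈ , len , av , w≢as with as | trans len deg3
  ... | a ∷ b ∷ c ∷ [] | refl with avoids-++ v (map (w ,_) (a ∷ b ∷ c ∷ [])) E≈ avoid | w≢as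
  ... | (_ , v≢a) ∷ (_ , v≢b) ∷ (_ , v≢c) ∷ [] , avoid₂ | w≢a ∷ w≢b ∷ w≢c ∷ [] = agrees-≈ v w E≈
    (ThreeStar.threeStar (unit v ∷ unit w ∷ []) (edge w a) (edge w b) (edge w c) (co w) (map erow E₂) (co≢𝟎 v≢a w≢a)
      (co-null w E₂ avoid₂ av) (Zco v≢w)
      (value w a (co w) (co-w v≢w) (co-other v≢a w≢a)) (value w b (co w) (co-w v≢w) (co-other v≢b w≢b)) (value w c (co w) (co-w v≢w) (co-other v≢c w≢c))
      refl n≥5 (trans (cong (_+ 7) (Listₚ.length-map erow E₂))
        (trans (shape (length E₂)) (trans (cong (_+ 4) (sym (≈-length E≈))) size))))
    where
    shape : ∀ a → a + 7 ≡ suc (suc (suc a)) + 4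
    shape = solve-∀

  at-quad : ∀ w → v ≢ w → deg w E ≡ 0 → Agrees v w E
  at-quad w v≢w deg0 with pull w E nonloop
  ... | as , E₂ , E≈ , len , av , w≢as with as | trans len deg0
  ... | [] | refl with fresh (v ∷ w ∷ []) (ℕₚ.≤-trans (s≤s (s≤s (s≤s z≤n))) n≥5)
  ... | t , v≢t ∷ w≢t ∷ [] = agrees-≈ v w E≈
    (degenerate (unit v ∷ unit w ∷ []) (co w) (map erow E₂) (co≢𝟎 v≢t w≢t)
      (co-null w E₂ (proj₂ (avoids-++ v [] E≈ avoid)) av) (Zco v≢w))

  module _ (w w′ : Fin n) (v≢w : v ≢ w) (v≢w′ : v ≢ w′) (w≢w′ : w ≢ w′) where

    private
      z₁ z₂ : Bits n
      z₁ = co w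
      z₂ = unit w′

    nonadjacent : ∀ b₁ b₂ E₂ → E ≈ (w , b₁) ∷ (w , b₂) ∷ E₂ → All (Avoids w) E₂ → w ≢ b₁ → w ≢ b₂ → w′ ≢ b₁ → w′ ≢ b₂ →
                  deg w′ E₂ ≡ 2 → Agrees v w E
    nonadjacent b₁ b₂ E₂ E≈ av w≢b₁ w≢b₂ w′≢b₁ w′≢b₂ deg2
      with avoids-++ v ((w , b₁) ∷ (w , b₂) ∷ []) E≈ avoid | nonLoop-++ ((w , b₁) ∷ (w , b₂) ∷ []) E≈ nonloop
    ... | (_ , v≢b₁) ∷ (_ , v≢b₂) ∷ [] , avoid₂ | nonloop₂ with pull w′ E₂ nonloop₂
    ... | as , E₃ , E₂≈ , len , av′ , w′≢as with as | trans len deg2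
    ... | c₁ ∷ c₂ ∷ [] | refl with avoids-++ v ((w′ , c₁) ∷ (w′ , c₂) ∷ []) E₂≈ avoid₂
                                   | avoids-++ w ((w′ , c₁) ∷ (w′ , c₂) ∷ []) E₂≈ av | w′≢as
    ... | (_ , v≢c₁) ∷ (_ , v≢c₂) ∷ [] , avoid₃ | (_ , w≢c₁) ∷ (_ , w≢c₂) ∷ [] , av₃ | w′≢c₁ ∷ w′≢c₂ ∷ [] =
      agrees-≈ v w (≈-trans E≈ (prep _ (prep _ E₂≈)))
      (twoStars (unit v ∷ unit w ∷ []) (edge w b₁) (edge w b₂) (edge w′ c₁) (edge w′ c₂) z₁ z₂ (map erow E₃)
        (co≢𝟎 v≢b₁ w≢b₁) (unit≢𝟎 w′) (co-null w E₃ avoid₃ av₃) (unit-null w′ E₃ av′) (Zco v≢w) (Zunit v≢w′ w≢w′)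
        (value w b₁ z₁ (co-w v≢w) (co-other v≢b₁ w≢b₁)) (value w b₁ z₂ (lookup-unit-other (w≢w′ ∘ sym)) (lookup-unit-other w′≢b₁))
        (value w b₂ z₁ (co-w v≢w) (co-other v≢b₂ w≢b₂)) (value w b₂ z₂ (lookup-unit-other (w≢w′ ∘ sym)) (lookup-unit-other w′≢b₂))
        (value w′ c₁ z₁ (co-other v≢w′ w≢w′) (co-other v≢c₁ w≢c₁)) (value w′ c₁ z₂ (lookup-unit-self w′) (lookup-unit-other w′≢c₁))
        (value w′ c₂ z₁ (co-other v≢w′ w≢w′) (co-other v≢c₂ w≢c₂)) (value w′ c₂ z₂ (lookup-unit-self w′) (lookup-unit-other w′≢c₂))
        (ℕₚ.<⇒≢ n≥5) (subst (0 <_) (sym (Listₚ.length-map erow E₃)) positive))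
      where
      -- Of the `2n` edges of G four are at v, two at `w` and two at `w′`; with `5 ≤ n` some edge
      -- remains, as `run-square` demands.
      total : length E₃ + 8 ≡ n + n
      total = trans (shape (length E₃)) (trans (cong (λ l → suc (suc l) + 4) (sym (≈-length E₂≈))) (trans (cong (_+ 4) (sym (≈-length E≈))) size))
        where
        shape : ∀ a → a + 8 ≡ suc (suc (suc (suc a))) + 4
        shape = solve-∀
      positive : 0 < length E₃
      positive = ℕₚ.+-cancelʳ-< 8 0 (length E₃) (ℕₚ.≤-trans (ℕₚ.n≤1+n 9) (ℕₚ.≤-trans (ℕₚ.+-mono-≤ n≥5 n≥5) (ℕₚ.≤-reflexive (sym total))))

    adjacent : ∀ b E₂ → E ≈ (w , b) ∷ (w , w′) ∷ E₂ → All (Avoids w) E₂ → w ≢ b → w′ ≢ b → deg w′ E₂ ≡ 1 → Agrees v w E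
    adjacent b E₂ E≈ av w≢b w′≢b deg1
      with avoids-++ v ((w , b) ∷ (w , w′) ∷ []) E≈ avoid | nonLoop-++ ((w , b) ∷ (w , w′) ∷ []) E≈ nonloop
    ... | (_ , v≢b) ∷ _ ∷ [] , avoid₂ | nonloop₂ with pull w′ E₂ nonloop₂
    ... | as , E₃ , E₂≈ , len , av′ , w′≢as with as | trans len deg1
    ... | c ∷ [] | refl with avoids-++ v ((w′ , c) ∷ []) E₂≈ avoid₂ | avoids-++ w ((w′ , c) ∷ []) E₂≈ av | w′≢as
    ... | (_ , v≢c) ∷ [] , avoid₃ | (_ , w≢c) ∷ [] , av₃ | w′≢c ∷ [] =
      agrees-≈ v w (≈-trans E≈ (prep _ (prep _ E₂≈)))
      (path (unit v ∷ unit w ∷ []) (edge w b) (edge w w′) (edge w′ c) z₁ z₂ (map erow E₃) (co≢𝟎 v≢b w≢b) (unit≢𝟎 w′)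
        (co-null w E₃ avoid₃ av₃) (unit-null w′ E₃ av′) (Zco v≢w) (Zunit v≢w′ w≢w′)
        (value w b z₁ (co-w v≢w) (co-other v≢b w≢b)) (value w b z₂ (lookup-unit-other (w≢w′ ∘ sym)) (lookup-unit-other w′≢b))
        (value w w′ z₁ (co-w v≢w) (co-other v≢w′ w≢w′)) (value w w′ z₂ (lookup-unit-other (w≢w′ ∘ sym)) (lookup-unit-self w′))
        (value w′ c z₁ (co-other v≢w′ w≢w′) (co-other v≢c w≢c)) (value w′ c z₂ (lookup-unit-self w′) (lookup-unit-other w′≢c))
        (ℕₚ.<⇒≢ n≥5))

    -- `w`, `w′` and their double edge form a component of G ─ v; `z₁ ⊕ z₂` is the indicator of the
    -- vertices other than these two and `v`.
    doubly-adjacent : ∀ E₂ → E ≈ (w , w′) ∷ (w , w′) ∷ E₂ → All (Avoids w) E₂ → deg w′ E₂ ≡ 0 → Agrees v w E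
    doubly-adjacent E₂ E≈ av deg0
      with avoids-++ v ((w , w′) ∷ (w , w′) ∷ []) E≈ avoid | nonLoop-++ ((w , w′) ∷ (w , w′) ∷ []) E≈ nonloop
    ... | _ , avoid₂ | nonloop₂ with pull w′ E₂ nonloop₂
    ... | as , E₃ , E₂≈ , len , av′ , w′≢as with as | trans len deg0
    ... | [] | refl with fresh (v ∷ w ∷ w′ ∷ []) (ℕₚ.≤-trans (s≤s (s≤s (s≤s (s≤s z≤n)))) n≥5)
    ... | t , v≢t ∷ w≢t ∷ w′≢t ∷ [] = agrees-≈ v w (≈-trans E≈ (prep _ (prep _ E₂≈)))
      (degenerate (unit v ∷ unit w ∷ []) (z₁ ⊕ z₂) ((edge w w′) ∷ (edge w w′) ∷ map erow E₃)
        (true⇒≢𝟎 t (trans (lookup-⊕ z₁ z₂ t) (cong₂ _xor_ (co-other v≢t w≢t) (lookup-unit-other w′≢t))))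
        (link ∷ link ∷ null-⊕ (map erow E₃) (co-null w E₃ (proj₂ (avoids-++ v [] E₂≈ avoid₂)) (proj₂ (avoids-++ w [] E₂≈ av))) (unit-null w′ E₃ av′))
        (null-⊕ (unit v ∷ unit w ∷ []) (Zco v≢w) (Zunit v≢w′ w≢w′)))
      where
      link : dot (edge w w′) (z₁ ⊕ z₂) ≡ false
      link = trans (dot-⊕ʳ (edge w w′) z₁ z₂) (cong₂ _xor_ (value w w′ z₁ (co-w v≢w) (co-other v≢w′ w≢w′))
        (value w w′ z₂ (lookup-unit-other (w≢w′ ∘ sym)) (lookup-unit-self w′)))

    -- The cases are the number 0, 1 or 2 of edges joining `w` and `w′`.
    at-doubles : deg w E ≡ 2 → deg w′ E ≡ 2 → Agrees v w E
    at-doubles deg2 deg2′ with pull w E nonloop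
    ... | as , E₂ , E≈ , len , av , w≢as with as | trans len deg2
    ... | b₁ ∷ b₂ ∷ [] | refl with w≢as | w′ Fin.≟ b₁ | w′ Fin.≟ b₂
                                   | trans (sym (deg-star w′ w (b₁ ∷ b₂ ∷ []) E₂ (w≢w′ ∘ sym))) (trans (sym (deg-≈ w′ E≈)) deg2′)
    ... | w≢b₁ ∷ w≢b₂ ∷ [] | no p       | no q       | eq = nonadjacent b₁ b₂ E₂ E≈ av w≢b₁ w≢b₂ p q eq
    ... | w≢b₁ ∷ w≢b₂ ∷ [] | yes refl | no q       | eq = adjacent b₂ E₂ (≈-trans E≈ (swap _ _)) av w≢b₂ q (ℕₚ.suc-injective eq)
    ... | w≢b₁ ∷ w≢b₂ ∷ [] | no p       | yes refl | eq = adjacent b₁ E₂ E≈ av w≢b₁ p (ℕₚ.suc-injective eq)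
    ... | _                | yes refl | yes refl | eq = doubly-adjacent E₂ E≈ av (ℕₚ.suc-injective (ℕₚ.suc-injective eq))

-- Spanning trees and determinants

reach-∷ : ∀ {n} {e : Edge n} {t} {E : List (Edge n)} {T u x} → Reach (graph n E) T u x → Reach (graph n (e ∷ E)) (t ∷ T) u x
reach-∷ here = here
reach-∷ (step e e∈T j r) = step (suc e) (Vec.there e∈T) j (reach-∷ r)

reach-trans : ∀ {G T u x y} → Reach G T u x → Reach G T x y → Reach G T u y
reach-trans here             r = r
reach-trans (step e e∈T j p) r = step e e∈T j (reach-trans p r)

module _ {n : ℕ} where

  treeRows : (E : List (Edge n)) → Bits (length E) → List (Bits n)
  treeRows E T = map erow (select E T)

  null-at : (E : List (Edge n)) (T : Bits (length E)) {s : Bits n} → Null (treeRows E T) s →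
            ∀ e → e ∈ˢ T → dot (erow (List.lookup E e)) s ≡ false
  null-at (_ ∷ E) (true  ∷ T) (p ∷ ns) zero    Vec.here        = p
  null-at (_ ∷ E) (true  ∷ T) (p ∷ ns) (suc e) (Vec.there e∈T) = null-at E T ns e e∈T
  null-at (_ ∷ E) (false ∷ T) ns       (suc e) (Vec.there e∈T) = null-at E T ns e e∈T

  null-from : (E : List (Edge n)) (T : Bits (length E)) {s : Bits n} →
              (∀ e → e ∈ˢ T → dot (erow (List.lookup E e)) s ≡ false) → Null (treeRows E T) s
  null-from []      []          f = []
  null-from (_ ∷ E) (true  ∷ T) f = f zero Vec.here ∷ null-from E T (λ e e∈T → f (suc e) (Vec.there e∈T))
  null-from (_ ∷ E) (false ∷ T) f = null-from E T (λ e e∈T → f (suc e) (Vec.there e∈T))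

  same-ends : (s : Bits n) (e : Edge n) → dot (erow e) s ≡ false → lookup s (proj₁ e) ≡ lookup s (proj₂ e)
  same-ends s (x , y) p = xor-false _ _ (trans (sym (dot-edge x y s)) p)

  reach-const : (E : List (Edge n)) (T : Bits (length E)) {s : Bits n} → Null (treeRows E T) s →
                ∀ {u w} → Reach (graph n E) T u w → lookup s u ≡ lookup s w
  reach-const E T ns here = refl
  reach-const E T {s} ns (step e e∈T (inj₁ eq) r) =
    trans (subst (λ (x , y) → lookup s x ≡ lookup s y) eq (same-ends s (List.lookup E e) (null-at E T ns e e∈T))) (reach-const E T ns r)
  reach-const E T {s} ns (step e e∈T (inj₂ eq) r) =
    trans (sym (subst (λ (x , y) → lookup s x ≡ lookup s y) eq (same-ends s (List.lookup E e) (null-at E T ns e e∈T)))) (reach-const E T ns r)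

  -- The indicator `s` of a connected component. Being null on the edges of T it contains all that
  -- is reachable from `u` (`reach-const`), so only the converse is recorded.
  Component : (E : List (Edge n)) → Bits (length E) → Fin n → Set
  Component E T u = ∃ λ s → Null (treeRows E T) s × lookup s u ≡ true × (∀ x → lookup s x ≡ true → Reach (graph n E) T u x)

  null-∨ : (E : List (Edge n)) (T : Bits (length E)) {s s′ : Bits n} → Null (treeRows E T) s → Null (treeRows E T) s′ →
           Null (treeRows E T) (zipWith _∨_ s s′)
  null-∨ E T {s} {s′} ns ns′ = null-from E T λ e e∈T → let (x , y) = List.lookup E e in
    trans (dot-edge x y (zipWith _∨_ s s′)) (trans
      (cong₂ _xor_ (trans (Vecₚ.lookup-zipWith _∨_ x s s′)
                      (cong₂ _∨_ (same-ends s (List.lookup E e) (null-at E T ns e e∈T)) (same-ends s′ (List.lookup E e) (null-at E T ns′ e e∈T))))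
                   (Vecₚ.lookup-zipWith _∨_ y s s′))
      (xor-same (lookup s y ∨ lookup s′ y)))

  merge : (p q u p′ q′ : Fin n) (E : List (Edge n)) (T : Bits (length E)) → Joins (graph n ((p , q) ∷ E)) zero p′ q′ →
    (c : Component E T u) → lookup (proj₁ c) p′ ≡ true → Component E T q′ → Component ((p , q) ∷ E) (true ∷ T) u
  merge p q u p′ q′ E T joins (s , ns , su , r) sp′ (s′ , ns′ , sq′ , r′) =
    t , (ends-equal joins ∷ null-∨ E T ns ns′) , trans (at u) (cong (_∨ lookup s′ u) su) , reach
    where
    t : Bits n
    t = zipWith _∨_ s s′
    at : ∀ x → lookup t x ≡ lookup s x ∨ lookup s′ x
    at x = Vecₚ.lookup-zipWith _∨_ x s s′
    tp′ : lookup t p′ ≡ true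
    tp′ = trans (at p′) (cong (_∨ lookup s′ p′) sp′)
    tq′ : lookup t q′ ≡ true
    tq′ = trans (at q′) (trans (cong (lookup s q′ ∨_) sq′) (Boolₚ.∨-zeroʳ (lookup s q′)))
    ends-equal : Joins (graph n ((p , q) ∷ E)) zero p′ q′ → dot (edge p q) t ≡ false
    ends-equal (inj₁ refl) = trans (dot-edge p q t) (cong₂ _xor_ tp′ tq′)
    ends-equal (inj₂ refl) = trans (dot-edge p q t) (cong₂ _xor_ tq′ tp′)
    reach : ∀ x → lookup t x ≡ true → Reach (graph n ((p , q) ∷ E)) (true ∷ T) u x
    reach x tx = go (lookup s x) (lookup s′ x) refl refl (trans (sym (at x)) tx)
      where
      go : ∀ a b → lookup s x ≡ a → lookup s′ x ≡ b → a ∨ b ≡ true → Reach (graph n ((p , q) ∷ E)) (true ∷ T) u x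
      go true  _    eq eq′ _ = reach-∷ (r x eq)
      go false true eq eq′ _ = reach-trans (reach-∷ (r p′ sp′)) (step zero Vec.here joins (reach-∷ (r′ x eq′)))

  -- Edges enter one at a time. When just one end of the new edge lies in the component of `u`, the
  -- component of the other end is merged into it.
  component : (E : List (Edge n)) (T : Bits (length E)) (u : Fin n) → Component E T u
  component [] [] u = unit u , [] , lookup-unit-self u , is
    where
    is : ∀ x → lookup (unit u) x ≡ true → Reach (graph n []) [] u x
    is x eq with u Fin.≟ x
    ... | yes refl = here
    ... | no u≢x     = contradiction (trans (sym eq) (lookup-unit-other u≢x)) λ ()
  component (e ∷ E) (false ∷ T) u with component E T u
  ... | s , ns , su , r = s , ns , su , λ x eq → reach-∷ (r x eq)
  component ((p , q) ∷ E) (true ∷ T) u = go (component E T u) _ _ refl refl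
    where
    go : (c : Component E T u) → ∀ a b → lookup (proj₁ c) p ≡ a → lookup (proj₁ c) q ≡ b → Component ((p , q) ∷ E) (true ∷ T) u
    go (s , ns , su , r) true  true  sp sq = s , (trans (dot-edge p q s) (cong₂ _xor_ sp sq) ∷ ns) , su , λ x eq → reach-∷ (r x eq)
    go (s , ns , su , r) false false sp sq = s , (trans (dot-edge p q s) (cong₂ _xor_ sp sq) ∷ ns) , su , λ x eq → reach-∷ (r x eq)
    go c true  false sp sq = merge p q u p q E T (inj₁ refl) c sp (component E T q)
    go c false true  sp sq = merge p q u q p E T (inj₂ refl) c sq (component E T p)

  comb-dot : {A : List (Bits n)} {x : Bits n} {t : Bool} {s : Bits n} → Comb A x t → Null A s → dot x s ≡ false
  comb-dot {s = s} []                 []       = dot-𝟎ˡ s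
  comb-dot         (skip c)           (p ∷ ns) = comb-dot c ns
  comb-dot {s = s} (take {r} {x = x} c) (p ∷ ns) = trans (dot-⊕ˡ r x s) (cong₂ _xor_ p (comb-dot c ns))

  ones : Bits n
  ones = replicate n true

  null-ones : (E : List (Edge n)) → Null (map erow E) ones
  null-ones [] = []
  null-ones ((x , y) ∷ E) = trans (dot-edge x y ones) (trans
    (cong₂ _xor_ (Vecₚ.lookup-replicate x true) (Vecₚ.lookup-replicate y true)) refl) ∷ null-ones E

  -- An edge of T which is a combination of the other ones.
  redundant : (E : List (Edge n)) (T : Bits (length E)) → ∀ {x t} → Comb (treeRows E T) x t → t ≡ true →
    ∃ λ e → e ∈ˢ T × (∀ s → Null (treeRows E (T Vec.[ e ]≔ outside)) s → dot (erow (List.lookup E e)) s ≡ dot x s)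
  redundant [] [] [] ()
  redundant (e ∷ E) (false ∷ T) c        eq with redundant E T c eq
  ... | i , i∈T , f = suc i , Vec.there i∈T , f
  redundant (e ∷ E) (true ∷ T)  (skip c) eq with redundant E T c eq
  ... | i , i∈T , f = suc i , Vec.there i∈T , λ { s (_ ∷ ns) → f s ns }
  redundant (e ∷ E) (true ∷ T)  (take {x = x} c) eq = zero , Vec.here , λ s ns →
    sym (trans (dot-⊕ˡ (erow e) x s) (trans (cong (dot (erow e) s xor_) (comb-dot c ns)) (xor-identityʳ _)))

  remove-length : (E : List (Edge n)) (T : Bits (length E)) → ∀ e → e ∈ˢ T →
                  suc (length (treeRows E (T Vec.[ e ]≔ outside))) ≡ length (treeRows E T)
  remove-length (_ ∷ E) (true  ∷ T) zero    Vec.here        = refl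
  remove-length (_ ∷ E) (true  ∷ T) (suc e) (Vec.there e∈T) = cong suc (remove-length E T e e∈T)
  remove-length (_ ∷ E) (false ∷ T) (suc e) (Vec.there e∈T) = remove-length E T e e∈T

  restore-null : (E : List (Edge n)) (T : Bits (length E)) {s : Bits n} → ∀ e → e ∈ˢ T →
    Null (treeRows E (T Vec.[ e ]≔ outside)) s → dot (erow (List.lookup E e)) s ≡ false → Null (treeRows E T) s
  restore-null (_ ∷ E) (true  ∷ T) zero    Vec.here        ns       p = p ∷ ns
  restore-null (_ ∷ E) (true  ∷ T) (suc e) (Vec.there e∈T) (q ∷ ns) p = q ∷ restore-null E T e e∈T ns p
  restore-null (_ ∷ E) (false ∷ T) (suc e) (Vec.there e∈T) ns       p = restore-null E T e e∈T ns p

treeDet : (E : List (Edge (suc k))) → Bits (length E) → Bool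
treeDet E T = det (treeRows E T ++ unit zero ∷ [])

module _ {k : ℕ} (E : List (Edge (suc k))) (T : Bits (length E)) where
  private
    H : Graph
    H = graph (suc k) E
    rows : List (Bits (suc k))
    rows = treeRows E T

  -- Connectedness makes the kernel trivial, which needs at least `suc k` rows; acyclicity makes the
  -- rows independent, which allows at most that many.
  tree⇒det : SpanningTree H T → treeDet E T ≡ true
  tree⇒det (connected , acyclic) = det-nonsingular _ len ¬sing
    where
    ¬sing : ¬ Singular (rows ++ unit zero ∷ [])
    ¬sing (s , s≢𝟎 , ns) with ≢𝟎⇒true s s≢𝟎
    ... | i , si = contradiction (trans (sym si) (trans (reach-const E T (Allₚ.++⁻ˡ rows ns) (connected i zero))
                     (trans (sym (dot-unit zero s)) (All.head (Allₚ.++⁻ʳ rows ns))))) λ ()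
    ¬dep : ¬ Dependent (rows ++ unit zero ∷ [])
    ¬dep c with comb-++⁻ rows c
    -- A dependency cannot use the ground row: `ones` is orthogonal to every edge row but not to the
    -- ground.
    ... | x , y , t , _ , cx , take [] , eq , _ = contradiction
          (trans (cong₂ _xor_ (sym (comb-dot cx (null-ones (select E T)))) (sym ground))
                   (trans (sym (dot-⊕ˡ x y ones)) (trans (cong (λ z → dot z ones) (sym eq)) (dot-𝟎ˡ (ones {suc k}))))) λ ()
      where
      ground : dot y ones ≡ true
      ground = trans (dot-⊕ˡ (unit zero) 𝟎 (ones {suc k})) (cong₂ _xor_ (dot-unit zero (ones {suc k})) (dot-𝟎ˡ (ones {suc k})))
    -- Some edge `e` is then a sum of other edges of T, so the component of its first end in T
    -- without `e` contains its second end: a cycle.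
    ... | x , _ , t , _ , cx , skip [] , eq , eq′ with redundant E T cx (sym (trans eq′ (Boolₚ.∨-identityʳ t)))
    ... | e , e∈T , f with component E (T Vec.[ e ]≔ outside) (proj₁ (List.lookup E e))
    ... | s , ns , sx , r = acyclic e e∈T (r _ (trans (sym (same-ends s (List.lookup E e)
            (trans (f s ns) (trans (cong (λ z → dot z s) (sym (trans eq (⊕-identityʳ x)))) (dot-𝟎ˡ s))))) sx))
    len : length (rows ++ unit zero ∷ []) ≡ suc k
    len with ℕₚ.<-cmp (length (rows ++ unit zero ∷ [])) (suc k)
    ... | Tri.tri< lt _ _ = ⊥-elim (¬sing (nullVector _ lt))
    ... | Tri.tri≈ _ eq _ = eq
    ... | Tri.tri> _ _ gt = ⊥-elim (¬dep (dependent-long _ gt))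

  det⇒tree : treeDet E T ≡ true → SpanningTree H T
  det⇒tree eq = connected , acyclic
    where
    len : length (rows ++ unit zero ∷ []) ≡ suc k
    len = proj₁ (det-true _ eq)
    ¬sing : ¬ Singular (rows ++ unit zero ∷ [])
    ¬sing = proj₂ (det-true _ eq)
    grounded : ∀ {s} → Null rows s → lookup s zero ≡ false → Null (rows ++ unit zero ∷ []) s
    grounded {s} ns s0 = Allₚ.++⁺ ns (trans (dot-unit zero s) s0 ∷ [])
    connected : ConnectedVia H T
    connected u w with component E T u
    ... | s , ns , su , r with lookup s w in sw | lookup s zero in s0
    ... | true  | _     = r w sw
    -- If `w` is outside the component of `u`, the indicator or its complement vanishes at the root
    -- and is a forbidden kernel vector.
    ... | false | false = ⊥-elim (¬sing (s , true⇒≢𝟎 u su , grounded ns s0))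
    ... | false | true  = ⊥-elim (¬sing (s ⊕ ones , true⇒≢𝟎 w (trans (lookup-⊕ s ones w) (cong₂ _xor_ sw (Vecₚ.lookup-replicate w true))) ,
                            grounded (null-⊕ rows ns (null-ones (select E T))) (trans (lookup-⊕ s ones zero) (cong (_xor true) s0))))
    acyclic : AcyclicVia H T
    -- Without `e` there are too few rows, hence a null vector; a path between the ends of `e` would
    -- make it null on `e` too.
    acyclic e e∈T reach with nullVector (treeRows E (T Vec.[ e ]≔ outside) ++ unit zero ∷ []) shorter
      where
      shorter : length (treeRows E (T Vec.[ e ]≔ outside) ++ unit zero ∷ []) < suc k
      shorter = ℕₚ.≤-reflexive (trans (cong suc (Listₚ.length-++ (treeRows E (T Vec.[ e ]≔ outside))))
        (trans (cong (_+ 1) (remove-length E T e e∈T)) (trans (sym (Listₚ.length-++ rows)) len)))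
    ... | s , s≢𝟎 , ns = ¬sing (s , s≢𝟎 , grounded (restore-null E T e e∈T ns′ bridge)
              (trans (sym (dot-unit zero s)) (All.head (Allₚ.++⁻ʳ rows′ ns))))
      where
      rows′ = treeRows E (T Vec.[ e ]≔ outside)
      ns′ : Null rows′ s
      ns′ = Allₚ.++⁻ˡ rows′ ns
      bridge : dot (erow (List.lookup E e)) s ≡ false
      bridge = let (x , y) = List.lookup E e in trans (dot-edge x y s)
        (trans (cong (_xor lookup s y) (reach-const E (T Vec.[ e ]≔ outside) ns′ reach)) (xor-same (lookup s y)))

-- Point counts

bit : Bool → Fin 2
bit false = zero
bit true  = suc zero

private
  count-map : {P : X′ → Set} (P? : ∀ y → Dec (P y)) (f : X → X′) (xs : List X) →
              length (List.filter P? (map f xs)) ≡ length (List.filter (λ x → P? (f x)) xs)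
  count-map P? f []       = refl
  count-map P? f (x ∷ xs) with does (P? (f x))
  ... | true  = cong suc (count-map P? f xs)
  ... | false = count-map P? f xs

count-points : ∀ m {P : Vec (Fin 2) m → Set} (P? : ∀ x → Dec (P x)) →
               length (List.filter P? (allPoints 2 m)) ≡ Σᵛ (λ xs → ⟦ does (P? (Vec.map bit xs)) ⟧)
count-points zero    P? with does (P? [])
... | true  = refl
... | false = refl
count-points (suc m) P? = begin
  length (List.filter P? (A ++ B ++ []))
    ≡⟨ cong (λ xs → length (List.filter P? (A ++ xs))) (Listₚ.++-identityʳ B) ⟩
  length (List.filter P? (A ++ B))
    ≡⟨ cong length (Listₚ.filter-++ P? A B) ⟩
  length (List.filter P? A ++ List.filter P? B)
    ≡⟨ Listₚ.length-++ (List.filter P? A) ⟩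
  length (List.filter P? A) + length (List.filter P? B)
    ≡⟨ cong₂ _+_ (trans (count-map P? (zero ∷_) (allPoints 2 m)) (count-points m (λ x → P? (zero ∷ x))))
                 (trans (count-map P? (suc zero ∷_) (allPoints 2 m)) (count-points m (λ x → P? (suc zero ∷ x)))) ⟩
  _ ∎
  where
  open ≡-Reasoning
  A = map (zero ∷_) (allPoints 2 m)
  B = map (suc zero ∷_) (allPoints 2 m)

even? : ∀ m → does (m % 2 ℕ.≟ 0) ≡ not (odd m)
even? zero          = refl
even? (suc zero)    = refl
even? (suc (suc m)) = trans (cong (λ r → does (r ℕ.≟ 0)) (trans (cong (_% 2) (ℕₚ.+-comm 2 m)) ([m+n]%n≡m%n m 2)))
  (trans (even? m) (cong not (sym (Boolₚ.not-involutive (odd m)))))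

mono : Bits m → Bits m → Bool
mono []      []       = true
mono (t ∷ T) (x ∷ xs) = (t ∨ x) ∧ mono T xs

monomial-mono : (T xs : Bits m) → monomial T (Vec.map bit xs) ≡ ⟦ mono T xs ⟧
monomial-mono []          []           = refl
monomial-mono (true  ∷ T) (x ∷ xs)     = trans (ℕₚ.+-identityʳ _) (monomial-mono T xs)
monomial-mono (false ∷ T) (true  ∷ xs) = trans (ℕₚ.+-identityʳ _) (monomial-mono T xs)
monomial-mono (false ∷ T) (false ∷ xs) = refl

⨁-false : {f : Bits m → Bool} → (∀ xs → f xs ≡ false) → ⨁ f ≡ false
⨁-false {zero}  eq = eq []
⨁-false {suc m} eq = cong₂ _xor_ (⨁-false (λ xs → eq (false ∷ xs))) (⨁-false (λ xs → eq (true ∷ xs)))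

poly-⨁ : (Φ : Bits m → Bool) (xs : Bits m) → poly Φ xs ≡ ⨁ (λ T → Φ T ∧ mono T xs)
poly-⨁ Φ []           = sym (Boolₚ.∧-identityʳ (Φ []))
poly-⨁ Φ (true  ∷ xs) = cong₂ _xor_ (poly-⨁ (λ T → Φ (false ∷ T)) xs) (poly-⨁ (λ T → Φ (true ∷ T)) xs)
poly-⨁ Φ (false ∷ xs) = cong₂ _xor_ (sym (⨁-false (λ T → ∧-zeroʳ (Φ (false ∷ T))))) (poly-⨁ (λ T → Φ (true ∷ T)) xs)

_≡ᵇ_ : Bits m → Bits m → Bool
[]      ≡ᵇ []      = true
(a ∷ T) ≡ᵇ (b ∷ U) = not (a xor b) ∧ (T ≡ᵇ U)

≡ᵇ-refl : (T : Bits m) → (T ≡ᵇ T) ≡ true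
≡ᵇ-refl []      = refl
≡ᵇ-refl (a ∷ T) rewrite xor-same a = ≡ᵇ-refl T

≡ᵇ-true : (T U : Bits m) → (T ≡ᵇ U) ≡ true → T ≡ U
≡ᵇ-true []          []          eq = refl
≡ᵇ-true (true  ∷ T) (true  ∷ U) eq = cong (true ∷_) (≡ᵇ-true T U eq)
≡ᵇ-true (false ∷ T) (false ∷ U) eq = cong (false ∷_) (≡ᵇ-true T U eq)

⨁-point : (U : Bits m) (g : Bits m → Bool) → ⨁ (λ T → (T ≡ᵇ U) ∧ g T) ≡ g U
⨁-point []          g = refl
⨁-point {suc m} (true  ∷ U) g = cong₂ _xor_ (⨁-false {m} {λ T → false} (λ _ → refl)) (⨁-point U (λ T → g (true ∷ T)))
⨁-point {suc m} (false ∷ U) g = trans (cong₂ _xor_ (⨁-point U (λ T → g (false ∷ T))) (⨁-false {m} {λ T → false} (λ _ → refl))) (xor-identityʳ _)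

member : List (Bits m) → Bits m → Bool
member []      T = false
member (U ∷ L) T = (T ≡ᵇ U) ∨ member L T

member⇒∈ : (L : List (Bits m)) (T : Bits m) → member L T ≡ true → T ∈ L
member⇒∈ (U ∷ L) T eq with T ≡ᵇ U in eq′
... | true  = here (≡ᵇ-true T U eq′)
... | false = there (member⇒∈ L T eq)

∈⇒member : (L : List (Bits m)) (T : Bits m) → T ∈ L → member L T ≡ true
∈⇒member (U ∷ L) .U (here refl) rewrite ≡ᵇ-refl U = refl
∈⇒member (U ∷ L) T (there T∈L) rewrite ∈⇒member L T T∈L = Boolₚ.∨-zeroʳ (T ≡ᵇ U)

-- As no edge set is listed twice, the disjunction in `member` is an exclusive one and distributes
-- over the parity sum.
odd-sum : (L : List (Bits m)) → Unique L → (g : Bits m → Bool) →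
          odd (sum (map (λ T → ⟦ g T ⟧) L)) ≡ ⨁ (λ T → member L T ∧ g T)
odd-sum []      []             g = sym (⨁-false {f = λ T → false ∧ g T} (λ _ → refl))
odd-sum (U ∷ L) (U∉L ∷ unique) g = trans (odd-+ ⟦ g U ⟧ _) (trans
  (cong₂ _xor_ (trans (odd-⟦⟧ (g U)) (sym (⨁-point U g))) (odd-sum L unique g))
  (trans (sym (⨁-xor (λ T → (T ≡ᵇ U) ∧ g T) (λ T → member L T ∧ g T))) (⨁-cong split)))
  where
  split : ∀ T → ((T ≡ᵇ U) ∧ g T) xor (member L T ∧ g T) ≡ ((T ≡ᵇ U) ∨ member L T) ∧ g T
  split T with T ≡ᵇ U in eq | member L T in eq′
  ... | false | _     = refl
  ... | true  | false = xor-identityʳ (g T)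
  ... | true  | true  = ⊥-elim (All.lookup U∉L (member⇒∈ L T eq′) (sym (≡ᵇ-true T U eq)))

Σᵛ-not : (f : Bits m → Bool) → Σᵛ (λ xs → ⟦ not (f xs) ⟧) + Σᵛ (λ xs → ⟦ f xs ⟧) ≡ 2 ^ m
Σᵛ-not {zero}  f with f []
... | true  = refl
... | false = refl
Σᵛ-not {suc m} f = trans (+-interchange (Σᵛ (λ xs → ⟦ not (f (false ∷ xs)) ⟧)) _ _ _)
  (cong₂ _+_ (Σᵛ-not (λ xs → f (false ∷ xs))) (trans (Σᵛ-not (λ xs → f (true ∷ xs))) (sym (ℕₚ.+-identityʳ _))))

private
  -- The lengths of `Q` and `map f Q` agree only propositionally; points are carried over by
  -- recursion rather than by `subst`.
  recast : (f : X → X′) (Q : List X) → Bits (length Q) → Bits (length (map f Q))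
  recast f []      []       = []
  recast f (e ∷ Q) (x ∷ xs) = x ∷ recast f Q xs

  polyOf-recast : (f : X → X′) (Φ : List X′ → Bool) (Q : List X) → ∀ xs → polyOf Φ (map f Q) (recast f Q xs) ≡ polyOf (Φ ∘ map f) Q xs
  polyOf-recast f Φ []      []       = refl
  polyOf-recast f Φ (e ∷ Q) (x ∷ xs) = cong₂ (λ a b → (x ∧ a) xor b) (polyOf-recast f Φ Q xs) (polyOf-recast f (Φ ∘ (f e ∷_)) Q xs)

  Σᵛ-recast : (f : X → X′) (Q : List X) (g : Bits (length (map f Q)) → ℕ) → Σᵛ (λ xs → g (recast f Q xs)) ≡ Σᵛ g
  Σᵛ-recast f []      g = refl
  Σᵛ-recast f (e ∷ Q) g = cong₂ _+_ (Σᵛ-recast f Q (λ xs → g (false ∷ xs))) (Σᵛ-recast f Q (λ xs → g (true ∷ xs)))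

nonzeros-map : (f : X → X′) (Φ : List X′ → Bool) (Q : List X) → nonzeros Φ (map f Q) ≡ nonzeros (Φ ∘ map f) Q
nonzeros-map f Φ Q = trans (sym (Σᵛ-recast f Q (λ xs → ⟦ polyOf Φ (map f Q) xs ⟧)))
  (Σᵛ-cong λ xs → cong ⟦_⟧ (polyOf-recast f Φ Q xs))

rooted : List (Bits (suc k)) → Bool
rooted A = det (A ++ unit zero ∷ [])

zeros+nonzeros : (E : List (Edge (suc k))) (L : List (EdgeSet (graph (suc k) E))) → EnumeratesSpanningTrees (graph (suc k) E) L →
                 zeroCount 2 (graph (suc k) E) L + nonzeros rooted (map erow E) ≡ 2 ^ length E
zeros+nonzeros {k} E L (unique , trees) = trans
  (cong₂ _+_ (trans (count-points (length E) (λ x → ΨAt (graph (suc k) E) L x % 2 ℕ.≟ 0))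
                      (Σᵛ-cong λ xs → cong ⟦_⟧ (trans (even? (ΨAt (graph (suc k) E) L (Vec.map bit xs))) (cong not (Ψ-parity xs)))))
             (nonzeros-map erow rooted E))
  (Σᵛ-not (polyOf (rooted ∘ map erow) E))
  where
  member-tree : ∀ T → member L T ≡ treeDet E T
  member-tree T = bool-ext (λ eq → tree⇒det E T (Equivalence.to (trees T) (member⇒∈ L T eq)))
                           (λ eq → ∈⇒member L T (Equivalence.from (trees T) (det⇒tree E T eq)))
  Ψ-parity : ∀ xs → odd (ΨAt (graph (suc k) E) L (Vec.map bit xs)) ≡ polyOf (rooted ∘ map erow) E xs
  Ψ-parity xs = begin
    odd (sum (map (λ T → monomial T (Vec.map bit xs)) L))   ≡⟨ cong (odd ∘ sum) (Listₚ.map-cong (λ T → monomial-mono T xs) L) ⟩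
    odd (sum (map (λ T → ⟦ mono T xs ⟧) L))                 ≡⟨ odd-sum L unique (λ T → mono T xs) ⟩
    ⨁ (λ T → member L T ∧ mono T xs)                        ≡⟨ ⨁-cong (λ T → cong (_∧ mono T xs) (member-tree T)) ⟩
    ⨁ (λ T → treeDet E T ∧ mono T xs)                       ≡⟨ sym (poly-⨁ (treeDet E) xs) ⟩
    poly (treeDet E) xs                                      ∎
    where open ≡-Reasoning

-- Deleting a vertex

insertZero : Fin (suc k) → Bits k → Bits (suc k)
insertZero v r = Vec.insertAt r v false

insertZero-⊕ : (v : Fin (suc k)) (r s : Bits k) → insertZero v (r ⊕ s) ≡ insertZero v r ⊕ insertZero v s
insertZero-⊕ zero    r       s       = refl
insertZero-⊕ (suc v) (a ∷ r) (b ∷ s) = cong ((a xor b) ∷_) (insertZero-⊕ v r s)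

insertZero-𝟎 : (v : Fin (suc k)) → insertZero v 𝟎 ≡ 𝟎
insertZero-𝟎 zero            = refl
insertZero-𝟎 {suc k} (suc v) = cong (false ∷_) (insertZero-𝟎 v)

insertZero-unit : (v : Fin (suc k)) (i : Fin k) → insertZero v (unit i) ≡ unit (Fin.punchIn v i)
insertZero-unit zero    i       = refl
insertZero-unit (suc v) zero    = cong (true ∷_) (insertZero-𝟎 v)
insertZero-unit (suc v) (suc i) = cong (false ∷_) (insertZero-unit v i)

dot-insertZero : (v : Fin (suc k)) (r : Bits k) (s : Bits (suc k)) → dot (insertZero v r) s ≡ dot r (Vec.removeAt s v)
dot-insertZero v r s = trans (dot-removeAt (insertZero v r) s v) (cong₂ _xor_
  (cong (_∧ lookup s v) (Vecₚ.insertAt-lookup r v false))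
  (cong (λ r → dot r (Vec.removeAt s v)) (Vecₚ.removeAt-insertAt r v false)))

-- The row `unit v` forces the coordinate `v` of a kernel vector to be 0, and omitting that
-- coordinate identifies the two kernels.
det-insertZero : (v : Fin (suc k)) (B : List (Bits k)) → det (unit v ∷ map (insertZero v) B) ≡ det B
det-insertZero v B = det-cong (unit v ∷ map (insertZero v) B) B
  (λ l → trans (sym (Listₚ.length-map (insertZero v) B)) (ℕₚ.suc-injective l))
  (λ l → cong suc (trans (Listₚ.length-map (insertZero v) B) l))
  (λ { (s , s≢𝟎 , p ∷ ns) → Vec.removeAt s v , (λ eq → s≢𝟎 (removeAt≡𝟎 s v (trans (sym (dot-unit v s)) p) eq)) ,
       All.map (λ {r} q → trans (sym (dot-insertZero v r s)) q) (Allₚ.map⁻ ns) })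
  (λ { (t , t≢𝟎 , nt) → insertZero v t ,
       (λ eq → t≢𝟎 (trans (sym (Vecₚ.removeAt-insertAt t v false)) (trans (cong (λ s → Vec.removeAt s v) eq) (removeAt-𝟎 v)))) ,
       trans (dot-unit v _) (Vecₚ.insertAt-lookup t v false) ∷
       Allₚ.map⁺ (All.map (λ {r} q → trans (dot-insertZero v r (insertZero v t)) (trans (cong (dot r) (Vecₚ.removeAt-insertAt t v false)) q)) nt) })

rowsOf : Fin n → List (Edge n) → List (Bits n)
rowsOf v E = List.catMaybes (factors v E)

-- Unification fills the hole with the function local to `deleteVertex`, which has no name here.
deletion : (E : List (Edge (suc k))) (v : Fin (suc k)) →
           Σ (Edge (suc k) → Maybe (Edge k)) λ f → edges (graph (suc k) E ─ v) ≡ List.mapMaybe f E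
deletion E v = _ , refl

-- At a loop on `v` the two sides differ: deletion drops it, whereas `factor` keeps it as the row
-- `𝟎`.
deletion-factor : (E : List (Edge (suc k))) (v : Fin (suc k)) (x y : Fin (suc k)) → x ≢ y →
                  Maybe.map (insertZero v ∘ erow) (proj₁ (deletion E v) (x , y)) ≡ factor v x y
deletion-factor E v x y x≢y with v Fin.≟ x | v Fin.≟ y
... | yes p | yes q = contradiction (trans (sym p) q) x≢y
... | yes p | no q  = refl
... | no p  | yes q = refl
... | no p  | no q  = cong just (trans (insertZero-⊕ v _ _) (cong₂ _⊕_ (lift p) (lift q)))
  where
  lift : ∀ {x} (p : v ≢ x) → insertZero v (unit (Fin.punchOut p)) ≡ unit x
  lift p = trans (insertZero-unit v _) (cong unit (Finₚ.punchIn-punchOut p))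

deletion-rows : (E : List (Edge (suc k))) (v : Fin (suc k)) → All NonLoop E →
                map (insertZero v) (map erow (edges (graph (suc k) E ─ v))) ≡ rowsOf v E
deletion-rows {k} E₀ v nonloop = go E₀ nonloop
  where
  f = proj₁ (deletion E₀ v)
  go : ∀ E → All NonLoop E → map (insertZero v) (map erow (List.mapMaybe f E)) ≡ rowsOf v E
  go []            []         = refl
  go ((x , y) ∷ E) (nl ∷ nls) with f (x , y) | deletion-factor E₀ v x y nl
  ... | nothing | eq = trans (go E nls) (cong (λ t → List.catMaybes (t ∷ factors v E)) eq)
  ... | just e  | eq = trans (cong (insertZero v (erow e) ∷_) (go E nls)) (cong (λ t → List.catMaybes (t ∷ factors v E)) eq)

-- The root `zero` of G ─ v is the vertex `punchIn v zero` of G, which becomes the second ground.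
nonzeros-deletion : (E : List (Edge (suc (suc k)))) (v : Fin (suc (suc k))) → All NonLoop E →
  nonzeros rooted (map erow (edges (graph (suc (suc k)) E ─ v))) ≡ nonzeros (Grounded v (Fin.punchIn v zero)) (rowsOf v E)
nonzeros-deletion {k} E v nonloop = begin
  nonzeros rooted Q
    ≡⟨ Σᵛ-cong (λ xs → cong ⟦_⟧ (poly-cong (λ F → transport (select Q F)) xs)) ⟩
  nonzeros (Grounded v (Fin.punchIn v zero) ∘ map (insertZero v)) Q
    ≡⟨ sym (nonzeros-map (insertZero v) (Grounded v (Fin.punchIn v zero)) Q) ⟩
  nonzeros (Grounded v (Fin.punchIn v zero)) (map (insertZero v) Q)
    ≡⟨ cong (nonzeros (Grounded v (Fin.punchIn v zero))) (deletion-rows E v nonloop) ⟩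
  nonzeros (Grounded v (Fin.punchIn v zero)) (rowsOf v E) ∎
  where
  open ≡-Reasoning
  Q = map erow (edges (graph (suc (suc k)) E ─ v))
  transport : ∀ A → rooted A ≡ Grounded v (Fin.punchIn v zero) (map (insertZero v) A)
  transport A = trans (sym (det-insertZero v (A ++ unit zero ∷ []))) (trans
    (cong (λ B → det (unit v ∷ B)) (trans (Listₚ.map-++ (insertZero v) A (unit zero ∷ [])) (cong (λ r → map (insertZero v) A ++ r ∷ []) (insertZero-unit v zero))))
    (det-↭ (↭-sym (shift (unit v) (map (insertZero v) A) (unit (Fin.punchIn v zero) ∷ [])))))

run-catMaybes : (fs : List (Maybe X)) (W : List X → List X → ℕ) → run fs W ≡ run (map just (List.catMaybes fs)) W
run-catMaybes []             W = refl
run-catMaybes (nothing ∷ fs) W = run-catMaybes fs W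
run-catMaybes (just r ∷ fs)  W = run-catMaybes fs _

rowsOf-star : (v : Fin n) (as : List (Fin n)) (E : List (Edge n)) → All (v ≢_) as → All (Avoids v) E →
              rowsOf v (map (v ,_) as ++ E) ≡ map erow E
rowsOf-star v [] [] [] [] = refl
rowsOf-star v [] ((x , y) ∷ E) [] ((v≢x , v≢y) ∷ av)
  rewrite dec-false (v Fin.≟ x) v≢x | dec-false (v Fin.≟ y) v≢y = cong (edge x y ∷_) (rowsOf-star v [] E [] av)
rowsOf-star v (a ∷ as) E (v≢a ∷ v≢as) av
  rewrite dec-true (v Fin.≟ v) refl | dec-false (v Fin.≟ a) v≢a = rowsOf-star v as E v≢as av

rowsOf-≈ : (v : Fin n) {E E′ : List (Edge n)} → E ≈ E′ → rowsOf v E ↭ rowsOf v E′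
rowsOf-≈ v q = catMaybes-↭ (map-≈ (factor-comm v) q)

-- The kernel of the rows of G ─ v contains the constant potential, which is all that a second ground removes.
reground : (v w w₀ : Fin n) → v ≢ w → v ≢ w₀ → (A : List (Bits n)) → Null A (Vec.map not (unit v)) → Grounded v w A ≡ Grounded v w₀ A
reground {n} v w w₀ v≢w v≢w₀ A null = trans (det-↭ (front w)) (trans
  (det-replace (A ++ unit v ∷ []) (true⇒≢𝟎 w (outer v≢w)) (Allₚ.++⁺ null (trans (dot-unit v z) inner ∷ [])) (unit w) (unit w₀)
    (trans (trans (dot-unit w z) (outer v≢w)) (sym (trans (dot-unit w₀ z) (outer v≢w₀)))))
  (det-↭ (↭-sym (front w₀))))
  where
  z = Vec.map not (unit v)
  inner : lookup z v ≡ false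
  inner = trans (Vecₚ.lookup-map v not (unit v)) (cong not (lookup-unit-self v))
  outer : ∀ {x} → v ≢ x → lookup z x ≡ true
  outer {x} v≢x = trans (Vecₚ.lookup-map x not (unit v)) (cong not (lookup-unit-other v≢x))
  front : ∀ x → A ++ unit v ∷ unit x ∷ [] ↭ unit x ∷ A ++ unit v ∷ []
  front x = ↭-trans (++⁺ˡ A (swap (unit v) (unit x) refl)) (shift (unit x) A (unit v ∷ []))

avoids-null : (v : Fin n) (E : List (Edge n)) → All (Avoids v) E → Null (map erow E) (Vec.map not (unit v))
avoids-null v [] [] = []
avoids-null v ((x , y) ∷ E) ((v≢x , v≢y) ∷ av) = trans (dot-edge x y _) (cong₂ _xor_ (outer v≢x) (outer v≢y)) ∷ avoids-null v E av
  where
  outer : ∀ {x} → v ≢ x → lookup (Vec.map not (unit v)) x ≡ true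
  outer {x} v≢x = trans (Vecₚ.lookup-map x not (unit v)) (cong not (lookup-unit-other v≢x))

nonzeros-reground : (v w w₀ : Fin n) → v ≢ w → v ≢ w₀ → (Q : List (Bits n)) → Null Q (Vec.map not (unit v)) →
                    nonzeros (Grounded v w) Q ≡ nonzeros (Grounded v w₀) Q
nonzeros-reground v w w₀ v≢w v≢w₀ Q null = Σᵛ-cong λ xs → cong ⟦_⟧
  (poly-cong (λ F → reground v w w₀ v≢w v≢w₀ (select Q F) (All-select null F)) xs)

-- The handshake lemma

ΣF : (Fin n → ℕ) → ℕ
ΣF {zero}  f = 0
ΣF {suc n} f = f zero + ΣF (λ i → f (suc i))

ΣF-cong : {f g : Fin n → ℕ} → (∀ i → f i ≡ g i) → ΣF f ≡ ΣF g
ΣF-cong {zero}  eq = refl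
ΣF-cong {suc n} eq = cong₂ _+_ (eq zero) (ΣF-cong (λ i → eq (suc i)))

ΣF-+ : (f g : Fin n → ℕ) → ΣF (λ i → f i + g i) ≡ ΣF f + ΣF g
ΣF-+ {zero}  f g = refl
ΣF-+ {suc n} f g = trans (cong (f zero + g zero +_) (ΣF-+ (λ i → f (suc i)) (λ i → g (suc i))))
  (+-interchange (f zero) (g zero) _ _)

ΣF-const : ∀ n c → ΣF {n} (λ _ → c) ≡ n * c
ΣF-const zero    c = refl
ΣF-const (suc n) c = cong (c +_) (ΣF-const n c)

ΣF-indicator : (x : Fin n) → ΣF (λ i → ⟦ does (i Fin.≟ x) ⟧) ≡ 1
ΣF-indicator {suc n} zero    = cong suc (trans (ΣF-const n 0) (ℕₚ.*-zeroʳ n))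
ΣF-indicator {suc n} (suc x) = ΣF-indicator x

handshake : (E : List (Edge n)) → ΣF (λ u → deg u E) ≡ length E * 2
handshake {n} []            = trans (ΣF-const n 0) (ℕₚ.*-zeroʳ n)
handshake     ((x , y) ∷ E) = trans (ΣF-+ (λ u → ⟦ does (u Fin.≟ x) ⟧ + ⟦ does (u Fin.≟ y) ⟧) (λ u → deg u E))
  (cong₂ _+_ (trans (ΣF-+ (λ u → ⟦ does (u Fin.≟ x) ⟧) (λ u → ⟦ does (u Fin.≟ y) ⟧)) (cong₂ _+_ (ΣF-indicator x) (ΣF-indicator y)))
             (handshake E))

-- 4-regular graphs with at least five vertices

module Regular (E : List (Edge n)) (nonloop : All NonLoop E) (regular : ∀ u → deg u E ≡ 4) where

  length-E : length E ≡ n + n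
  length-E = ℕₚ.*-cancelʳ-≡ (length E) (n + n) 2 (trans (sym (handshake E)) (trans (ΣF-cong regular) (trans (ΣF-const n 4) (shape n))))
    where
    shape : ∀ n → n * 4 ≡ (n + n) * 2
    shape = solve-∀

  rowsOf-length : ∀ v → length (rowsOf v E) + 4 ≡ n + n
  rowsOf-length v with pull v E nonloop
  ... | as , E₁ , E≈ , len , av , v≢as = begin
    length (rowsOf v E) + 4                       ≡⟨ cong (_+ 4) (↭-length (rowsOf-≈ v E≈)) ⟩
    length (rowsOf v (map (v ,_) as ++ E₁)) + 4   ≡⟨ cong (λ l → length l + 4) (rowsOf-star v as E₁ v≢as av) ⟩
    length (map erow E₁) + 4                      ≡⟨ cong (_+ 4) (Listₚ.length-map erow E₁) ⟩
    length E₁ + 4                                 ≡⟨ ℕₚ.+-comm (length E₁) 4 ⟩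
    4 + length E₁                                 ≡⟨ cong (_+ length E₁) (sym (trans len (regular v))) ⟩
    length as + length E₁                         ≡⟨ cong (_+ length E₁) (sym (Listₚ.length-map (v ,_) as)) ⟩
    length (map (v ,_) as) + length E₁            ≡⟨ sym (Listₚ.length-++ (map (v ,_) as)) ⟩
    length (map (v ,_) as ++ E₁)                  ≡⟨ sym (≈-length E≈) ⟩
    length E                                      ≡⟨ length-E ⟩
    n + n                                         ∎
    where open ≡-Reasoning

  module _ (n≥5 : 5 ≤ n) where

    -- The local analysis wants its second ground at a suitable neighbour `w` of `v`; `reground`
    -- moves it there from `w₀` and back.
    nonzeros≡treePairs : ∀ v w₀ → v ≢ w₀ →
      nonzeros (Grounded v w₀) (rowsOf v E) % 8 ≡ treePairs v (unit v ∷ unit w₀ ∷ []) E % 8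
    nonzeros≡treePairs v w₀ v≢w₀ with pull v E nonloop
    ... | as , E₁ , E≈ , len , av , v≢as with as | trans len (regular v)
    ... | a ∷ b ∷ c ∷ d ∷ [] | refl = conclude (neighbours a b c d)
      where
      star = map (v ,_) (a ∷ b ∷ c ∷ d ∷ [])
      rows : rowsOf v E ↭ map erow E₁
      rows = subst (rowsOf v E ↭_) (rowsOf-star v (a ∷ b ∷ c ∷ d ∷ []) E₁ v≢as av) (rowsOf-≈ v E≈)
      nonloop₁ : All NonLoop E₁
      nonloop₁ = nonLoop-++ star E≈ nonloop
      size : length E₁ + 4 ≡ n + n
      size = trans (ℕₚ.+-comm (length E₁) 4) (trans (sym (≈-length E≈)) length-E)
      degree₁ : ∀ w → v ≢ w → occurrences w (a ∷ b ∷ c ∷ d ∷ []) + deg w E₁ ≡ 4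
      degree₁ w v≢w = trans (sym (deg-star w v (a ∷ b ∷ c ∷ d ∷ []) E₁ (v≢w ∘ sym))) (trans (sym (deg-≈ w E≈)) (regular w))
      remaining : ∀ w p q → v ≢ w → occurrences w (a ∷ b ∷ c ∷ d ∷ []) ≡ p → p + q ≡ 4 → deg w E₁ ≡ q
      remaining w p q v≢w occ eq = ℕₚ.+-cancelˡ-≡ p _ _ (trans (cong (_+ deg w E₁) (sym occ)) (trans (degree₁ w v≢w) (sym eq)))
      from : ∀ w → v ≢ w → Agrees v w E₁ → nonzeros (Grounded v w₀) (rowsOf v E) % 8 ≡ treePairs v (unit v ∷ unit w₀ ∷ []) E % 8
      from w v≢w agrees = begin
        nonzeros (Grounded v w₀) (rowsOf v E) % 8
          ≡⟨ cong (_% 8) (nonzeros-↭ (Φ-sym (unit v ∷ unit w₀ ∷ [])) rows) ⟩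
        nonzeros (Grounded v w₀) (map erow E₁) % 8
          ≡⟨ cong (_% 8) (nonzeros-reground v w₀ w v≢w₀ v≢w (map erow E₁) null) ⟩
        nonzeros (Grounded v w) (map erow E₁) % 8
          ≡⟨ agrees ⟩
        run (map just (map erow E₁)) (pairWeight (Grounded v w)) % 8
          ≡⟨ cong (_% 8) (run-cong (map just (map erow E₁)) (All-just null) (λ A B nA nB →
               cong₂ (λ x y → ⟦ x ⟧ * ⟦ y ⟧) (reground v w w₀ v≢w v≢w₀ A nA) (reground v w w₀ v≢w v≢w₀ B nB))) ⟩
        run (map just (map erow E₁)) (pairWeight (Grounded v w₀)) % 8
          ≡⟨ cong (_% 8) (run-↭ (pairWeight-sym (unit v ∷ unit w₀ ∷ [])) (map⁺ just (↭-sym rows))) ⟩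
        run (map just (rowsOf v E)) (pairWeight (Grounded v w₀)) % 8
          ≡⟨ cong (_% 8) (sym (run-catMaybes (factors v E) (pairWeight (Grounded v w₀)))) ⟩
        treePairs v (unit v ∷ unit w₀ ∷ []) E % 8 ∎
        where
        open ≡-Reasoning
        null : Null (map erow E₁) (Vec.map not (unit v))
        null = avoids-null v E₁ av
      conclude : Neighbours (a ∷ b ∷ c ∷ d ∷ []) → nonzeros (Grounded v w₀) (rowsOf v E) % 8 ≡ treePairs v (unit v ∷ unit w₀ ∷ []) E % 8
      conclude (single w w∈ occ) = from w v≢w (at-single v E₁ av nonloop₁ n≥5 size w v≢w (remaining w 1 3 v≢w occ refl))
        where v≢w = All.lookup v≢as w∈
      conclude (quad w w∈ occ) = from w v≢w (at-quad v E₁ av nonloop₁ n≥5 size w v≢w (remaining w 4 0 v≢w occ refl))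
        where v≢w = All.lookup v≢as w∈
      conclude (doubles w w′ w≢w′ w∈ w′∈ occ occ′) = from w v≢w (at-doubles v E₁ av nonloop₁ n≥5 size w w′ v≢w v≢w′ w≢w′
          (remaining w 2 2 v≢w occ refl) (remaining w′ 2 2 v≢w′ occ′ refl))
        where
        v≢w  = All.lookup v≢as w∈
        v≢w′ = All.lookup v≢as w′∈

    -- Rooting G ─ v at `w` and G ─ w at `v` grounds the same two vertices, so both tree counts use
    -- the same `Z` up to order and `treePairs-swap` applies.
    nonzeros-invariant : ∀ v w → v ≢ w → nonzeros (Grounded v w) (rowsOf v E) % 8 ≡ nonzeros (Grounded w v) (rowsOf w E) % 8
    nonzeros-invariant v w v≢w = trans (nonzeros≡treePairs v w v≢w) (trans (cong (_% 8)
      (trans (treePairs-swap v w U Z E apart (Uniqueₚ.filter⁺ other? (Uniqueₚ.allFin⁺ n)) nonloop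
                 (All.universal (λ (x , y) → covers x , covers y) E) (All.universal regular U)
                 (unit-closed v ∷ unit-closed w ∷ []) (All.map (λ (v≢u , w≢u) → null v≢u ∷ null w≢u ∷ []) apart))
               (run-ext (factors w E) λ A B → cong₂ (λ x y → ⟦ x ⟧ * ⟦ y ⟧)
                 (det-↭ (++⁺ˡ A (swap _ _ refl))) (det-↭ (++⁺ˡ B (swap _ _ refl))))))
      (sym (nonzeros≡treePairs w v (v≢w ∘ sym))))
      where
      Z = unit v ∷ unit w ∷ []
      other? : ∀ u → Dec (v ≢ u × w ≢ u)
      other? u = ¬? (v Fin.≟ u) ×-dec ¬? (w Fin.≟ u)
      U = List.filter other? (List.allFin n)
      apart : All (λ u → v ≢ u × w ≢ u) U
      apart = Allₚ.all-filter other? (List.allFin n)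
      null : ∀ {x u} → x ≢ u → dot (unit x) (unit u) ≡ false
      null {x} {u} x≢u = trans (dot-unit x (unit u)) (lookup-unit-other (x≢u ∘ sym))
      covers : ∀ x → x ∈ v ∷ w ∷ U
      covers x with v Fin.≟ x | w Fin.≟ x
      ... | yes refl | _          = here refl
      ... | no _       | yes refl = there (here refl)
      ... | no v≢x     | no w≢x     = there (there (∈-filter⁺ other? (∈-allFin x) (v≢x , w≢x)))

-- On four vertices Ψ can be odd at a number of points not congruent to the number of tree pairs
-- modulo 8; graphs with at most four vertices are listed by their edge multiplicities instead.

canonical : (es : List (Edge n)) → Vec ℕ (length es) → List (Edge n)
canonical []       []       = []
canonical (e ∷ es) (m ∷ ms) = List.replicate m e ++ canonical es ms

++-≈ : (D : List (Edge n)) {E E′ : List (Edge n)} → E ≈ E′ → D ++ E ≈ D ++ E′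
++-≈ []      q = q
++-≈ (e ∷ D) q = prep e (++-≈ D q)

insert-canonical : (es : List (Edge n)) (ms : Vec ℕ (length es)) (i : Fin (length es)) →
                   List.lookup es i ∷ canonical es ms ≈ canonical es (Vec.updateAt ms i suc)
insert-canonical (e ∷ es) (m ∷ ms) zero    = refl
insert-canonical (e ∷ es) (m ∷ ms) (suc i) =
  ≈-trans (shift-≈ _ (List.replicate m e) (canonical es ms)) (++-≈ (List.replicate m e) (insert-canonical es ms i))

Complete : List (Edge n) → Set
Complete {n} es = (x y : Fin n) → x ≢ y → ∃ λ i → List.lookup es i ≡ (x , y) ⊎ List.lookup es i ≡ (y , x)

none : (es : List (Edge n)) → ∃ λ ms → [] ≈ canonical es ms
none []       = [] , refl
none (e ∷ es) with none es
... | ms , q = 0 ∷ ms , q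

classify : (es : List (Edge n)) → Complete es → (E : List (Edge n)) → All NonLoop E → ∃ λ ms → E ≈ canonical es ms
classify es complete []            []         = none es
classify es complete ((x , y) ∷ E) (nl ∷ nls) with classify es complete E nls | complete x y nl
... | ms , q | i , inj₁ eq = Vec.updateAt ms i suc ,
  ≈-trans (prep _ q) (subst (λ e → e ∷ canonical es ms ≈ canonical es (Vec.updateAt ms i suc)) eq (insert-canonical es ms i))
... | ms , q | i , inj₂ eq = Vec.updateAt ms i suc ,
  ≈-trans (prep _ q) (≈-trans (flip x y) (subst (λ e → e ∷ canonical es ms ≈ canonical es (Vec.updateAt ms i suc)) eq (insert-canonical es ms i)))

weightedDegree : Fin n → (es : List (Edge n)) → Vec ℕ (length es) → ℕ
weightedDegree u []             []       = 0
weightedDegree u ((x , y) ∷ es) (m ∷ ms) = m * (⟦ does (u Fin.≟ x) ⟧ + ⟦ does (u Fin.≟ y) ⟧) + weightedDegree u es ms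

deg-canonical : (u : Fin n) (es : List (Edge n)) (ms : Vec ℕ (length es)) → deg u (canonical es ms) ≡ weightedDegree u es ms
deg-canonical u []             []       = refl
deg-canonical u ((x , y) ∷ es) (m ∷ ms) = go m
  where
  d = ⟦ does (u Fin.≟ x) ⟧ + ⟦ does (u Fin.≟ y) ⟧
  go : ∀ m → deg u (List.replicate m (x , y) ++ canonical es ms) ≡ m * d + weightedDegree u es ms
  go zero    = deg-canonical u es ms
  go (suc m) = trans (cong (d +_) (go m)) (sym (ℕₚ.+-assoc d (m * d) _))

nonzeros₈ : Fin (suc (suc k)) → List (Edge (suc (suc k))) → ℕ
nonzeros₈ v E = nonzeros (Grounded v (Fin.punchIn v zero)) (rowsOf v E) % 8

nonzeros₈-≈ : (v : Fin (suc (suc k))) {E E′ : List (Edge (suc (suc k)))} → E ≈ E′ → nonzeros₈ v E ≡ nonzeros₈ v E′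
nonzeros₈-≈ v q = cong (_% 8) (nonzeros-↭ (Φ-sym (unit v ∷ unit (Fin.punchIn v zero) ∷ [])) (rowsOf-≈ v q))

edges₂ : List (Edge 2)
edges₂ = (0F , 1F) ∷ []

edges₃ : List (Edge 3)
edges₃ = (0F , 1F) ∷ (0F , 2F) ∷ (1F , 2F) ∷ []

edges₄ : List (Edge 4)
edges₄ = (0F , 1F) ∷ (0F , 2F) ∷ (0F , 3F) ∷ (1F , 2F) ∷ (1F , 3F) ∷ (2F , 3F) ∷ []

complete2 : Complete edges₂
complete2 zero zero x≢y = contradiction refl x≢y
complete2 zero (suc zero) x≢y = zero , inj₁ refl
complete2 (suc zero) zero x≢y = zero , inj₂ refl
complete2 (suc zero) (suc zero) x≢y = contradiction refl x≢y

complete3 : Complete edges₃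
complete3 zero zero x≢y = contradiction refl x≢y
complete3 zero (suc zero) x≢y = zero , inj₁ refl
complete3 zero (suc (suc zero)) x≢y = (suc zero) , inj₁ refl
complete3 (suc zero) zero x≢y = zero , inj₂ refl
complete3 (suc zero) (suc zero) x≢y = contradiction refl x≢y
complete3 (suc zero) (suc (suc zero)) x≢y = (suc (suc zero)) , inj₁ refl
complete3 (suc (suc zero)) zero x≢y = (suc zero) , inj₂ refl
complete3 (suc (suc zero)) (suc zero) x≢y = (suc (suc zero)) , inj₂ refl
complete3 (suc (suc zero)) (suc (suc zero)) x≢y = contradiction refl x≢y

complete4 : Complete edges₄
complete4 zero zero x≢y = contradiction refl x≢y
complete4 zero (suc zero) x≢y = zero , inj₁ refl
complete4 zero (suc (suc zero)) x≢y = (suc zero) , inj₁ refl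
complete4 zero (suc (suc (suc zero))) x≢y = (suc (suc zero)) , inj₁ refl
complete4 (suc zero) zero x≢y = zero , inj₂ refl
complete4 (suc zero) (suc zero) x≢y = contradiction refl x≢y
complete4 (suc zero) (suc (suc zero)) x≢y = (suc (suc (suc zero))) , inj₁ refl
complete4 (suc zero) (suc (suc (suc zero))) x≢y = (suc (suc (suc (suc zero)))) , inj₁ refl
complete4 (suc (suc zero)) zero x≢y = (suc zero) , inj₂ refl
complete4 (suc (suc zero)) (suc zero) x≢y = (suc (suc (suc zero))) , inj₂ refl
complete4 (suc (suc zero)) (suc (suc zero)) x≢y = contradiction refl x≢y
complete4 (suc (suc zero)) (suc (suc (suc zero))) x≢y = (suc (suc (suc (suc (suc zero))))) , inj₁ refl
complete4 (suc (suc (suc zero))) zero x≢y = (suc (suc zero)) , inj₂ refl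
complete4 (suc (suc (suc zero))) (suc zero) x≢y = (suc (suc (suc (suc zero)))) , inj₂ refl
complete4 (suc (suc (suc zero))) (suc (suc zero)) x≢y = (suc (suc (suc (suc (suc zero))))) , inj₂ refl
complete4 (suc (suc (suc zero))) (suc (suc (suc zero))) x≢y = contradiction refl x≢y

opaque
  unfolding det

  check₂ : ∀ v → nonzeros₈ v (canonical edges₂ (4 ∷ [])) ≡ nonzeros₈ 0F (canonical edges₂ (4 ∷ []))
  check₂ 0F = refl
  check₂ 1F = refl

  check₃ : ∀ v → nonzeros₈ v (canonical edges₃ (2 ∷ 2 ∷ 2 ∷ [])) ≡ nonzeros₈ 0F (canonical edges₃ (2 ∷ 2 ∷ 2 ∷ []))
  check₃ 0F = refl
  check₃ 1F = refl
  check₃ 2F = refl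

  -- 4-regularity forces opposite edges of the complete graph to have equal multiplicities, whence
  -- the palindrome; the 15 solutions of `a + b + c ≡ 4` are settled by evaluation.
  check₄ : ∀ a b c → a + b + c ≡ 4 → ∀ v →
           nonzeros₈ v (canonical edges₄ (a ∷ b ∷ c ∷ c ∷ b ∷ a ∷ [])) ≡ nonzeros₈ 0F (canonical edges₄ (a ∷ b ∷ c ∷ c ∷ b ∷ a ∷ []))
  check₄ = go
    where
    fins : {P : Fin 4 → ℕ} → P 1F ≡ P 0F → P 2F ≡ P 0F → P 3F ≡ P 0F → ∀ v → P v ≡ P 0F
    fins p q r 0F = refl
    fins p q r 1F = p
    fins p q r 2F = q
    fins p q r 3F = r
    go : ∀ a b c → a + b + c ≡ 4 → ∀ v →
         nonzeros₈ v (canonical edges₄ (a ∷ b ∷ c ∷ c ∷ b ∷ a ∷ [])) ≡ nonzeros₈ 0F (canonical edges₄ (a ∷ b ∷ c ∷ c ∷ b ∷ a ∷ []))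
    go 0 0 .4 refl = fins refl refl refl
    go 0 1 .3 refl = fins refl refl refl
    go 0 2 .2 refl = fins refl refl refl
    go 0 3 .1 refl = fins refl refl refl
    go 0 4 .0 refl = fins refl refl refl
    go 0 (suc (suc (suc (suc (suc b))))) c ()
    go 1 0 .3 refl = fins refl refl refl
    go 1 1 .2 refl = fins refl refl refl
    go 1 2 .1 refl = fins refl refl refl
    go 1 3 .0 refl = fins refl refl refl
    go 1 (suc (suc (suc (suc b)))) c ()
    go 2 0 .2 refl = fins refl refl refl
    go 2 1 .1 refl = fins refl refl refl
    go 2 2 .0 refl = fins refl refl refl
    go 2 (suc (suc (suc b))) c ()
    go 3 0 .1 refl = fins refl refl refl
    go 3 1 .0 refl = fins refl refl refl
    go 3 (suc (suc b)) c ()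
    go 4 0 .0 refl = fins refl refl refl
    go 4 (suc b) c ()
    go (suc (suc (suc (suc (suc a))))) b c ()

invariant₂ : (E : List (Edge 2)) → All NonLoop E → (∀ u → deg u E ≡ 4) → ∀ v w → nonzeros₈ v E ≡ nonzeros₈ w E
invariant₂ E nonloop regular v w with classify edges₂ complete2 E nonloop
... | p ∷ [] , q = trans (const v) (sym (const w))
  where
  p≡4 : p ≡ 4
  p≡4 = trans (shape p) (trans (sym (deg-canonical 0F edges₂ (p ∷ []))) (trans (sym (deg-≈ 0F q)) (regular 0F)))
    where
    shape : ∀ p → p ≡ p * 1 + 0
    shape = solve-∀
  const : ∀ v → nonzeros₈ v E ≡ nonzeros₈ 0F (canonical edges₂ (4 ∷ []))
  const v = trans (nonzeros₈-≈ v q) (trans (cong (λ p → nonzeros₈ v (canonical edges₂ (p ∷ []))) p≡4) (check₂ v))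

halve : ∀ a b → a + a ≡ b + b → a ≡ b
halve a b eq = ℕₚ.*-cancelʳ-≡ a b 2 (trans (shape a) (trans eq (sym (shape b))))
  where
  shape : ∀ a → a * 2 ≡ a + a
  shape = solve-∀

invariant₃ : (E : List (Edge 3)) → All NonLoop E → (∀ u → deg u E ≡ 4) → ∀ v w → nonzeros₈ v E ≡ nonzeros₈ w E
invariant₃ E nonloop regular v w with classify edges₃ complete3 E nonloop
... | p ∷ q ∷ r ∷ [] , E≈ = trans (const v) (sym (const w))
  where
  degree≡4 : ∀ u → weightedDegree u edges₃ (p ∷ q ∷ r ∷ []) ≡ 4
  degree≡4 u = trans (sym (deg-canonical u edges₃ (p ∷ q ∷ r ∷ []))) (trans (sym (deg-≈ u E≈)) (regular u))
  d₀ : p + q ≡ 4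
  d₀ = trans (shape p q r) (degree≡4 0F)
    where
    shape : ∀ p q r → p + q ≡ p * 1 + (q * 1 + (r * 0 + 0))
    shape = solve-∀
  d₁ : p + r ≡ 4
  d₁ = trans (shape p q r) (degree≡4 1F)
    where
    shape : ∀ p q r → p + r ≡ p * 1 + (q * 0 + (r * 1 + 0))
    shape = solve-∀
  d₂ : q + r ≡ 4
  d₂ = trans (shape p q r) (degree≡4 2F)
    where
    shape : ∀ p q r → q + r ≡ p * 0 + (q * 1 + (r * 1 + 0))
    shape = solve-∀
  q≡r : q ≡ r
  q≡r = ℕₚ.+-cancelˡ-≡ p q r (trans d₀ (sym d₁))
  p≡r : p ≡ r
  p≡r = ℕₚ.+-cancelʳ-≡ q p r (trans d₀ (trans (sym d₂) (ℕₚ.+-comm q r)))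
  r≡2 : r ≡ 2
  r≡2 = halve r 2 (trans (cong (_+ r) (sym p≡r)) d₁)
  const : ∀ v → nonzeros₈ v E ≡ nonzeros₈ 0F (canonical edges₃ (2 ∷ 2 ∷ 2 ∷ []))
  const v = trans (nonzeros₈-≈ v E≈) (trans (cong (λ ms → nonzeros₈ v (canonical edges₃ ms))
    (cong₂ _∷_ (trans p≡r r≡2) (cong₂ _∷_ (trans q≡r r≡2) (cong (_∷ []) r≡2)))) (check₃ v))

invariant₄ : (E : List (Edge 4)) → All NonLoop E → (∀ u → deg u E ≡ 4) → ∀ v w → nonzeros₈ v E ≡ nonzeros₈ w E
invariant₄ E nonloop regular v w with classify edges₄ complete4 E nonloop
... | a ∷ b ∷ c ∷ d ∷ e ∷ f ∷ [] , E≈ = trans (const v) (sym (const w))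
  where
  ms = a ∷ b ∷ c ∷ d ∷ e ∷ f ∷ []
  degree≡4 : ∀ u → weightedDegree u edges₄ ms ≡ 4
  degree≡4 u = trans (sym (deg-canonical u edges₄ ms)) (trans (sym (deg-≈ u E≈)) (regular u))
  d₀ : a + b + c ≡ 4
  d₀ = trans (shape a b c d e f) (degree≡4 0F)
    where
    shape : ∀ a b c d e f → a + b + c ≡ a * 1 + (b * 1 + (c * 1 + (d * 0 + (e * 0 + (f * 0 + 0)))))
    shape = solve-∀
  d₁ : a + d + e ≡ 4
  d₁ = trans (shape a b c d e f) (degree≡4 1F)
    where
    shape : ∀ a b c d e f → a + d + e ≡ a * 1 + (b * 0 + (c * 0 + (d * 1 + (e * 1 + (f * 0 + 0)))))
    shape = solve-∀
  d₂ : b + d + f ≡ 4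
  d₂ = trans (shape a b c d e f) (degree≡4 2F)
    where
    shape : ∀ a b c d e f → b + d + f ≡ a * 0 + (b * 1 + (c * 0 + (d * 1 + (e * 0 + (f * 1 + 0)))))
    shape = solve-∀
  d₃ : c + e + f ≡ 4
  d₃ = trans (shape a b c d e f) (degree≡4 3F)
    where
    shape : ∀ a b c d e f → c + e + f ≡ a * 0 + (b * 0 + (c * 1 + (d * 0 + (e * 1 + (f * 1 + 0)))))
    shape = solve-∀
  -- Compare the degree sum of vertices 1 and 2 with that of vertices 0 and 3: the edges between the
  -- two pairs cancel and leave twice `d` and twice `c`.
  d≡c : d ≡ c
  d≡c = halve d c (ℕₚ.+-cancelˡ-≡ (a + b + e + f) _ _ (trans (lhs a b d e f)
    (trans (cong₂ _+_ d₁ d₂) (trans (sym (cong₂ _+_ d₀ d₃)) (rhs a b c e f)))))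
    where
    lhs : ∀ a b d e f → a + b + e + f + (d + d) ≡ (a + d + e) + (b + d + f)
    lhs = solve-∀
    rhs : ∀ a b c e f → (a + b + c) + (c + e + f) ≡ a + b + e + f + (c + c)
    rhs = solve-∀
  e≡b : e ≡ b
  e≡b = ℕₚ.+-cancelˡ-≡ (a + d) e b (trans d₁ (trans (sym d₀) (trans (swap₂₃ a b c) (cong (λ x → a + x + b) (sym d≡c)))))
    where
    swap₂₃ : ∀ a b c → a + b + c ≡ a + c + b
    swap₂₃ = solve-∀
  f≡a : f ≡ a
  f≡a = ℕₚ.+-cancelˡ-≡ (b + d) f a (trans d₂ (trans (sym d₀) (trans (rotate a b c) (cong (λ x → b + x + a) (sym d≡c)))))
    where
    rotate : ∀ a b c → a + b + c ≡ b + c + a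
    rotate = solve-∀
  const : ∀ v → nonzeros₈ v E ≡ nonzeros₈ 0F (canonical edges₄ (a ∷ b ∷ c ∷ c ∷ b ∷ a ∷ []))
  const v = trans (nonzeros₈-≈ v E≈) (trans (cong (λ ms → nonzeros₈ v (canonical edges₄ (a ∷ b ∷ c ∷ ms)))
    (cong₂ _∷_ d≡c (cong₂ _∷_ e≡b (cong (_∷ []) f≡a)))) (check₄ a b c d₀ v))

nonzeros₈-invariant : (E : List (Edge (suc (suc k)))) → All NonLoop E → (∀ u → deg u E ≡ 4) → ∀ v w → nonzeros₈ v E ≡ nonzeros₈ w E
nonzeros₈-invariant {0} E nonloop regular v w = invariant₂ E nonloop regular v w
nonzeros₈-invariant {1} E nonloop regular v w = invariant₃ E nonloop regular v w
nonzeros₈-invariant {2} E nonloop regular v w = invariant₄ E nonloop regular v w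
nonzeros₈-invariant {suc (suc (suc k))} E nonloop regular v w with v Fin.≟ w
... | yes refl = refl
... | no v≢w     = trans (toward v w v≢w) (trans
    (Regular.nonzeros-invariant E nonloop regular (s≤s (s≤s (s≤s (s≤s (s≤s z≤n))))) v w v≢w) (sym (toward w v (v≢w ∘ sym))))
  where
  rows-null : ∀ v → Null (rowsOf v E) (Vec.map not (unit v))
  rows-null v with pull v E nonloop
  ... | as , E₁ , E≈ , _ , av , v≢as = All-resp-↭
    (↭-sym (subst (rowsOf v E ↭_) (rowsOf-star v as E₁ v≢as av) (rowsOf-≈ v E≈))) (avoids-null v E₁ av)
  toward : ∀ v w → v ≢ w → nonzeros₈ v E ≡ nonzeros (Grounded v w) (rowsOf v E) % 8
  toward v w v≢w = cong (_% 8) (nonzeros-reground v (Fin.punchIn v zero) w (λ eq → Finₚ.punchInᵢ≢i v zero (sym eq)) v≢w (rowsOf v E) (rows-null v))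

-- From counts modulo 8 to the invariant

degree-deg : (E : List (Edge n)) (u : Fin n) → degree (graph n E) u ≡ deg u E
degree-deg []            u = refl
degree-deg ((x , y) ∷ E) u = trans (cong₂ _+_ (count-∷ proj₁ (x , y) E) (count-∷ proj₂ (x , y) E)) (trans
  (+-interchange ⟦ does (x Fin.≟ u) ⟧ _ ⟦ does (y Fin.≟ u) ⟧ _) (cong₂ _+_ (cong₂ _+_ (symmetric x) (symmetric y)) (degree-deg E u)))
  where
  count-∷ : (f : Edge _ → Fin _) (e : Edge _) (E : List (Edge _)) →
            length (List.filter (λ e → f e Fin.≟ u) (e ∷ E)) ≡ ⟦ does (f e Fin.≟ u) ⟧ + length (List.filter (λ e → f e Fin.≟ u) E)
  count-∷ f e E with does (f e Fin.≟ u)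
  ... | true  = refl
  ... | false = refl
  symmetric : ∀ x → ⟦ does (x Fin.≟ u) ⟧ ≡ ⟦ does (u Fin.≟ x) ⟧
  symmetric x with x Fin.≟ u
  ... | yes refl = cong ⟦_⟧ (sym (dec-true (u Fin.≟ u) refl))
  ... | no x≢u     = cong ⟦_⟧ (sym (dec-false (u Fin.≟ x) (x≢u ∘ sym)))

loopless⇒nonLoop : (E : List (Edge n)) → Loopless (graph n E) → All NonLoop E
loopless⇒nonLoop []      ll = []
loopless⇒nonLoop (e ∷ E) ll = ll zero ∷ loopless⇒nonLoop E (λ i → ll (suc i))

-- Add 7·b to both sides.
%8-cancel : ∀ a b c d → a + b ≡ c + d → b % 8 ≡ d % 8 → a % 8 ≡ c % 8
%8-cancel a b c d eq b≡d = begin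
  a % 8                             ≡⟨ sym ([m+kn]%n≡m%n a b 8) ⟩
  (a + b * 8) % 8                   ≡⟨ cong (_% 8) (trans (shape a b) (cong (_+ 7 * b) eq)) ⟩
  (c + d + 7 * b) % 8               ≡⟨ cong (_% 8) (ℕₚ.+-assoc c d (7 * b)) ⟩
  (c + (d + 7 * b)) % 8             ≡⟨ %-distribˡ-+ c (d + 7 * b) 8 ⟩
  (c % 8 + (d + 7 * b) % 8) % 8     ≡⟨ cong (λ x → (c % 8 + x) % 8) vanish ⟩
  (c % 8 + (b * 8) % 8) % 8         ≡⟨ sym (%-distribˡ-+ c (b * 8) 8) ⟩
  (c + b * 8) % 8                   ≡⟨ [m+kn]%n≡m%n c b 8 ⟩
  c % 8                             ∎
  where
  open ≡-Reasoning
  shape : ∀ a b → a + b * 8 ≡ a + b + 7 * b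
  shape = solve-∀
  eight : ∀ b → b + 7 * b ≡ b * 8
  eight = solve-∀
  vanish : (d + 7 * b) % 8 ≡ (b * 8) % 8
  vanish = begin
    (d + 7 * b) % 8                 ≡⟨ %-distribˡ-+ d (7 * b) 8 ⟩
    (d % 8 + (7 * b) % 8) % 8       ≡⟨ cong (λ x → (x + (7 * b) % 8) % 8) (sym b≡d) ⟩
    (b % 8 + (7 * b) % 8) % 8       ≡⟨ sym (%-distribˡ-+ b (7 * b) 8) ⟩
    (b + 7 * b) % 8                 ≡⟨ cong (_% 8) (eight b) ⟩
    (b * 8) % 8                     ∎

theorem6p1 : (G : Graph) → Loopless G → Connected G → (∀ u → degree G u ≡ 4)
    → (v w : Fin (nV G))
    → (Lv : List (EdgeSet (G ─ v))) → EnumeratesSpanningTrees (G ─ v) Lv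
    → (Lw : List (EdgeSet (G ─ w))) → EnumeratesSpanningTrees (G ─ w) Lw
    → c2 2 (G ─ v) Lv ≡ c2 2 (G ─ w) Lw
theorem6p1 (graph zero E) _ _ _ ()
theorem6p1 (graph 1 []) _ _ regular v w Lv trees-v Lw trees-w = contradiction (regular zero) λ ()
theorem6p1 (graph 1 ((zero , zero) ∷ E)) loopless _ _ v w Lv trees-v Lw trees-w = contradiction refl (loopless zero)
theorem6p1 (graph (suc (suc k)) E) loopless _ regular v w Lv trees-v Lw trees-w = begin
  -- The invariant is the bit of weight 4 of the number of zeros, so it can be read off the residue
  -- modulo 8.
  zeroCount 2 Hv Lv / 4 % 2       ≡⟨ sym (m%[n*o]/o≡m/o%n (zeroCount 2 Hv Lv) 2 4) ⟩
  zeroCount 2 Hv Lv % 8 / 4       ≡⟨ cong (_/ 4) zeros≡ ⟩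
  zeroCount 2 Hw Lw % 8 / 4       ≡⟨ m%[n*o]/o≡m/o%n (zeroCount 2 Hw Lw) 2 4 ⟩
  zeroCount 2 Hw Lw / 4 % 2       ∎
  where
  open ≡-Reasoning
  Hv = graph (suc (suc k)) E ─ v
  Hw = graph (suc (suc k)) E ─ w
  nonloop : All NonLoop E
  nonloop = loopless⇒nonLoop E loopless
  regular′ : ∀ u → deg u E ≡ 4
  regular′ u = trans (sym (degree-deg E u)) (regular u)
  size : ∀ x → length (edges (graph (suc (suc k)) E ─ x)) + 4 ≡ suc (suc k) + suc (suc k)
  size x = trans (cong (_+ 4) (trans (sym (trans (Listₚ.length-map (insertZero x) (map erow (edges (graph (suc (suc k)) E ─ x)))) (Listₚ.length-map erow (edges (graph (suc (suc k)) E ─ x)))))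
    (cong length (deletion-rows E x nonloop)))) (Regular.rowsOf-length E nonloop regular′ x)
  zeros≡ : zeroCount 2 Hv Lv % 8 ≡ zeroCount 2 Hw Lw % 8
  zeros≡ = %8-cancel (zeroCount 2 Hv Lv) (nonzeros rooted (map erow (edges Hv))) (zeroCount 2 Hw Lw) (nonzeros rooted (map erow (edges Hw)))
    (trans (zeros+nonzeros (edges Hv) Lv trees-v) (trans
      (cong (2 ^_) (ℕₚ.+-cancelʳ-≡ 4 _ _ (trans (size v) (sym (size w))))) (sym (zeros+nonzeros (edges Hw) Lw trees-w))))
    (trans (cong (_% 8) (nonzeros-deletion E v nonloop)) (trans (nonzeros₈-invariant E nonloop regular′ v w)
      (cong (_% 8) (sym (nonzeros-deletion E w nonloop)))))
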